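{- Let $\mathcal G$ be a class of (finite, undirected) graphs. The following four statements are equivalent. (1) $\mathcal G$ has structurally bounded treedepth, i.e., there exist a graph class $\mathcal G'$ of bounded treedepth and a first-order transduction $\tau$ such that $\mathcal G \subseteq \tau(\mathcal G')$. (2) There exists a number $d$ such that every graph in $\mathcal G$ has a lacon-decomposition $(L,\pi)$ with $\mathrm{wcol}_\infty(L,\pi)\le d$. (3) There exist a number $d$ and a signature $S$ such that every graph in $\mathcal G$ has a shrub-decomposition $(F,S)$ with one color, diameter at most $d$, and such that $F$ has treedepth at most $d$. (4) There exist a number $d$ and a graph class $\mathcal G'$ of bounded treedepth such that every graph in $\mathcal G$ has a parity-decomposition $P\in\mathcal G'$ of target-degree at most $d$.
   Context: A linear order on the vertices of a graph is an injective map $\pi: V\to\mathbb N$. A vertex $u$ is weakly $r$-reachable from $v$ (w.r.t. $\pi$) if there is a path of length at most $r$ from $v$ to $u$ such that $\pi(u)\le\pi(w)$ for all vertices $w$ on the path; $\mathrm{wcol}_r(G,\pi)$ is the maximum over $v$ of the number of vertices weakly $r$-reachable from $v$, and $\mathrm{wcol}_\infty(G,\pi)$ is the same quantity with no bound on the path length. Lacon-decomposition: a pair $(L,\pi)$ where $L$ is a bipartite graph with sides $T$ (target vertices) and $H$ (hidden vertices), each hidden vertex is labeled "0" or "1", $\pi$ is a linear order on $V(L)$ with $\pi(h)<\pi(t)$ for all $h\in H,t\in T$, and for all $t,t'\in T$ we have $N(t)\cap N(t')\neq\emptyset$; the $\pi$-largest vertex of $N(t)\cap N(t')$ is the dominant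 vertex of $t,t'$. It is a lacon-decomposition of a graph $G$ if $V(G)=T$ and for all $t\ne t'\in T$, $tt'\in E(G)$ iff the dominant vertex of $t,t'$ is labeled "1". Shrub-decomposition of $m$ colors and diameter $d$ of a graph $G$: a pair $(F,S)$ with $F$ an undirected graph and $S\subseteq\{1,\dots,m\}^2\times\{1,\dots,d\}$ such that any two vertices of $F$ have distance at most $d$ in $F$, the set of degree-one vertices of $F$ is exactly $V(G)$, each degree-one vertex of $F$ is assigned a color in $\{1,\dots,m\}$, $(i,j,l)\in S$ iff $(j,i,l)\in S$, and for all $u,v\in V(G)$ with colors $i,j$ and $F$-distance $l$, $uv\in E(G)$ iff $(i,j,l)\in S$. Parity-decomposition of target-degree $d$ of a graph $G$: a bipartite graph $P$ with sides $T,H$ in which every vertex of $T$ has degree at most $d$, $T=V(G)$, and for all $t\ne t'\in T$, $tt'\in E(G)$ iff $|N(t)\cap N(t')|$ is odd. First-order transductions: a basic transduction is a triple $\tau_0=(\chi,\nu,\varphi)$ of first-order formulas with $0,1,2$ free variables; $\tau_0(G)$ is undefined if $G\not\models\chi$, otherwise it is the graph with vertex set $\{v: G\models\nu(v)\}$ and edges $uv$ ($u\neq v$) with $G\models\varphi(u,v)\lor\varphi(v,u)$. A $p$-parameter expansion maps $G$ to the set of all graphs obtained by adding $p$ unary predicates to $G$. An $m$-copy operation maps $G$ to the graph with vertex set $V(G)\times\{1,\dots,m\}$, edges $(v,i)(w,i)$ for $vw\in E(G)$, a binary relation $\sim$ with $(u,i)\sim(v,j)$ iff $u=v$, and unary predicates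 $Q_i=V(G)\times\{i\}$. A transduction is $\tau=\tau_0\circ\gamma\circ\varepsilon$ with $\varepsilon$ a parameter expansion, $\gamma$ a copy operation, $\tau_0$ a basic transduction; $\tau(\mathcal G')=\bigcup_{G\in\mathcal G'}\tau(G)$. -}

module Defs where

open import Level using (0ℓ)
open import Data.Nat using (ℕ; zero; suc; _+_; _≤_; _<_; _%_)
open import Data.Fin using (Fin; zero; suc; splitAt)
open import Data.Bool using (Bool; true; false; if_then_else_; _∧_)
open import Data.Maybe using (Maybe; just; nothing)
open import Data.Product using (Σ; _×_; _,_; ∃)
open import Data.Sum using (_⊎_; inj₁; inj₂)
open import Data.Empty using (⊥)
open import Data.List using (List; []; _∷_; length; map; allFin)
open import Data.Nat.ListAction using (sum)
open import Data.List.Relation.Unary.All using (All)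
open import Data.List.Relation.Unary.Unique.Propositional using (Unique)
open import Relation.Nullary using (¬_)
open import Relation.Binary.PropositionalEquality using (_≡_; _≢_; refl)
open import Function using (Injective)
open import Function.Bundles using (_⇔_)

record Graph : Set where
  field
    n      : ℕ
    adj    : Fin n → Fin n → Bool
    sym    : ∀ u v → adj u v ≡ adj v u
    irrefl : ∀ v → adj v v ≡ false

open Graph public

Edge : (G : Graph) → Fin (n G) → Fin (n G) → Set
Edge G u v = adj G u v ≡ true

GraphClass : Set₁
GraphClass = Graph → Set

data Walk {V : Set} (E : V → V → Set) : V → V → Set where
  []  : ∀ {v} → Walk E v v
  _∷_ : ∀ {u v w} → E u v → Walk E v w → Walk E u w

verts : ∀ {V : Set} {E : V → V → Set} {u w : V} → Walk E u w → List V
verts ([] {v})      = v ∷ []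
verts (_∷_ {u} _ p) = u ∷ verts p

wlen : ∀ {V : Set} {E : V → V → Set} {u w : V} → Walk E u w → ℕ
wlen []      = 0
wlen (_ ∷ p) = suc (wlen p)

IsPath : ∀ {V : Set} {E : V → V → Set} {u w : V} → Walk E u w → Set
IsPath p = Unique (verts p)

DistLE : ∀ {V : Set} (E : V → V → Set) → V → V → ℕ → Set
DistLE E x y k = Σ (Walk E x y) λ p → wlen p ≤ k

Dist : ∀ {V : Set} (E : V → V → Set) → V → V → ℕ → Set
Dist E x y l = DistLE E x y l × (∀ k → k < l → ¬ DistLE E x y k)

AtMost : ∀ {V : Set} → (V → Set) → ℕ → Set
AtMost {V} P d = (xs : List V) → Unique xs → All P xs → length xs ≤ d

-- Weak coloring number wcol_∞ (π an injective map V → ℕ)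

WReach : ∀ {V : Set} (E : V → V → Set) (π : V → ℕ) → V → V → Set
WReach E π v u =
  Σ (Walk E v u) λ p → IsPath p × All (λ w → π u ≤ π w) (verts p)

WcolInfLE : ∀ {V : Set} (E : V → V → Set) (π : V → ℕ) → ℕ → Set
WcolInfLE E π d = ∀ v → AtMost (WReach E π v) d

-- depth (number of vertices on the path to the root) of v is ≤ k
data DepthLE {V : Set} (par : V → Maybe V) : ℕ → V → Set where
  root : ∀ {k v} → par v ≡ nothing → DepthLE par (suc k) v
  step : ∀ {k v w} → par v ≡ just w → DepthLE par k w → DepthLE par (suc k) v

data Anc {V : Set} (par : V → Maybe V) (a : V) : V → Set where
  here : Anc par a a
  up   : ∀ {v w} → par v ≡ just w → Anc par a w → Anc par a v

TreedepthLE' : ∀ {V : Set} (E : V → V → Set) → ℕ → Set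
TreedepthLE' {V} E d =
  Σ (V → Maybe V) λ par →
    (∀ v → DepthLE par d v) ×
    (∀ u v → E u v → Anc par u v ⊎ Anc par v u)

TreedepthLE : Graph → ℕ → Set
TreedepthLE G d = TreedepthLE' (Edge G) d

BoundedTreedepth : GraphClass → Set
BoundedTreedepth 𝒢 = Σ ℕ λ d → ∀ G → 𝒢 G → TreedepthLE G d

-- First-order logic over the signature of (expanded, copied) graphs:
-- binary E, binary ∼, unary Q_i (i < m, copy predicates),
-- unary P_j (j < p, expansion predicates), equality.
-- Formulas with k free variables (de Bruijn, Fin k).

data Fm (p m : ℕ) : ℕ → Set where
  _≐_   : ∀ {k} → Fin k → Fin k → Fm p m k
  edge  : ∀ {k} → Fin k → Fin k → Fm p m k
  sim   : ∀ {k} → Fin k → Fin k → Fm p m k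
  copyQ : ∀ {k} → Fin m → Fin k → Fm p m k
  param : ∀ {k} → Fin p → Fin k → Fm p m k
  ⊤ᶠ    : ∀ {k} → Fm p m k
  ⊥ᶠ    : ∀ {k} → Fm p m k
  ¬ᶠ_   : ∀ {k} → Fm p m k → Fm p m k
  _∧ᶠ_  : ∀ {k} → Fm p m k → Fm p m k → Fm p m k
  _∨ᶠ_  : ∀ {k} → Fm p m k → Fm p m k → Fm p m k
  ∃ᶠ_   : ∀ {k} → Fm p m (suc k) → Fm p m k
  ∀ᶠ_   : ∀ {k} → Fm p m (suc k) → Fm p m k

record Str (p m : ℕ) : Set₁ where
  field
    V   : Set
    E   : V → V → Set
    Sim : V → V → Set
    Q   : Fin m → V → Set
    P   : Fin p → V → Set

ext : ∀ {V : Set} {k} → V → (Fin k → V) → Fin (suc k) → V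
ext x ρ zero    = x
ext x ρ (suc i) = ρ i

Sat : ∀ {p m} (A : Str p m) {k} → Fm p m k → (Fin k → Str.V A) → Set
Sat A (x ≐ y)     ρ = ρ x ≡ ρ y
Sat A (edge x y)  ρ = Str.E A (ρ x) (ρ y)
Sat A (sim x y)   ρ = Str.Sim A (ρ x) (ρ y)
Sat A (copyQ i x) ρ = Str.Q A i (ρ x)
Sat A (param j x) ρ = Str.P A j (ρ x)
Sat A ⊤ᶠ          ρ = Data.Unit.⊤ where import Data.Unit
Sat A ⊥ᶠ          ρ = ⊥
Sat A (¬ᶠ φ)      ρ = ¬ Sat A φ ρ
Sat A (φ ∧ᶠ ψ)    ρ = Sat A φ ρ × Sat A ψ ρ
Sat A (φ ∨ᶠ ψ)    ρ = Sat A φ ρ ⊎ Sat A ψ ρ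
Sat A (∃ᶠ φ)      ρ = Σ (Str.V A) λ x → Sat A φ (ext x ρ)
Sat A (∀ᶠ φ)      ρ = (x : Str.V A) → Sat A φ (ext x ρ)

env0 : ∀ {V : Set} → Fin 0 → V
env0 ()

env1 : ∀ {V : Set} → V → Fin 1 → V
env1 x zero = x

env2 : ∀ {V : Set} → V → V → Fin 2 → V
env2 x y zero       = x
env2 x y (suc zero) = y

-- p-parameter expansion (Pr) followed by the m-copy operation.
-- The expansion predicates are copied to every copy.
copyExp : (G : Graph) (p m : ℕ) → (Fin p → Fin (n G) → Bool) → Str p m
copyExp G p m Pr = record
  { V   = Fin (n G) × Fin m
  ; E   = λ { (v , i) (w , j) → i ≡ j × Edge G v w }
  ; Sim = λ { (v , i) (w , j) → v ≡ w }
  ; Q   = λ { c (v , i) → i ≡ c }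
  ; P   = λ { j (v , i) → Pr j v ≡ true }
  }

-- a transduction τ = τ₀ ∘ γ ∘ ε  (ε: p-parameter expansion, γ: m-copy,
-- τ₀ = (χ, ν, φ) basic transduction)
record Transduction : Set where
  field
    p m : ℕ
    χ   : Fm p m 0
    ν   : Fm p m 1
    φ   : Fm p m 2

-- G ∈ τ(G')  (up to isomorphism): for some expansion, τ₀ is defined and its
-- output graph is isomorphic to G via f.
InImage : Transduction → Graph → Graph → Set
InImage τ G' G =
  Σ (Fin p → Fin (n G') → Bool) λ Pr →
    let A = copyExp G' p m Pr in
    Sat A χ env0 ×
    Σ (Fin (n G) → Str.V A) λ f →
      Injective _≡_ _≡_ f ×
      (∀ x → Sat A ν (env1 x) ⇔ (∃ λ v → f v ≡ x)) ×
      (∀ u v → u ≢ v →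
        (Edge G u v ⇔ (Sat A φ (env2 (f u) (f v)) ⊎ Sat A φ (env2 (f v) (f u)))))
  where open Transduction τ

SubsetTransduction : GraphClass → Transduction → GraphClass → Set
SubsetTransduction 𝒢 τ 𝒢' = ∀ G → 𝒢 G → Σ Graph λ G' → 𝒢' G' × InImage τ G' G

StructurallyBoundedTreedepth : GraphClass → Set₁
StructurallyBoundedTreedepth 𝒢 =
  Σ GraphClass λ 𝒢' → BoundedTreedepth 𝒢' × Σ Transduction λ τ → SubsetTransduction 𝒢 τ 𝒢'

-- Lacon-decompositions. T = V(G) = Fin (n G), H = Fin m.

LEdge : ∀ {t m : ℕ} → (Fin t → Fin m → Bool) → Fin t ⊎ Fin m → Fin t ⊎ Fin m → Set
LEdge a (inj₁ x) (inj₂ h) = a x h ≡ true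
LEdge a (inj₂ h) (inj₁ x) = a x h ≡ true
LEdge a (inj₁ _) (inj₁ _) = ⊥
LEdge a (inj₂ _) (inj₂ _) = ⊥

record Lacon (G : Graph) : Set where
  field
    m       : ℕ                               -- number of hidden vertices
    ladj    : Fin (n G) → Fin m → Bool
    label   : Fin m → Bool                    -- true = "1", false = "0"
    π       : Fin (n G) ⊎ Fin m → ℕ
    π-inj   : Injective _≡_ _≡_ π
    π-hid   : ∀ h t → π (inj₂ h) < π (inj₁ t)
    common  : ∀ t t' → ∃ λ h → ladj t h ≡ true × ladj t' h ≡ true
  Dominant : Fin (n G) → Fin (n G) → Fin m → Set
  Dominant t t' h = (ladj t h ≡ true × ladj t' h ≡ true) ×
    (∀ h' → ladj t h' ≡ true → ladj t' h' ≡ true → π (inj₂ h') ≤ π (inj₂ h))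
  field
    correct : ∀ t t' → t ≢ t' → ∀ h → Dominant t t' h →
              (Edge G t t' ⇔ label h ≡ true)

deg : (F : Graph) → Fin (n F) → ℕ
deg F x = sum (map (λ y → if adj F x y then 1 else 0) (allFin (n F)))

record ShrubDec (G : Graph) (m d : ℕ) (S : Fin m → Fin m → ℕ → Bool) : Set where
  field
    F       : Graph
    ι       : Fin (n G) → Fin (n F)
    ι-inj   : Injective _≡_ _≡_ ι
    leaves  : ∀ x → (deg F x ≡ 1 ⇔ (∃ λ v → ι v ≡ x))
    diam    : ∀ x y → DistLE (Edge F) x y d
    col     : Fin (n G) → Fin m
    S-range : ∀ i j l → S i j l ≡ true → 1 ≤ l × l ≤ d
    S-sym   : ∀ i j l → S i j l ≡ S j i l
    correct : ∀ u v l → Dist (Edge F) (ι u) (ι v) l →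
              (Edge G u v ⇔ S (col u) (col v) l ≡ true)

bipS : ∀ {t k : ℕ} → (Fin t → Fin k → Bool) → Fin t ⊎ Fin k → Fin t ⊎ Fin k → Bool
bipS a (inj₁ x) (inj₂ h) = a x h
bipS a (inj₂ h) (inj₁ x) = a x h
bipS a (inj₁ _) (inj₁ _) = false
bipS a (inj₂ _) (inj₂ _) = false

bipS-sym : ∀ {t k} (a : Fin t → Fin k → Bool) x y → bipS a x y ≡ bipS a y x
bipS-sym a (inj₁ x) (inj₁ y) = refl
bipS-sym a (inj₁ x) (inj₂ y) = refl
bipS-sym a (inj₂ x) (inj₁ y) = refl
bipS-sym a (inj₂ x) (inj₂ y) = refl

bipS-irr : ∀ {t k} (a : Fin t → Fin k → Bool) x → bipS a x x ≡ false
bipS-irr a (inj₁ x) = refl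
bipS-irr a (inj₂ x) = refl

bipGraph : (t k : ℕ) → (Fin t → Fin k → Bool) → Graph
bipGraph t k a = record
  { n      = t + k
  ; adj    = λ x y → bipS a (splitAt t x) (splitAt t y)
  ; sym    = λ x y → bipS-sym a (splitAt t x) (splitAt t y)
  ; irrefl = λ x → bipS-irr a (splitAt t x)
  }

Odd : ℕ → Set
Odd x = x % 2 ≡ 1

record ParityDec (G : Graph) (d : ℕ) : Set where
  field
    k     : ℕ                                 -- hidden vertices H = Fin k
    padj  : Fin (n G) → Fin k → Bool
  degT : Fin (n G) → ℕ
  degT x = sum (map (λ h → if padj x h then 1 else 0) (allFin k))
  commonN : Fin (n G) → Fin (n G) → ℕ
  commonN x y = sum (map (λ h → if padj x h ∧ padj y h then 1 else 0) (allFin k))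
  field
    tdeg    : ∀ x → degT x ≤ d
    correct : ∀ x y → x ≢ y → (Edge G x y ⇔ Odd (commonN x y))
  graph : Graph
  graph = bipGraph (n G) k padj

Cond1 : GraphClass → Set₁
Cond1 𝒢 = StructurallyBoundedTreedepth 𝒢

Cond2 : GraphClass → Set
Cond2 𝒢 = Σ ℕ λ d → ∀ G → 𝒢 G →
  Σ (Lacon G) λ L → WcolInfLE (LEdge (Lacon.ladj L)) (Lacon.π L) d

Cond3 : GraphClass → Set
Cond3 𝒢 = Σ ℕ λ d → Σ (Fin 1 → Fin 1 → ℕ → Bool) λ S → ∀ G → 𝒢 G →
  Σ (ShrubDec G 1 d S) λ D → TreedepthLE (ShrubDec.F D) d

Cond4 : GraphClass → Set₁
Cond4 𝒢 = Σ ℕ λ d → Σ GraphClass λ 𝒢' → BoundedTreedepth 𝒢' ×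
  (∀ G → 𝒢 G → Σ (ParityDec G d) λ P → 𝒢' (ParityDec.graph P))

{-# OPTIONS --safe #-}
-- All four conditions are equivalent to having a tree model: the vertices sit at the leaves of a
-- rooted tree of bounded height and adjacency depends only on the colours of the two end points
-- and the level of their lowest common ancestor, with boundedly many colours.
--
-- A transduction of graphs of bounded treedepth yields a tree model by a back-and-forth argument:
-- if the colour of an element is refined, for each of its ancestors, by the truncated number of
-- branches below that ancestor meeting each colour class, then tuples with equal refined colours
-- and equal patterns of common ancestors have matching one-point extensions, so each quantifier
-- costs one refinement.
--
-- From a tree model one obtains a lacon-decomposition with one hidden vertex for each node and pair
-- of colours, a parity-decomposition by writing the changes of the adjacency matrix between
-- successive levels as Gram matrices over 𝔽₂, and a one-colour shrub-decomposition by hanging each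
-- vertex on a path whose length encodes its colour. Conversely, adjacency is definable in each of
-- the decompositions, and a bound on wcol_∞ bounds the treedepth.

module Submission where

open import Defs hiding (sym)
open import Data.Bool using (Bool; true; false; if_then_else_; _∧_; _∨_; _xor_; not)
import Data.Bool.Properties as Bool
open import Data.Fin as Fin using (Fin; zero; suc; toℕ; combine; remQuot; funToFin; finToFun)
import Data.Fin.Properties as Fin
open import Data.List using (List; []; _∷_; length; map; lookup; allFin; filter; take; tabulate)
open import Data.List.Membership.Propositional using (_∈_; find)
open import Data.List.Membership.Propositional.Properties
  using (∈-lookup; ∈-map⁺; ∈-map⁻; ∈-allFin; ∈-filter⁺)
open import Data.List.Properties using (length-map; length-take; map-∘; map-tabulate; ∷-injectiveˡ; ∷-injectiveʳ)
open import Data.List.Relation.Unary.All as All using (All; []; _∷_)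
import Data.List.Relation.Unary.All.Properties as All
open import Data.List.Relation.Unary.AllPairs using ([]; _∷_)
open import Data.List.Relation.Unary.Any as Any using (Any; here; there; index)
open import Data.List.Relation.Unary.Any.Properties using (lookup-index)
import Data.List.Relation.Unary.Unique.DecPropositional as DecUnique
open import Data.List.Relation.Unary.Unique.Propositional using (Unique)
import Data.List.Relation.Unary.Unique.Propositional.Properties as Unique
open import Data.Maybe as Maybe using (Maybe; just; nothing; fromMaybe)
import Data.Maybe.Properties as Maybe
open import Data.Nat
  using (ℕ; zero; suc; _+_; _*_; _^_; _∸_; _⊔_; _⊓_; _≤_; _<_; z≤n; s≤s; _≟_; _≤?_; _<?_)
open import Data.Nat.ListAction using (sum)
open import Data.Nat.Properties
open import Data.Nat.Tactic.RingSolver using (solve-∀)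
open import Data.Product as Product using (Σ; ∃; _×_; _,_; proj₁; proj₂; uncurry)
import Data.Product.Properties as Product
open import Data.Sum as Sum using (_⊎_; inj₁; inj₂; [_,_]′)
import Data.Sum.Properties as Sum
open import Data.Unit using (⊤; tt)
open import Data.Vec as Vec using (Vec; []; _∷_)
import Data.Vec.Properties as Vec
open import Function using (_∘_; id; Injective)
open import Function.Bundles using (_⇔_; mk⇔; Equivalence)
open import Relation.Binary using (DecidableEquality; tri<; tri≈; tri>)
open import Relation.Binary.PropositionalEquality
open import Relation.Nullary using (¬_; Dec; yes; no; does; contradiction; ¬?; _×-dec_; _⊎-dec_)
open import Relation.Nullary.Decidable using (map′; decidable-stable; dec-true; dec-false; does-⇔)

-- The number of colours may depend on the formula, the treedepth bound and the numbers of
-- parameters and copies, but not on the graph. This is why branches are counted with truncation: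
-- `k` elements occupy at most `k` branches below a node, so knowing whether there are at least `s`
-- branches for each `s ≤ k + 1` is enough to find a free one. The treedepth of the
-- parity-decompositions is not estimated directly. They use the same layered kind of hidden
-- vertices and order as the lacon-decompositions; this order has bounded weak colouring number, and
-- the elimination forest extracted from such an order bounds the treedepth. Case distinctions are
-- decided by search through finite sets, so the argument is constructive throughout.

Searchable : Set → Set₁
Searchable X = ∀ {P : X → Set} → (∀ x → Dec (P x)) → Dec (∃ P)

Fin-searchable : ∀ {k} → Searchable (Fin k)
Fin-searchable = Fin.any?

×-searchable : ∀ {A B} → Searchable A → Searchable B → Searchable (A × B)
×-searchable sA sB P? =
  map′ (λ (a , b , p) → (a , b) , p) (λ ((a , b) , p) → a , b , p) (sA λ a → sB λ b → P? (a , b))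

⊎-searchable : ∀ {A B} → Searchable A → Searchable B → Searchable (A ⊎ B)
⊎-searchable sA sB P? with sA (λ a → P? (inj₁ a)) | sB (λ b → P? (inj₂ b))
... | yes (a , p) | _           = yes (inj₁ a , p)
... | no _        | yes (b , p) = yes (inj₂ b , p)
... | no ¬p       | no ¬q       = no λ { (inj₁ a , p) → ¬p (a , p) ; (inj₂ b , q) → ¬q (b , q) }

Vec-searchable : ∀ {A} k → Searchable A → Searchable (Vec A k)
Vec-searchable zero    sA P? = map′ ([] ,_) (λ { ([] , p) → p }) (P? [])
Vec-searchable (suc k) sA P? =
  map′ (λ (a , v , p) → a ∷ v , p) (λ { (a ∷ v , p) → a , v , p })
       (sA λ a → Vec-searchable k sA λ v → P? (a ∷ v))

-- Counting by injections, and products of colourings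

Unique-lookup-injective : ∀ {A : Set} {xs : List A} → Unique xs → Injective _≡_ _≡_ (lookup xs)
Unique-lookup-injective {xs = x ∷ xs} (x∉ ∷ u) {zero}  {zero}  eq = refl
Unique-lookup-injective {xs = x ∷ xs} (x∉ ∷ u) {zero}  {suc j} eq = contradiction eq (All.lookup x∉ (∈-lookup j))
Unique-lookup-injective {xs = x ∷ xs} (x∉ ∷ u) {suc i} {zero}  eq = contradiction (sym eq) (All.lookup x∉ (∈-lookup i))
Unique-lookup-injective {xs = x ∷ xs} (x∉ ∷ u) {suc i} {suc j} eq = cong suc (Unique-lookup-injective u eq)

Unique-⊆-length : ∀ {A : Set} {xs ys : List A} → Unique xs → (∀ {x} → x ∈ xs → x ∈ ys) → length xs ≤ length ys
Unique-⊆-length {xs = xs} {ys} u sub = Fin.injective⇒≤ {f = pos} pos-injective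
  where
  pos : Fin (length xs) → Fin (length ys)
  pos i = index (sub (∈-lookup i))
  pos-injective : Injective _≡_ _≡_ pos
  pos-injective {i} {j} eq = Unique-lookup-injective u (begin
    lookup xs i        ≡⟨ lookup-index (sub (∈-lookup i)) ⟩
    lookup ys (pos i)  ≡⟨ cong (lookup ys) eq ⟩
    lookup ys (pos j)  ≡⟨ lookup-index (sub (∈-lookup j)) ⟨
    lookup xs j        ∎)
    where open ≡-Reasoning

-- Injectivity of the code is asked for on `P` alone, so elements can be coded relative to the fixed
-- vertex that defines `P`.
length-≤-code : ∀ {A : Set} {P : A → Set} {k} (code : A → Fin k) →
  (∀ {x y} → P x → P y → code x ≡ code y → x ≡ y) → AtMost P k
length-≤-code {A} {P} {k} code inj xs u ps = Fin.injective⇒≤ {f = code ∘ lookup xs}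
  λ {i} {j} eq → Unique-lookup-injective u
    (inj (All.lookup ps (∈-lookup i)) (All.lookup ps (∈-lookup j)) eq)

-- Coding colours as numbers makes their count explicit. Afterwards only the recovery of equal
-- components from equal codes is used, so the codes stay opaque.
opaque
  _⊗_ : ∀ {X : Set} {M M'} → (X → Fin M) → (X → Fin M') → X → Fin (M * M')
  (c ⊗ c') x = combine (c x) (c' x)

  ⊗-≡ˡ : ∀ {X : Set} {M M'} (c : X → Fin M) (c' : X → Fin M') {x y} → (c ⊗ c') x ≡ (c ⊗ c') y → c x ≡ c y
  ⊗-≡ˡ c c' {x} {y} = Fin.combine-injectiveˡ (c x) (c' x) (c y) (c' y)

  ⊗-≡ʳ : ∀ {X : Set} {M M'} (c : X → Fin M) (c' : X → Fin M') {x y} → (c ⊗ c') x ≡ (c ⊗ c') y → c' x ≡ c' y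
  ⊗-≡ʳ c c' {x} {y} = Fin.combine-injectiveʳ (c x) (c' x) (c y) (c' y)

  ⨂ : ∀ {X : Set} {M} k → (Fin k → X → Fin M) → X → Fin (M ^ k)
  ⨂ k cs x = funToFin λ i → cs i x

  ⨂-≡ : ∀ {X : Set} {M} k (cs : Fin k → X → Fin M) x y → ⨂ k cs x ≡ ⨂ k cs y → ∀ i → cs i x ≡ cs i y
  ⨂-≡ k cs x y eq i = begin
    cs i x               ≡⟨ Fin.finToFun-funToFin (λ i → cs i x) i ⟨
    finToFun (⨂ k cs x) i  ≡⟨ cong (λ z → finToFun z i) eq ⟩
    finToFun (⨂ k cs y) i  ≡⟨ Fin.finToFun-funToFin (λ i → cs i y) i ⟩
    cs i y               ∎
    where open ≡-Reasoning

bit : ∀ {P : Set} → Dec P → Fin 2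
bit (yes _) = suc zero
bit (no _)  = zero

bit-≡ : ∀ {P Q : Set} {P? : Dec P} {Q? : Dec Q} → bit P? ≡ bit Q? → P → Q
bit-≡ {P? = _}     {yes q} _  _ = q
bit-≡ {P? = no ¬p} {no _}  _  p = contradiction p ¬p

walk-first : ∀ {V : Set} {E : V → V → Set} {u v} {P : V → Set} (p : Walk E u v) → All P (verts p) → P u
walk-first []      (px ∷ _) = px
walk-first (_ ∷ _) (px ∷ _) = px

TreedepthLE'-mono : ∀ {V : Set} {E : V → V → Set} {d d'} → d ≤ d' → TreedepthLE' E d → TreedepthLE' E d'
TreedepthLE'-mono d≤d' (par , depth , edges) = par , (λ v → mono d≤d' (depth v)) , edges
  where
  mono : ∀ {d d' v} → d ≤ d' → DepthLE par d v → DepthLE par d' v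
  mono (s≤s le) (root eq)   = root eq
  mono (s≤s le) (step eq p) = step eq (mono le p)

-- Trees of bounded height and elimination forests

-- The bottom node of `v` is `key D v`, and `key e v` is its ancestor on level `e`. Several elements
-- may share a bottom node, as the copies of one vertex do. For `e > D` the value of `key e` is
-- unconstrained.
record LevelTree (V : Set) (D : ℕ) : Set where
  field
    N        : ℕ
    top      : Fin N
    lvl      : Fin N → ℕ
    parent   : Fin N → Fin N
    lvl-≤    : ∀ x → lvl x ≤ D
    lvl-zero : ∀ {x} → lvl x ≡ 0 → x ≡ top
    lvl-suc  : ∀ {x l} → lvl x ≡ suc l → lvl (parent x) ≡ l
    key      : ℕ → V → Fin N
    key-lvl  : ∀ {e} → e ≤ D → ∀ v → lvl (key e v) ≡ e
    key-up   : ∀ {e} → e < D → ∀ v → parent (key (suc e) v) ≡ key e v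

  key-zero : ∀ u v → key 0 u ≡ key 0 v
  key-zero u v = trans (lvl-zero (key-lvl z≤n u)) (sym (lvl-zero (key-lvl z≤n v)))

  key-suc : ∀ {e u v} → e < D → key (suc e) u ≡ key (suc e) v → key e u ≡ key e v
  key-suc e<D eq = trans (sym (key-up e<D _)) (trans (cong parent eq) (key-up e<D _))

  key-mono : ∀ {e e' u v} → e ≤ e' → e' ≤ D → key e' u ≡ key e' v → key e u ≡ key e v
  key-mono {e' = zero}   z≤n  _    eq = eq
  key-mono {e' = suc e'} e≤e' e'≤D eq with m≤n⇒m<n∨m≡n e≤e'
  ... | inj₁ (s≤s e≤) = key-mono e≤ (<⇒≤ e'≤D) (key-suc e'≤D eq)
  ... | inj₂ refl     = eq

  -- With `D` as first argument this is the level of the lowest common ancestor; the default 0 is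
  -- sound because all elements share the top.
  meet : ℕ → V → V → ℕ
  meet zero    u v = 0
  meet (suc e) u v with key (suc e) u Fin.≟ key (suc e) v
  ... | yes _ = suc e
  ... | no _  = meet e u v

  meet-≤ : ∀ e u v → meet e u v ≤ e
  meet-≤ zero    u v = z≤n
  meet-≤ (suc e) u v with key (suc e) u Fin.≟ key (suc e) v
  ... | yes _ = ≤-refl
  ... | no _  = m≤n⇒m≤1+n (meet-≤ e u v)

  meet-key : ∀ e u v → key (meet e u v) u ≡ key (meet e u v) v
  meet-key zero    u v = key-zero u v
  meet-key (suc e) u v with key (suc e) u Fin.≟ key (suc e) v
  ... | yes eq = eq
  ... | no _   = meet-key e u v

  meet-max : ∀ E u v {e} → e ≤ E → key e u ≡ key e v → e ≤ meet E u v
  meet-max zero    u v z≤n _ = z≤n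
  meet-max (suc E) u v e≤ eq with key (suc E) u Fin.≟ key (suc E) v
  ... | yes _ = e≤
  ... | no ¬eq with m≤n⇒m<n∨m≡n e≤
  ...   | inj₁ (s≤s e≤E) = meet-max E u v e≤E eq
  ...   | inj₂ refl      = contradiction eq ¬eq

  lev : V → V → ℕ
  lev = meet D

  lev-≤ : ∀ u v → lev u v ≤ D
  lev-≤ = meet-≤ D

  lev-key : ∀ {u v e} → e ≤ lev u v → key e u ≡ key e v
  lev-key {u} {v} e≤ = key-mono e≤ (lev-≤ u v) (meet-key D u v)

  lev-max : ∀ {u v e} → e ≤ D → key e u ≡ key e v → e ≤ lev u v
  lev-max = meet-max D _ _

  lev-unique : ∀ {u v u' v'} → (∀ {e} → e ≤ D → key e u ≡ key e v ⇔ key e u' ≡ key e v') → lev u v ≡ lev u' v'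
  lev-unique h = ≤-antisym
    (lev-max (lev-≤ _ _) (Equivalence.to (h (lev-≤ _ _)) (lev-key ≤-refl)))
    (lev-max (lev-≤ _ _) (Equivalence.from (h (lev-≤ _ _)) (lev-key ≤-refl)))

  lev-sym : ∀ u v → lev u v ≡ lev v u
  lev-sym u v = lev-unique λ _ → mk⇔ sym sym

restrict : ∀ {V W D} → (W → V) → LevelTree V D → LevelTree W D
restrict f T = record
  { N = N ; top = top ; lvl = lvl ; parent = parent ; lvl-≤ = lvl-≤ ; lvl-zero = lvl-zero ; lvl-suc = lvl-suc
  ; key = λ e w → key e (f w) ; key-lvl = λ e≤ w → key-lvl e≤ (f w) ; key-up = λ e< w → key-up e< (f w) }
  where open LevelTree T

module Forest {V : Set} {par : V → Maybe V} {d : ℕ} (depth : ∀ v → DepthLE par d v) where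

  height : ∀ {k v} → DepthLE par k v → ℕ
  height (root _)   = 0
  height (step _ p) = suc (height p)

  height-< : ∀ {k v} (p : DepthLE par k v) → height p < k
  height-< (root _)   = s≤s z≤n
  height-< (step _ p) = s≤s (height-< p)

  -- `DepthLE` only bounds the depth, and its derivations vary with the bound. The number of steps
  -- to the root does not vary, so `dep` can be compared along `par`.
  height-unique : ∀ {k k' v} (p : DepthLE par k v) (q : DepthLE par k' v) → height p ≡ height q
  height-unique (root _)   (root _)    = refl
  height-unique (root e)   (step e' _) with () ← trans (sym e) e'
  height-unique (step e _) (root e')   with () ← trans (sym e) e'
  height-unique (step e p) (step e' q) with refl ← Maybe.just-injective (trans (sym e) e') = cong suc (height-unique p q)

  dep : V → ℕ
  dep v = height (depth v)

  dep-< : ∀ v → dep v < d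
  dep-< v = height-< (depth v)

  dep-par : ∀ {v w} → par v ≡ just w → dep v ≡ suc (dep w)
  dep-par eq = height-unique (depth _) (step eq (depth _))

  -- A root is its own parent, in line with the truncation in `dep v ∸ 1`.
  above : V → V
  above v = fromMaybe v (par v)

  up-par : ∀ {v w} → par v ≡ just w → above v ≡ w
  up-par {v} = cong (fromMaybe v)

  dep-up : ∀ v → dep (above v) ≡ dep v ∸ 1
  dep-up v = helper (par v) refl
    where
    helper : ∀ x → par v ≡ x → dep (fromMaybe v x) ≡ dep v ∸ 1
    helper nothing  eq = sym (trans (cong (_∸ 1) (height-unique (depth v) (root {k = 0} eq))) (height-unique (root {k = 0} eq) (depth v)))
    helper (just w) eq = cong (_∸ 1) (sym (dep-par eq))

  up^ : ℕ → V → V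
  up^ zero    v = v
  up^ (suc j) v = up^ j (above v)

  dep-up^ : ∀ j v → dep (up^ j v) ≡ dep v ∸ j
  dep-up^ zero    v = refl
  dep-up^ (suc j) v = trans (dep-up^ j (above v)) (trans (cong (_∸ j) (dep-up v)) (∸-+-assoc (dep v) 1 j))

  up^-+ : ∀ i j v → up^ i (up^ j v) ≡ up^ (j + i) v
  up^-+ i zero    v = refl
  up^-+ i (suc j) v = up^-+ i j (above v)

  -- The ancestor of depth `e`, or `v` itself if its depth is at most `e`. Each vertex is thus
  -- repeated on all deeper levels, so that vertices of all depths can be placed on one bottom
  -- level.
  anc : ℕ → V → V
  anc e v = up^ (dep v ∸ e) v

  anc-deep : ∀ {e v} → dep v ≤ e → anc e v ≡ v
  anc-deep {e} {v} le = cong (λ j → up^ j v) (m≤n⇒m∸n≡0 le)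

  anc-anc : ∀ {e e'} → e ≤ e' → ∀ v → anc e (anc e' v) ≡ anc e v
  anc-anc {e} {e'} e≤e' v = trans (up^-+ _ (dep v ∸ e') v) (cong (λ j → up^ j v) (begin
    (dep v ∸ e') + (dep (anc e' v) ∸ e)          ≡⟨ cong (λ j → (dep v ∸ e') + (j ∸ e)) (dep-up^ (dep v ∸ e') v) ⟩
    (dep v ∸ e') + (dep v ∸ (dep v ∸ e') ∸ e)    ≡⟨ arith (dep v) ⟩
    dep v ∸ e                                    ∎))
    where
    open ≡-Reasoning
    arith : ∀ k → (k ∸ e') + (k ∸ (k ∸ e') ∸ e) ≡ k ∸ e
    arith k with ≤-total k e'
    ... | inj₁ k≤e' rewrite m≤n⇒m∸n≡0 k≤e' = refl
    ... | inj₂ e'≤k rewrite m∸[m∸n]≡n e'≤k = trans (sym (+-∸-assoc (k ∸ e') e≤e')) (cong (_∸ e) (m∸n+n≡m e'≤k))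

  dep-Anc : ∀ {u v} → Anc par u v → dep u ≤ dep v
  dep-Anc here      = ≤-refl
  dep-Anc (up eq a) = ≤-trans (dep-Anc a) (≤-trans (n≤1+n _) (≤-reflexive (sym (dep-par eq))))

  dep-Anc-< : ∀ {u v} → Anc par u v → u ≢ v → dep u < dep v
  dep-Anc-< here      u≢v = contradiction refl u≢v
  dep-Anc-< (up eq a) _   = ≤-trans (s≤s (dep-Anc a)) (≤-reflexive (sym (dep-par eq)))

  anc-Anc : ∀ {u v} → Anc par u v → anc (dep u) v ≡ u
  anc-Anc {u} here = anc-deep {dep u} ≤-refl
  anc-Anc {u} {v} (up {w = w} eq a) = begin
    anc (dep u) v                ≡⟨ anc-anc (dep-Anc a) v ⟨
    anc (dep u) (anc (dep w) v)  ≡⟨ cong (anc (dep u)) above-v ⟩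
    anc (dep u) w                ≡⟨ anc-Anc a ⟩
    u                            ∎
    where
    open ≡-Reasoning
    above-v : anc (dep w) v ≡ w
    above-v = trans (cong (λ j → up^ j v) (trans (cong (_∸ dep w) (dep-par eq)) (m+n∸n≡m 1 (dep w)))) (up-par eq)

-- A node of level suc e is a pair (e , a); the top node makes all keys of level 0 agree.
module ForestTree {n : ℕ} {par : Fin n → Maybe (Fin n)} {d : ℕ} (depth : ∀ v → DepthLE par d v) where
  open Forest depth

  nodeLvl : Fin (suc (d * n)) → ℕ
  nodeLvl zero    = 0
  nodeLvl (suc y) = suc (toℕ (proj₁ (remQuot {d} n y)))

  parentOf : ∀ {k} → Fin k × Fin n → Fin (suc (k * n))
  parentOf (zero  , a) = zero
  parentOf (suc e , a) = suc (combine (Fin.inject₁ e) (anc (toℕ e) a))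

  nodeUp : Fin (suc (d * n)) → Fin (suc (d * n))
  nodeUp zero    = zero
  nodeUp (suc y) = parentOf (remQuot {d} n y)

  nodeLvl-≤ : ∀ x → nodeLvl x ≤ d
  nodeLvl-≤ zero    = z≤n
  nodeLvl-≤ (suc y) = Fin.toℕ<n (proj₁ (remQuot {d} n y))

  nodeLvl-node : ∀ (e : Fin d) a → nodeLvl (suc (combine e a)) ≡ suc (toℕ e)
  nodeLvl-node e a = cong (suc ∘ toℕ ∘ proj₁) (Fin.remQuot-combine e a)

  nodeUp-node : ∀ (e : Fin d) a → nodeUp (suc (combine e a)) ≡ parentOf (e , a)
  nodeUp-node e a = cong parentOf (Fin.remQuot-combine e a)

  nodeLvl-suc : ∀ {x l} → nodeLvl x ≡ suc l → nodeLvl (nodeUp x) ≡ l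
  nodeLvl-suc {suc y} eq = trans (parent-lvl (remQuot {d} n y)) (suc-injective eq)
    where
    parent-lvl : ∀ (z : Fin d × Fin n) → nodeLvl (parentOf z) ≡ toℕ (proj₁ z)
    parent-lvl (zero  , a) = refl
    parent-lvl (suc e , a) = trans (nodeLvl-node _ _) (cong suc (Fin.toℕ-inject₁ e))

  nodeKey : ℕ → Fin n → Fin (suc (d * n))
  nodeKey zero    v = zero
  nodeKey (suc e) v with e <? d
  ... | yes e<d = suc (combine (Fin.fromℕ< e<d) (anc e v))
  ... | no _    = zero

  nodeKey-lvl : ∀ {e} → e ≤ d → ∀ v → nodeLvl (nodeKey e v) ≡ e
  nodeKey-lvl {zero}  _   v = refl
  nodeKey-lvl {suc e} e<d v with e <? d
  ... | yes p = trans (nodeLvl-node _ _) (cong suc (Fin.toℕ-fromℕ< p))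
  ... | no ¬p = contradiction e<d ¬p

  parentOf-key : ∀ {k e} (p : suc e < k) (q : e < k) v →
    parentOf (Fin.fromℕ< p , anc (suc e) v) ≡ suc (combine (Fin.fromℕ< q) (anc e v))
  parentOf-key {suc (suc k)} {e} (s≤s p) q v = cong suc (cong₂ combine
    (Fin.toℕ-injective (trans (Fin.toℕ-inject₁ _) (trans (Fin.toℕ-fromℕ< p) (sym (Fin.toℕ-fromℕ< q)))))
    (trans (cong (λ e' → anc e' (anc (suc e) v)) (Fin.toℕ-fromℕ< p)) (anc-anc (n≤1+n e) v)))

  nodeKey-up : ∀ {e} → e < d → ∀ v → nodeUp (nodeKey (suc e) v) ≡ nodeKey e v
  nodeKey-up {e} e<d v with e <? d
  ... | no ¬p = contradiction e<d ¬p
  nodeKey-up {zero} e<d v | yes p = trans (nodeUp-node _ _) (at-root p)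
    where
    at-root : ∀ {k} (p : 0 < k) → parentOf (Fin.fromℕ< p , anc 0 v) ≡ zero
    at-root (s≤s p) = refl
  nodeKey-up {suc e} e<d v | yes p with e <? d
  ... | yes q = trans (nodeUp-node _ _) (parentOf-key p q v)
  ... | no ¬q = contradiction (<⇒≤ e<d) ¬q

  levelTree : LevelTree (Fin n) d
  levelTree = record
    { N = suc (d * n) ; top = zero ; lvl = nodeLvl ; parent = nodeUp ; lvl-≤ = nodeLvl-≤
    ; lvl-zero = λ { {zero} _ → refl } ; lvl-suc = λ {x} → nodeLvl-suc {x}
    ; key = nodeKey ; key-lvl = nodeKey-lvl ; key-up = nodeKey-up }

  nodeKey-≡⇒ : ∀ {e} → e < d → ∀ {u v} → nodeKey (suc e) u ≡ nodeKey (suc e) v → anc e u ≡ anc e v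
  nodeKey-≡⇒ {e} e<d eq with e <? d
  ... | yes p = Fin.combine-injectiveʳ (Fin.fromℕ< p) _ _ _ (Fin.suc-injective eq)
  ... | no ¬p = contradiction e<d ¬p

  nodeKey-≡⇐ : ∀ {e u v} → anc e u ≡ anc e v → nodeKey (suc e) u ≡ nodeKey (suc e) v
  nodeKey-≡⇐ {e} eq with e <? d
  ... | yes p = cong (λ a → suc (combine (Fin.fromℕ< p) a)) eq
  ... | no _  = refl

-- Back-and-forth

-- The function `g` takes at least `s` values on `P`; the vector of witnesses makes this decidable
-- by search.
Many : ∀ {X : Set} {N} → (X → Fin N) → (X → Set) → ℕ → Set
Many {X} g P s = Σ (Vec X s) λ v → All P (Vec.toList v) × Unique (map g (Vec.toList v))

many? : ∀ {X : Set} {N} → Searchable X → (g : X → Fin N) {P : X → Set} → (∀ x → Dec (P x)) → ∀ s → Dec (Many g P s)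
many? search g P? s = Vec-searchable s search λ v →
  All.all? P? (Vec.toList v) ×-dec DecUnique.unique? Fin._≟_ (map g (Vec.toList v))

many-fromList : ∀ {X : Set} {N} {g : X → Fin N} {P : X → Set} (xs : List X) → All P xs → Unique (map g xs) →
                Many g P (length xs)
many-fromList {g = g} {P} xs ps u =
  Vec.fromList xs , subst (All P) (sym (Vec.toList∘fromList xs)) ps , subst (Unique ∘ map g) (sym (Vec.toList∘fromList xs)) u

distinct-values : ∀ {I : Set} {N} (g : I → Fin N) {Q : I → Set} → (∀ i → Dec (Q i)) → (is : List I) →
  ∃ λ js → Unique (map g js) × All Q js × (∀ {i} → i ∈ is → Q i → g i ∈ map g js)
distinct-values g Q? [] = [] , [] , [] , λ ()
distinct-values g Q? (i ∷ is) with distinct-values g Q? is | Q? i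
... | js , u , qs , cover | no ¬q = js , u , qs ,
  λ { (here refl) q → contradiction q ¬q ; (there i∈) q → cover i∈ q }
... | js , u , qs , cover | yes q with Any.any? (g i Fin.≟_) (map g js)
...   | yes gi∈ = js , u , qs , λ { (here refl) _ → gi∈ ; (there i∈) q' → cover i∈ q' }
...   | no gi∉  = i ∷ js , All.¬Any⇒All¬ _ gi∉ ∷ u , q ∷ qs ,
  λ { (here refl) _ → here refl ; (there i∈) q' → there (cover i∈ q') }

-- An old colour, and one bit for each of `suc D` levels, `M` colours and `2 + k` counts
-- `s = 0, ..., k + 1`.
refineSize : ℕ → ℕ → ℕ → ℕ
refineSize D M k = M * ((2 ^ (2 + k)) ^ M) ^ suc D

module BackAndForth {X : Set} {D : ℕ} (search : Searchable X) (T : LevelTree X D) where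

  open LevelTree T

  -- The condition on keys says that corresponding pairs have their lowest common ancestors on the
  -- same level.
  record Similar {M k : ℕ} (c : X → Fin M) (ρ ρ' : Fin k → X) : Set where
    field
      colours : ∀ i → c (ρ i) ≡ c (ρ' i)
      keys    : ∀ {e} → e ≤ D → ∀ i j → key e (ρ i) ≡ key e (ρ j) ⇔ key e (ρ' i) ≡ key e (ρ' j)
    keys⇒ : ∀ {e} → e ≤ D → ∀ {i j} → key e (ρ i) ≡ key e (ρ j) → key e (ρ' i) ≡ key e (ρ' j)
    keys⇒ e≤ = Equivalence.to (keys e≤ _ _)
    keys⇐ : ∀ {e} → e ≤ D → ∀ {i j} → key e (ρ' i) ≡ key e (ρ' j) → key e (ρ i) ≡ key e (ρ j)
    keys⇐ e≤ = Equivalence.from (keys e≤ _ _)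

  similar-sym : ∀ {M k} {c : X → Fin M} {ρ ρ' : Fin k → X} → Similar c ρ ρ' → Similar c ρ' ρ
  similar-sym sr = record { colours = λ i → sym (colours i) ; keys = λ e≤ i j → mk⇔ (keys⇐ e≤) (keys⇒ e≤) }
    where open Similar sr

  similar-map : ∀ {M M' k} {c : X → Fin M} {c' : X → Fin M'} {ρ ρ' : Fin k → X} →
    (∀ {x y} → c x ≡ c y → c' x ≡ c' y) → Similar c ρ ρ' → Similar c' ρ ρ'
  similar-map f sr = record { colours = λ i → f (colours i) ; keys = keys }
    where open Similar sr

  module _ {M : ℕ} (c : X → Fin M) where

    InClass : ℕ → X → Fin M → X → Set
    InClass e x γ y = key e y ≡ key e x × c y ≡ γ

    inClass? : ∀ e x γ y → Dec (InClass e x γ y)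
    inClass? e x γ y = (key e y Fin.≟ key e x) ×-dec (c y Fin.≟ γ)

    -- A branch below the node `key e x` is a value of `key (suc e)` on the class of `x`; at least
    -- `s` of them contain the colour `γ`.
    Branches : ℕ → Fin M → ℕ → X → Set
    Branches e γ s x = Many (key (suc e)) (InClass e x γ) s

    branches? : ∀ e γ s x → Dec (Branches e γ s x)
    branches? e γ s x = many? search (key (suc e)) (inClass? e x γ) s

    branchColour : ∀ k → X → Fin (((2 ^ (2 + k)) ^ M) ^ suc D)
    branchColour k = ⨂ (suc D) λ e → ⨂ M λ γ → ⨂ (2 + k) λ s x → bit (branches? (toℕ e) γ (toℕ s) x)

    opaque
      refinement : ∀ k → X → Fin (refineSize D M k)
      refinement k = c ⊗ branchColour k

      refinement-colour : ∀ {k x y} → refinement k x ≡ refinement k y → c x ≡ c y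
      refinement-colour {k} = ⊗-≡ˡ c (branchColour k)

      refinement-branches : ∀ {k x y} → refinement k x ≡ refinement k y →
        ∀ {e s} γ → e ≤ D → s < 2 + k → Branches e γ s x → Branches e γ s y
      refinement-branches {k} {x} {y} eq {e} {s} γ e≤D s< =
        subst₂ (λ e s → Branches e γ s x → Branches e γ s y) (Fin.toℕ-fromℕ< (s≤s e≤D)) (Fin.toℕ-fromℕ< s<)
          (bit-≡ {P? = branches? _ γ _ x} {branches? _ γ _ y} bits)
        where
        e' : Fin (suc D)
        e' = Fin.fromℕ< (s≤s e≤D)
        s' : Fin (2 + k)
        s' = Fin.fromℕ< s<
        bits : bit (branches? (toℕ e') γ (toℕ s') x) ≡ bit (branches? (toℕ e') γ (toℕ s') y)
        bits = ⨂-≡ (2 + k) _ x y (⨂-≡ M _ x y (⨂-≡ (suc D) _ x y (⊗-≡ʳ c (branchColour k) eq) e') γ) s'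

    -- This is the count `s = 1`. A single element is free of repetitions, so the count is
    -- meaningful even for `e = D`, where `key (suc D)` is arbitrary.
    refinement-meets : ∀ {k x y γ e} → refinement k x ≡ refinement k y → e ≤ D →
      ∃ (InClass e x γ) → ∃ (InClass e y γ)
    refinement-meets {k} eq e≤D (z , z∈)
      with refinement-branches {k} eq _ e≤D (s≤s (s≤s z≤n)) (z ∷ [] , z∈ ∷ [] , [] ∷ [])
    ... | z' ∷ [] , z'∈ ∷ [] , _ = z' , z'∈

    -- Here `e` is the level at which the branch of `y` leaves the subtree spanned by `ρ`. Since
    -- there is at least one entry, level 0 always qualifies.
    deepest : ∀ {k} (ρ : Fin (suc k) → X) y E → ∃ λ e → e ≤ E × (∃ λ i → key e y ≡ key e (ρ i)) ×
      (∀ j {e'} → e < e' → e' ≤ E → key e' y ≢ key e' (ρ j))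
    deepest ρ y zero = 0 , z≤n , (zero , key-zero _ _) , λ { _ e<e' z≤n _ → contradiction e<e' λ () }
    deepest ρ y (suc E) with Fin.any? (λ i → key (suc E) y Fin.≟ key (suc E) (ρ i))
    ... | yes m  = suc E , ≤-refl , m , λ _ E< ≤E _ → <⇒≱ E< ≤E
    ... | no ¬m with deepest ρ y E
    ...   | e , e≤E , m , above = e , m≤n⇒m≤1+n e≤E , m , above'
      where
      above' : ∀ j {e'} → e < e' → e' ≤ suc E → key e' y ≢ key e' (ρ j)
      above' j e<e' e'≤ eq with m≤n⇒m<n∨m≡n e'≤
      ... | inj₁ (s≤s e'≤E) = above j e<e' e'≤E eq
      ... | inj₂ refl       = ¬m (j , eq)

    module _ {k : ℕ} {ρ ρ' : Fin (suc k) → X} (sr : Similar (refinement (suc k)) ρ ρ') where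
      open Similar sr

      -- If every γ-coloured branch below the class of ρ' i contained some ρ' j, then there would be
      -- as few such branches as there are among the ρ j, but below ρ i there is one more.
      escape : ∀ {e} → e < D → ∀ y i → key e y ≡ key e (ρ i) → (∀ j → key (suc e) y ≢ key (suc e) (ρ j)) →
        ∃ λ y' → InClass e (ρ' i) (c y) y' × (∀ j → key (suc e) y' ≢ key (suc e) (ρ' j))
      -- A branch is occupied if it contains an entry of `ρ`. Only occupied branches that meet the
      -- colour of `y` compete, and `js` picks one entry in each.
      escape {e} e<D y i y~i y≁ with distinct-values (key (suc e) ∘ ρ) occupied? (allFin _)
        where
        occupied? : ∀ j → Dec (key e (ρ j) ≡ key e (ρ i) × ∃ (InClass (suc e) (ρ j) (c y)))
        occupied? j = (key e (ρ j) Fin.≟ key e (ρ i)) ×-dec search (inClass? (suc e) (ρ j) (c y))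
      ... | js , u , occ , cover = found (Any.any? free? (Vec.toList xs'))
        where
        reps : (js : List (Fin (suc k))) → All (λ j → key e (ρ j) ≡ key e (ρ i) × ∃ (InClass (suc e) (ρ j) (c y))) js →
          ∃ λ xs → All (InClass e (ρ i) (c y)) xs × map (key (suc e)) xs ≡ map (key (suc e) ∘ ρ) js
        reps [] [] = [] , [] , refl
        reps (j ∷ js) ((j~i , z , z~j , cz) ∷ occ) with reps js occ
        ... | xs , ps , eq = z ∷ xs , (trans (key-suc e<D z~j) j~i , cz) ∷ ps , cong₂ _∷_ z~j eq
        xs = proj₁ (reps js occ)
        xs-keys = proj₂ (proj₂ (reps js occ))
        y-new : All (λ a → key (suc e) y ≢ a) (map (key (suc e)) xs)
        y-new = subst (All (λ a → key (suc e) y ≢ a)) (sym xs-keys) (All.map⁺ (All.tabulate λ {j} _ → y≁ j))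
        xs-length : length xs ≡ length js
        xs-length = begin
          length xs                        ≡⟨ length-map (key (suc e)) xs ⟨
          length (map (key (suc e)) xs)      ≡⟨ cong length xs-keys ⟩
          length (map (key (suc e) ∘ ρ) js)  ≡⟨ length-map _ js ⟩
          length js                        ∎
          where open ≡-Reasoning
        js≤k : length js ≤ suc k
        js≤k = Fin.injective⇒≤ (Unique-lookup-injective (Unique.map⁻ u))
        s = suc (length xs)
        -- The occupied branches and the branch of `y` together are one more than `length js`, a
        -- count that the refined colour still registers.
        branches' : Branches e (c y) s (ρ' i)
        branches' = refinement-branches (colours i) (c y) (<⇒≤ e<D)
          (s≤s (s≤s (subst (_≤ suc k) (sym xs-length) js≤k)))
          (many-fromList (y ∷ xs) ((y~i , refl) ∷ proj₁ (proj₂ (reps js occ)))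
            (y-new ∷ subst Unique (sym xs-keys) u))
        xs' = proj₁ branches'
        Free : X → Set
        Free x = ¬ (key (suc e) x ∈ map (key (suc e) ∘ ρ') js)
        free? : ∀ x → Dec (Free x)
        free? x = ¬? (Any.any? (key (suc e) x Fin.≟_) _)
        found : Dec (Any Free (Vec.toList xs')) →
          ∃ λ y' → InClass e (ρ' i) (c y) y' × (∀ j → key (suc e) y' ≢ key (suc e) (ρ' j))
        found (no none) = contradiction
          (begin-strict
            length js                                  ≡⟨ xs-length ⟨
            length xs                                  <⟨ n<1+n _ ⟩
            s                                          ≡⟨ Vec.length-toList xs' ⟨
            length (Vec.toList xs')                    ≡⟨ length-map (key (suc e)) (Vec.toList xs') ⟨
            length (map (key (suc e)) (Vec.toList xs'))  ≤⟨ Unique-⊆-length (proj₂ (proj₂ branches')) covered ⟩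
            length (map (key (suc e) ∘ ρ') js)           ≡⟨ length-map _ js ⟩
            length js                                  ∎)
          (<-irrefl refl)
          where
          open ≤-Reasoning
          covered : ∀ {a} → a ∈ map (key (suc e)) (Vec.toList xs') → a ∈ map (key (suc e) ∘ ρ') js
          covered a∈ with ∈-map⁻ (key (suc e)) a∈
          ... | x , x∈ , refl = decidable-stable (Any.any? (key (suc e) x Fin.≟_) _)
            (All.lookup (All.¬Any⇒All¬ _ none) x∈)
        found (yes some) with find some
        ... | y' , y'∈ , free with All.lookup (proj₁ (proj₂ branches')) y'∈
        ...   | y'~ , cy' = y' , (y'~ , cy') , avoids
          where
          avoids : ∀ j → key (suc e) y' ≢ key (suc e) (ρ' j)
          -- If `y'` shared a branch with `ρ' j`, then the branch of `ρ j` would contain the colour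
          -- of `y` as well and would be represented in `js`; but `y'` lies outside the branches
          -- matching those.
          avoids j eq with refinement-meets (sym (colours j)) e<D (y' , eq , cy')
          ... | z , z~j , cz with ∈-map⁻ (key (suc e) ∘ ρ) (cover (∈-allFin j) (keys⇐ (<⇒≤ e<D) (trans (sym (key-suc e<D eq)) y'~) , z , z~j , cz))
          ...   | j' , j'∈ , j~j' = free (subst (_∈ map (key (suc e) ∘ ρ') js)
                    (trans (sym (keys⇒ e<D j~j')) (sym eq)) (∈-map⁺ (key (suc e) ∘ ρ') j'∈))

    extend-similar : ∀ {k} {ρ ρ' : Fin k → X} {y y'} → Similar c ρ ρ' → c y ≡ c y' →
      (∀ {e} → e ≤ D → ∀ j → key e y ≡ key e (ρ j) ⇔ key e y' ≡ key e (ρ' j)) → Similar c (ext y ρ) (ext y' ρ')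
    extend-similar {ρ = ρ} {ρ'} {y} {y'} sr cy ky = record { colours = cs ; keys = ks }
      where
      open Similar sr
      cs : ∀ i → c (ext y ρ i) ≡ c (ext y' ρ' i)
      cs zero    = cy
      cs (suc i) = colours i
      ks : ∀ {e} → e ≤ D → ∀ i j → key e (ext y ρ i) ≡ key e (ext y ρ j) ⇔ key e (ext y' ρ' i) ≡ key e (ext y' ρ' j)
      ks e≤ zero    zero    = mk⇔ (λ _ → refl) (λ _ → refl)
      ks e≤ zero    (suc j) = ky e≤ j
      ks e≤ (suc i) zero    = mk⇔ (sym ∘ Equivalence.to (ky e≤ i) ∘ sym) (sym ∘ Equivalence.from (ky e≤ i) ∘ sym)
      ks e≤ (suc i) (suc j) = keys e≤ i j

    -- Choose `y'` with the colour of `y`, in the class of `ρ' i` on the level `e` where `y` leaves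
    -- the tuple, and outside the branches of all `ρ' j` on the next level. On levels up to `e` it
    -- agrees with `ρ' i`; on deeper levels it shares a key with no entry, just as `y` does.
    forth : ∀ {k} {ρ ρ' : Fin k → X} → Similar (refinement k) ρ ρ' → ∀ y →
      ∃ λ y' → Similar c (ext y ρ) (ext y' ρ')
    -- Both tuples live in the same structure, so over the empty tuple `y` is matched with itself.
    forth {zero}  sr y = y , extend-similar (similar-map (refinement-colour {0}) sr) refl λ _ ()
    forth {suc k} {ρ} {ρ'} sr y with deepest ρ y D
    ... | e , e≤D , (i , y~i) , above with candidate
      where
      open Similar sr
      candidate : ∃ λ y' → InClass e (ρ' i) (c y) y' × (∀ j → e < D → key (suc e) y' ≢ key (suc e) (ρ' j))
      candidate with m≤n⇒m<n∨m≡n e≤D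
      ... | inj₁ e<D with escape sr e<D y i y~i (λ j → above j ≤-refl e<D)
      ...   | y' , y'∈ , y'≁ = y' , y'∈ , λ j _ → y'≁ j
      -- On the bottom level there is nothing to escape from: any element of the right colour at the
      -- node of `ρ' i` will do.
      candidate | inj₂ refl with refinement-meets (colours i) ≤-refl (y , y~i , refl)
      ...   | y' , y'∈ = y' , y'∈ , λ j D<D → contradiction D<D (<-irrefl refl)
    ... | y' , (y'~i , cy') , y'≁ =
      y' , extend-similar (similar-map (refinement-colour {suc k}) sr) (sym cy') ky
      where
      open Similar sr
      ky : ∀ {e'} → e' ≤ D → ∀ j → key e' y ≡ key e' (ρ j) ⇔ key e' y' ≡ key e' (ρ' j)
      ky {e'} e'≤D j with e' ≤? e
      ... | yes e'≤e = mk⇔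
        (λ eq → trans (key-mono e'≤e e≤D y'~i) (keys⇒ e'≤D (trans (sym (key-mono e'≤e e≤D y~i)) eq)))
        (λ eq → trans (key-mono e'≤e e≤D y~i) (keys⇐ e'≤D (trans (sym (key-mono e'≤e e≤D y'~i)) eq)))
      ... | no e'≰e = mk⇔
        (λ eq → contradiction eq (above j e<e' e'≤D))
        (λ eq → contradiction (key-mono e<e' e'≤D eq) (y'≁ j (≤-trans e<e' e'≤D)))
        where
        e<e' : e < e'
        e<e' = ≰⇒> e'≰e

-- Invariance of first-order formulas under similarity

bool? : (b : Bool) → Dec (b ≡ true)
bool? b = b Bool.≟ true

does⇒ : ∀ {P : Set} (P? : Dec P) → does P? ≡ true → P
does⇒ (yes p) _ = p

-- A quantifier is refined for tuples of length `k`, the environment before the bound variable joins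
-- it.
formulaSize : ∀ {p m} (d : ℕ) {k} → Fm p m k → ℕ
formulaSize {p} {m} d (x ≐ y)     = (m * d) * (2 ^ d * 2 ^ p)
formulaSize {p} {m} d (edge x y)  = (m * d) * (2 ^ d * 2 ^ p)
formulaSize {p} {m} d (sim x y)   = (m * d) * (2 ^ d * 2 ^ p)
formulaSize {p} {m} d (copyQ i x) = (m * d) * (2 ^ d * 2 ^ p)
formulaSize {p} {m} d (param j x) = (m * d) * (2 ^ d * 2 ^ p)
formulaSize {p} {m} d ⊤ᶠ          = (m * d) * (2 ^ d * 2 ^ p)
formulaSize {p} {m} d ⊥ᶠ          = (m * d) * (2 ^ d * 2 ^ p)
formulaSize d (¬ᶠ φ)      = formulaSize d φ
formulaSize d (φ ∧ᶠ ψ)    = formulaSize d φ * formulaSize d ψ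
formulaSize d (φ ∨ᶠ ψ)    = formulaSize d φ * formulaSize d ψ
formulaSize d {k} (∃ᶠ φ)  = refineSize d (formulaSize d φ) k
formulaSize d {k} (∀ᶠ φ)  = refineSize d (formulaSize d φ) k

module Invariance (G : Graph) {d : ℕ} (td : TreedepthLE G d) (p m : ℕ) (Pr : Fin p → Fin (n G) → Bool) where

  open Forest (proj₁ (proj₂ td))
  open ForestTree (proj₁ (proj₂ td))
  edges = proj₂ (proj₂ td)

  A : Str p m
  A = copyExp G p m Pr

  X : Set
  X = Fin (n G) × Fin m

  open BackAndForth {X} (×-searchable Fin-searchable Fin-searchable) (restrict proj₁ levelTree)

  copyColour : X → Fin m
  copyColour = proj₂

  depthColour : X → Fin d
  depthColour (v , _) = Fin.fromℕ< (dep-< v)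

  -- An edge always joins a vertex to one of its ancestors, so these bits of the deeper end
  -- determine it once the depth of the other end is known.
  edgeBits : Fin d → X → Fin 2
  edgeBits e (v , _) = bit (bool? (adj G v (anc (toℕ e) v)))

  paramBits : Fin p → X → Fin 2
  paramBits j (v , _) = bit (bool? (Pr j v))

  atomColour : X → Fin ((m * d) * (2 ^ d * 2 ^ p))
  atomColour = (copyColour ⊗ depthColour) ⊗ (⨂ d edgeBits ⊗ ⨂ p paramBits)

  atom-copy : ∀ {x y} → atomColour x ≡ atomColour y → proj₂ x ≡ proj₂ y
  atom-copy = ⊗-≡ˡ copyColour depthColour ∘ ⊗-≡ˡ _ _

  atom-dep : ∀ {x y} → atomColour x ≡ atomColour y → dep (proj₁ x) ≡ dep (proj₁ y)
  atom-dep {x} {y} eq = trans (sym (Fin.toℕ-fromℕ< _))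
    (trans (cong toℕ (⊗-≡ʳ copyColour depthColour (⊗-≡ˡ _ _ eq))) (Fin.toℕ-fromℕ< _))

  atom-edge : ∀ {x y} → atomColour x ≡ atomColour y → ∀ {e} → e < d →
    Edge G (proj₁ x) (anc e (proj₁ x)) → Edge G (proj₁ y) (anc e (proj₁ y))
  atom-edge {x} {y} eq {e} e<d =
    subst (λ e → Edge G (proj₁ x) (anc e (proj₁ x)) → Edge G (proj₁ y) (anc e (proj₁ y))) (Fin.toℕ-fromℕ< e<d)
      (bit-≡ {P? = bool? _} {bool? _}
        (⨂-≡ d edgeBits x y (⊗-≡ˡ (⨂ d edgeBits) (⨂ p paramBits) (⊗-≡ʳ _ _ eq)) (Fin.fromℕ< e<d)))

  atom-param : ∀ {x y} → atomColour x ≡ atomColour y → ∀ j → Pr j (proj₁ x) ≡ true → Pr j (proj₁ y) ≡ true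
  atom-param {x} {y} eq j = bit-≡ {P? = bool? _} {bool? _}
    (⨂-≡ p paramBits x y (⊗-≡ʳ (⨂ d edgeBits) (⨂ p paramBits) (⊗-≡ʳ _ _ eq)) j)

  same-anc : ∀ {M k} {c : X → Fin M} {ρ ρ' : Fin k → X} → Similar c ρ ρ' → ∀ {e} → e < d → ∀ i j →
    anc e (proj₁ (ρ i)) ≡ anc e (proj₁ (ρ j)) → anc e (proj₁ (ρ' i)) ≡ anc e (proj₁ (ρ' j))
  same-anc sr e<d i j eq = nodeKey-≡⇒ e<d (Similar.keys⇒ sr e<d (nodeKey-≡⇐ eq))

  -- On a level at least as deep as both images `anc` is the identity, so equal keys there mean
  -- equal vertices.
  same-vertex : ∀ {M k} {c : X → Fin M} {ρ ρ' : Fin k → X} → Similar c ρ ρ' → ∀ i j →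
    proj₁ (ρ i) ≡ proj₁ (ρ j) → proj₁ (ρ' i) ≡ proj₁ (ρ' j)
  same-vertex {ρ = ρ} {ρ'} sr i j eq = begin
    proj₁ (ρ' i)                  ≡⟨ anc-deep (m≤n⊔m (dep (proj₁ (ρ' j))) _) ⟨
    anc e (proj₁ (ρ' i))          ≡⟨ same-anc sr e<d i j (cong (anc e) eq) ⟩
    anc e (proj₁ (ρ' j))          ≡⟨ anc-deep (m≤m⊔n _ (dep (proj₁ (ρ' i)))) ⟩
    proj₁ (ρ' j)                  ∎
    where
    open ≡-Reasoning
    e : ℕ
    e = dep (proj₁ (ρ' j)) ⊔ dep (proj₁ (ρ' i))
    e<d : e < d
    e<d = ⊔-pres-<m (dep-< _) (dep-< _)

  -- Equal depth colours and the pattern of keys make `ρ' i` the ancestor of `ρ' j` of depth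
  -- `dep u`, so the same bit of the lower end is consulted on both sides.
  same-edge-up : ∀ {k} {ρ ρ' : Fin k → X} → Similar atomColour ρ ρ' → ∀ i j →
    Anc (proj₁ td) (proj₁ (ρ i)) (proj₁ (ρ j)) → Edge G (proj₁ (ρ j)) (proj₁ (ρ i)) → Edge G (proj₁ (ρ' j)) (proj₁ (ρ' i))
  same-edge-up {ρ = ρ} {ρ'} sr i j a uv = subst (Edge G (proj₁ (ρ' j))) above'
    (atom-edge (colours j) (dep-< u) (subst (Edge G (proj₁ (ρ j))) (sym (anc-Anc a)) uv))
    where
    open Similar sr
    u = proj₁ (ρ i)
    above' : anc (dep u) (proj₁ (ρ' j)) ≡ proj₁ (ρ' i)
    above' = begin
      anc (dep u) (proj₁ (ρ' j))  ≡⟨ same-anc sr (dep-< u) i j (trans (anc-deep ≤-refl) (sym (anc-Anc a))) ⟨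
      anc (dep u) (proj₁ (ρ' i))  ≡⟨ anc-deep (≤-reflexive (sym (atom-dep (colours i)))) ⟩
      proj₁ (ρ' i)                ∎
      where open ≡-Reasoning

  same-edge : ∀ {k} {ρ ρ' : Fin k → X} → Similar atomColour ρ ρ' → ∀ i j →
    Edge G (proj₁ (ρ i)) (proj₁ (ρ j)) → Edge G (proj₁ (ρ' i)) (proj₁ (ρ' j))
  same-edge sr i j uv with edges _ _ uv
  ... | inj₁ a = trans (Graph.sym G _ _) (same-edge-up sr i j a (trans (Graph.sym G _ _) uv))
  ... | inj₂ a = same-edge-up sr j i a uv

  formulaColour : ∀ {k} (φ : Fm p m k) → X → Fin (formulaSize d φ)
  formulaColour (x ≐ y)     = atomColour
  formulaColour (edge x y)  = atomColour
  formulaColour (sim x y)   = atomColour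
  formulaColour (copyQ i x) = atomColour
  formulaColour (param j x) = atomColour
  formulaColour ⊤ᶠ          = atomColour
  formulaColour ⊥ᶠ          = atomColour
  formulaColour (¬ᶠ φ)      = formulaColour φ
  formulaColour (φ ∧ᶠ ψ)    = formulaColour φ ⊗ formulaColour ψ
  formulaColour (φ ∨ᶠ ψ)    = formulaColour φ ⊗ formulaColour ψ
  formulaColour {k} (∃ᶠ φ)  = refinement (formulaColour φ) k
  formulaColour {k} (∀ᶠ φ)  = refinement (formulaColour φ) k

  -- One implication suffices because similarity is symmetric; negation and `∀ᶠ` use it in the
  -- opposite direction.
  invariant : ∀ {k} (φ : Fm p m k) {ρ ρ'} → Similar (formulaColour φ) ρ ρ' → Sat A φ ρ → Sat A φ ρ'
  invariant (x ≐ y) sr eq = cong₂ _,_ (same-vertex sr x y (cong proj₁ eq))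
    (trans (sym (atom-copy (colours x))) (trans (cong proj₂ eq) (atom-copy (colours y))))
    where open Similar sr
  invariant (edge x y) sr (i≡j , uv) =
    trans (sym (atom-copy (colours x))) (trans i≡j (atom-copy (colours y))) , same-edge sr x y uv
    where open Similar sr
  invariant (sim x y)   sr eq = same-vertex sr x y eq
  invariant (copyQ i x) sr eq = trans (sym (atom-copy (Similar.colours sr x))) eq
  invariant (param j x) sr    = atom-param (Similar.colours sr x) j
  invariant ⊤ᶠ          sr s  = s
  invariant (¬ᶠ φ)      sr ¬s = λ s → ¬s (invariant φ (similar-sym sr) s)
  invariant (φ ∧ᶠ ψ)    sr (s , t) =
    invariant φ (similar-map (⊗-≡ˡ _ (formulaColour ψ)) sr) s ,
    invariant ψ (similar-map (⊗-≡ʳ (formulaColour φ) _) sr) t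
  invariant (φ ∨ᶠ ψ)    sr (inj₁ s) = inj₁ (invariant φ (similar-map (⊗-≡ˡ _ (formulaColour ψ)) sr) s)
  invariant (φ ∨ᶠ ψ)    sr (inj₂ t) = inj₂ (invariant ψ (similar-map (⊗-≡ʳ (formulaColour φ) _) sr) t)
  invariant (∃ᶠ φ)      sr (x , s) with forth (formulaColour φ) sr x
  ... | y , sr' = y , invariant φ sr' s
  invariant (∀ᶠ φ)      sr s y with forth (formulaColour φ) (similar-sym sr) y
  ... | x , sr' = invariant φ (similar-sym sr') (s x)

-- Tree models

record TreeModel (G : Graph) (D M : ℕ) (S : Fin M → Fin M → ℕ → Bool) : Set where
  field
    tree : LevelTree (Fin (n G)) D
    col  : Fin (n G) → Fin M
  open LevelTree tree public
  field
    adj-S : ∀ u v → u ≢ v → adj G u v ≡ S (col u) (col v) (lev u v)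

Decomposable : GraphClass → Set
Decomposable 𝒢 = Σ ℕ λ D → Σ ℕ λ M → Σ (Fin M → Fin M → ℕ → Bool) λ S → ∀ G → 𝒢 G → TreeModel G D M S

≡true-ext : ∀ {a b : Bool} → (a ≡ true ⇔ b ≡ true) → a ≡ b
≡true-ext {true}  {true}  _ = refl
≡true-ext {true}  {false} h = sym (Equivalence.to h refl)
≡true-ext {false} {true}  h = Equivalence.from h refl
≡true-ext {false} {false} _ = refl

-- The table of a graph is made part of the colour of each of its vertices, so that one signature
-- serves all graphs.
module Table (D M : ℕ) where

  K : ℕ
  K = 2 ^ (suc D * (M * M))

  -- Two vertices of one graph carry the same table, so that of the first colour is read.
  readTable : Fin M × Fin K → Fin M × Fin K → ∀ {l} → Dec (l < suc D) → Bool
  readTable (i , t) (j , _) (yes l<) = does (finToFun {2} {suc D * (M * M)} t (combine (Fin.fromℕ< l<) (combine i j)) Fin.≟ suc zero)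
  readTable _       _       (no _)   = false

  tableS : Fin (M * K) → Fin (M * K) → ℕ → Bool
  tableS a b l = readTable (remQuot K a) (remQuot K b) (l <? suc D)

  module _ {T : ℕ → Fin M → Fin M → Set} (T? : ∀ l i j → Dec (T l i j)) where

    entry : Fin (suc D) × Fin (M * M) → Fin 2
    entry (l , ij) = bit (T? (toℕ l) (proj₁ (remQuot {M} M ij)) (proj₂ (remQuot {M} M ij)))

    table : Fin K
    table = funToFin (entry ∘ remQuot (M * M))

    read-entry : ∀ (l : Fin (suc D)) i j → finToFun table (combine l (combine i j)) ≡ bit (T? (toℕ l) i j)
    read-entry l i j = begin
      finToFun table (combine l (combine i j))            ≡⟨ Fin.finToFun-funToFin (entry ∘ remQuot (M * M)) _ ⟩
      entry (remQuot (M * M) (combine l (combine i j)))   ≡⟨ cong entry (Fin.remQuot-combine l (combine i j)) ⟩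
      entry (l , combine i j)                             ≡⟨ cong (λ (i , j) → bit (T? (toℕ l) i j)) (Fin.remQuot-combine i j) ⟩
      bit (T? (toℕ l) i j)                                ∎
      where open ≡-Reasoning

    bit-does : ∀ {P : Set} (P? : Dec P) → does (bit P? Fin.≟ suc zero) ≡ does P?
    bit-does (yes _) = refl
    bit-does (no _)  = refl

    tableS-correct : ∀ i j {l} → l ≤ D → tableS (combine i table) (combine j table) l ≡ does (T? l i j)
    tableS-correct i j {l} l≤D = begin
      tableS (combine i table) (combine j table) l
        ≡⟨ cong₂ (λ a b → readTable a b (l <? suc D)) (Fin.remQuot-combine i table) (Fin.remQuot-combine j table) ⟩
      readTable (i , table) (j , table) (l <? suc D)  ≡⟨ at-level (l <? suc D) ⟩
      does (T? l i j)                                 ∎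
      where
      open ≡-Reasoning
      at-level : ∀ q → readTable (i , table) (j , table) {l} q ≡ does (T? l i j)
      at-level (yes q) = begin
        does (finToFun table (combine (Fin.fromℕ< q) (combine i j)) Fin.≟ suc zero)
          ≡⟨ cong (λ b → does (b Fin.≟ suc zero)) (read-entry (Fin.fromℕ< q) i j) ⟩
        does (bit (T? (toℕ (Fin.fromℕ< q)) i j) Fin.≟ suc zero) ≡⟨ bit-does (T? (toℕ (Fin.fromℕ< q)) i j) ⟩
        does (T? (toℕ (Fin.fromℕ< q)) i j) ≡⟨ cong (λ l → does (T? l i j)) (Fin.toℕ-fromℕ< q) ⟩
        does (T? l i j) ∎
      at-level (no ¬q) = contradiction (s≤s l≤D) ¬q

-- From transductions to tree models

Cond1⇒Decomposable : ∀ {𝒢} → Cond1 𝒢 → Decomposable 𝒢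
Cond1⇒Decomposable {𝒢} (𝒢' , (d , td) , τ , image) = d , M * K , tableS , model
  where
  open Transduction τ
  M : ℕ
  M = formulaSize d φ
  open Table d M
  model : ∀ G → 𝒢 G → TreeModel G d (M * K) tableS
  model G G∈ with image G G∈
  ... | G' , G'∈ , Pr , _ , f , f-inj , _ , f-edge = record
    { tree = T ; col = λ u → combine (c u) (table pattern?) ; adj-S = adj-S }
    where
    open Invariance G' (td G' G'∈) p m Pr
    open ForestTree (proj₁ (proj₂ (td G' G'∈))) using (levelTree; nodeKey)
    open BackAndForth {X} (×-searchable Fin-searchable Fin-searchable) (restrict proj₁ levelTree) using (Similar)
    T : LevelTree (Fin (n G)) d
    T = restrict (proj₁ ∘ f) levelTree
    open LevelTree T using (N; key; lev; lev-≤; lev-key; lev-max)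
    c : Fin (n G) → Fin M
    c u = formulaColour φ (f u)
    -- The table records whether some edge has these colours and this level; by `invariant-edge` all
    -- pairs of distinct vertices with the same data are then edges.
    Pattern : ℕ → Fin M → Fin M → Fin (n G) × Fin (n G) → Set
    Pattern l i j (u , v) = (c u ≡ i × c v ≡ j × lev u v ≡ l) × u ≢ v × Edge G u v
    pattern? : ∀ l i j → Dec (∃ (Pattern l i j))
    pattern? l i j = ×-searchable Fin-searchable Fin-searchable λ (u , v) →
      ((c u Fin.≟ i) ×-dec (c v Fin.≟ j) ×-dec (lev u v ≟ l)) ×-dec ¬? (u Fin.≟ v) ×-dec bool? (adj G u v)
    similar : ∀ {u v u' v'} → c u ≡ c u' → c v ≡ c v' → lev u v ≡ lev u' v' →
      Similar (formulaColour φ) (env2 (f u) (f v)) (env2 (f u') (f v'))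
    similar {u} {v} {u'} {v'} cu cv eq = record { colours = colours ; keys = keys }
      where
      colours : ∀ i → formulaColour φ (env2 (f u) (f v) i) ≡ formulaColour φ (env2 (f u') (f v') i)
      colours zero       = cu
      colours (suc zero) = cv
      transfer : ∀ {u v u' v' e} → e ≤ d → lev u v ≡ lev u' v' → key e u ≡ key e v → key e u' ≡ key e v'
      transfer e≤ eq k = lev-key (subst (_ ≤_) eq (lev-max e≤ k))
      keyᴬ : ℕ → X → Fin N
      keyᴬ e x = nodeKey e (proj₁ x)
      keys : ∀ {e} → e ≤ d → ∀ i j → keyᴬ e (env2 (f u) (f v) i) ≡ keyᴬ e (env2 (f u) (f v) j) ⇔
        keyᴬ e (env2 (f u') (f v') i) ≡ keyᴬ e (env2 (f u') (f v') j)
      keys e≤ zero       zero       = mk⇔ (λ _ → refl) (λ _ → refl)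
      keys e≤ zero       (suc zero) = mk⇔ (transfer e≤ eq) (transfer e≤ (sym eq))
      keys e≤ (suc zero) zero       = mk⇔ (sym ∘ transfer e≤ eq ∘ sym) (sym ∘ transfer e≤ (sym eq) ∘ sym)
      keys e≤ (suc zero) (suc zero) = mk⇔ (λ _ → refl) (λ _ → refl)
    invariant-edge : ∀ {u v u' v'} → u ≢ v → u' ≢ v' → c u ≡ c u' → c v ≡ c v' → lev u v ≡ lev u' v' →
      Edge G u v → Edge G u' v'
    invariant-edge {u} {v} {u'} {v'} u≢v u'≢v' cu cv eq uv with Equivalence.to (f-edge u v u≢v) uv
    ... | inj₁ s = Equivalence.from (f-edge u' v' u'≢v') (inj₁ (invariant φ (similar cu cv eq) s))
    ... | inj₂ s = Equivalence.from (f-edge u' v' u'≢v') (inj₂ (invariant φ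
      (similar cv cu (trans (LevelTree.lev-sym T v u) (trans eq (LevelTree.lev-sym T u' v')))) s))
    adj-S : ∀ u v → u ≢ v → adj G u v ≡
      tableS (combine (c u) (table pattern?)) (combine (c v) (table pattern?)) (lev u v)
    adj-S u v u≢v = trans (≡true-ext (mk⇔ to from)) (sym (tableS-correct pattern? (c u) (c v) (lev-≤ u v)))
      where
      P? = pattern? (lev u v) (c u) (c v)
      to : Edge G u v → does P? ≡ true
      to uv = dec-true P? ((u , v) , (refl , refl , refl) , u≢v , uv)
      from : does P? ≡ true → Edge G u v
      from eq with does⇒ P? eq
      ... | (u' , v') , (cu , cv , l) , u'≢v' , uv = invariant-edge u'≢v' u≢v cu cv l uv

-- Lacon-decompositions

-- A hidden vertex is a level, a node and an index below `Q`. The order puts deeper levels higher,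
-- breaks ties by the priority `pr` and then arbitrarily, and puts all targets on top.
module Layered {t D : ℕ} (T : LevelTree (Fin t) D) (Q : ℕ) (pr : Fin Q → Fin 2) where

  open LevelTree T

  m : ℕ
  m = suc D * (N * Q)

  hidden : Fin (suc D) → Fin N → Fin Q → Fin m
  hidden e a q = combine e (combine a q)

  split : Fin m → Fin (suc D) × Fin N × Fin Q
  split h = proj₁ (remQuot (N * Q) h) , remQuot Q (proj₂ (remQuot {suc D} (N * Q) h))

  split-hidden : ∀ e a q → split (hidden e a q) ≡ (e , a , q)
  split-hidden e a q = trans (cong (λ (e , aq) → e , remQuot {N} Q aq) (Fin.remQuot-combine e (combine a q)))
    (cong (e ,_) (Fin.remQuot-combine a q))

  hlev : Fin m → Fin (suc D)
  hlev h = proj₁ (split h)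

  hnode : Fin m → Fin N
  hnode h = proj₁ (proj₂ (split h))

  hindex : Fin m → Fin Q
  hindex h = proj₂ (proj₂ (split h))

  hidden-split : ∀ h → hidden (hlev h) (hnode h) (hindex h) ≡ h
  hidden-split h = trans (cong (combine (hlev h)) (Fin.combine-remQuot {N} Q _)) (Fin.combine-remQuot {suc D} (N * Q) h)

  hlev-≤ : ∀ h → toℕ (hlev h) ≤ D
  hlev-≤ h = ≤-pred (Fin.toℕ<n (hlev h))

  class : Fin m → Fin (suc D * 2)
  class h = combine (hlev h) (pr (hindex h))

  π : Fin t ⊎ Fin m → ℕ
  π (inj₁ v) = suc D * 2 * m + toℕ v
  π (inj₂ h) = toℕ (combine (class h) h)

  π-hid : ∀ h v → π (inj₂ h) < π (inj₁ v)
  π-hid h v = <-≤-trans (Fin.toℕ<n (combine (class h) h)) (m≤m+n _ _)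

  π-inj : Injective _≡_ _≡_ π
  π-inj {inj₁ u} {inj₁ v} eq = cong inj₁ (Fin.toℕ-injective (+-cancelˡ-≡ (suc D * 2 * m) _ _ eq))
  π-inj {inj₁ u} {inj₂ h} eq = contradiction (sym eq) (<⇒≢ (π-hid h u))
  π-inj {inj₂ h} {inj₁ u} eq = contradiction eq (<⇒≢ (π-hid h u))
  π-inj {inj₂ h} {inj₂ k} eq = cong inj₂ (Fin.combine-injectiveʳ (class h) h (class k) k (Fin.toℕ-injective eq))

  π-class : ∀ {h h'} → π (inj₂ h) ≤ π (inj₂ h') → class h Fin.≤ class h'
  π-class {h} {h'} le = ≮⇒≥ λ lt → <⇒≱ (Fin.combine-monoˡ-< {i = class h'} {class h} h' h lt) le

  π-hlev : ∀ {h h'} → π (inj₂ h) ≤ π (inj₂ h') → hlev h Fin.≤ hlev h'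
  π-hlev {h} {h'} le = ≮⇒≥ λ lt →
    <⇒≱ (Fin.combine-monoˡ-< {i = hlev h'} {hlev h} (pr (hindex h')) (pr (hindex h)) lt) (π-class {h} {h'} le)

  π-pr : ∀ {h h'} → π (inj₂ h) ≤ π (inj₂ h') → hlev h ≡ hlev h' → pr (hindex h) Fin.≤ pr (hindex h')
  π-pr {h} {h'} le eq = +-cancelˡ-≤ (2 * toℕ (hlev h)) _ _ (begin
    2 * toℕ (hlev h) + toℕ (pr (hindex h))    ≡⟨ Fin.toℕ-combine (hlev h) (pr (hindex h)) ⟨
    toℕ (class h)                             ≤⟨ π-class {h} {h'} le ⟩
    toℕ (class h')                            ≡⟨ Fin.toℕ-combine (hlev h') (pr (hindex h')) ⟩
    2 * toℕ (hlev h') + toℕ (pr (hindex h'))  ≡⟨ cong (λ e → 2 * toℕ e + toℕ (pr (hindex h'))) eq ⟨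
    2 * toℕ (hlev h) + toℕ (pr (hindex h'))   ∎)
    where open ≤-Reasoning

  parent^ : ℕ → Fin N → Fin N
  parent^ zero    x = x
  parent^ (suc j) x = parent^ j (parent x)

  parent^-key : ∀ j {e} v → j + e ≤ D → parent^ j (key (j + e) v) ≡ key e v
  parent^-key zero    v _  = refl
  parent^-key (suc j) v j< = trans (cong (parent^ j) (key-up j< v)) (parent^-key j v (<⇒≤ j<))

  module _ (a : Fin t → Fin m → Bool) (local : ∀ {v h} → a v h ≡ true → hnode h ≡ key (toℕ (hlev h)) v) where

    keyOf : ℕ → Fin t ⊎ Fin m → Fin N
    keyOf e (inj₁ v) = key e v
    keyOf e (inj₂ h) = parent^ (toℕ (hlev h) ∸ e) (hnode h)

    Above : ℕ → Fin t ⊎ Fin m → Set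
    Above e (inj₁ _) = ⊤
    Above e (inj₂ h) = e ≤ toℕ (hlev h)

    keyOf-target : ∀ {e v h} → a v h ≡ true → e ≤ toℕ (hlev h) → keyOf e (inj₂ h) ≡ key e v
    keyOf-target {e} {v} {h} vh e≤ = begin
      parent^ (l ∸ e) (hnode h)            ≡⟨ cong (parent^ (l ∸ e)) (local vh) ⟩
      parent^ (l ∸ e) (key l v)            ≡⟨ cong (λ l' → parent^ (l ∸ e) (key l' v)) (m∸n+n≡m e≤) ⟨
      parent^ (l ∸ e) (key (l ∸ e + e) v)  ≡⟨ parent^-key (l ∸ e) v (subst (_≤ D) (sym (m∸n+n≡m e≤)) (hlev-≤ h)) ⟩
      key e v                              ∎
      where
      open ≡-Reasoning
      l = toℕ (hlev h)

    keyOf-edge : ∀ {e} x y → LEdge a x y → Above e x → Above e y → keyOf e x ≡ keyOf e y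
    keyOf-edge (inj₁ v) (inj₂ h) vh _ e≤ = sym (keyOf-target {h = h} vh e≤)
    keyOf-edge (inj₂ h) (inj₁ v) vh e≤ _ = keyOf-target {h = h} vh e≤

    above : ∀ {h} x → π (inj₂ h) ≤ π x → Above (toℕ (hlev h)) x
    above     (inj₁ _) _  = tt
    above {h} (inj₂ k) le = π-hlev {h} {k} le

    walk-keyOf : ∀ {e x y} (p : Walk (LEdge a) x y) → All (Above e) (verts p) → keyOf e x ≡ keyOf e y
    walk-keyOf []      _         = refl
    walk-keyOf (xw ∷ p) (ax ∷ ap) = trans (keyOf-edge _ _ xw ax (walk-first p ap)) (walk-keyOf p ap)

    -- All hidden vertices on the walk have at least the level of `h`, so the ancestor on that level
    -- stays the same along the walk, and `h` sits at the one of `x`.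
    reach-hidden : ∀ {x h} → WReach (LEdge a) π x (inj₂ h) → keyOf (toℕ (hlev h)) x ≡ hnode h
    reach-hidden {h = h} (p , _ , ge) = trans (walk-keyOf p (All.map (λ {y} → above {h} y) ge))
      (cong (λ j → parent^ j (hnode h)) (n∸n≡0 (toℕ (hlev h))))

    -- A walk with at least one step visits a hidden vertex, which is smaller than every target.
    reach-target : ∀ {x v} → WReach (LEdge a) π x (inj₁ v) → x ≡ inj₁ v
    reach-target ([] , _ , _) = refl
    reach-target {inj₂ h} {v} (_ ∷ _ , _ , ge ∷ _) = contradiction ge (<⇒≱ (π-hid h v))
    reach-target {inj₁ _} {v} (_∷_ {v = inj₂ h} _ p , _ , _ ∷ ge) = contradiction (walk-first p ge) (<⇒≱ (π-hid h v))

    -- At most one target is weakly reachable, hence one code for all of them; the node of a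
    -- reachable hidden vertex is determined by its level.
    code : Fin t ⊎ Fin m → Fin (suc (suc D * Q))
    code (inj₁ _) = zero
    code (inj₂ h) = suc (combine (hlev h) (hindex h))

    wcol-layered : WcolInfLE (LEdge a) π (suc (suc D * Q))
    wcol-layered x = length-≤-code code injective
      where
      injective : ∀ {y z} → WReach (LEdge a) π x y → WReach (LEdge a) π x z → code y ≡ code z → y ≡ z
      injective {inj₁ _} {inj₁ _} ry rz _ = trans (sym (reach-target ry)) (reach-target rz)
      injective {inj₂ h} {inj₂ k} ry rz eq = cong inj₂ (begin
        h                                       ≡⟨ hidden-split h ⟨
        hidden (hlev h) (hnode h) (hindex h)    ≡⟨ cong₂ (λ l q → hidden l (hnode h) q) l≡ q≡ ⟩
        hidden (hlev k) (hnode h) (hindex k)    ≡⟨ cong (λ a → hidden (hlev k) a (hindex k)) node≡ ⟩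
        hidden (hlev k) (hnode k) (hindex k)    ≡⟨ hidden-split k ⟩
        k                                       ∎)
        where
        open ≡-Reasoning
        l≡ = Fin.combine-injectiveˡ (hlev h) (hindex h) (hlev k) (hindex k) (Fin.suc-injective eq)
        q≡ = Fin.combine-injectiveʳ (hlev h) (hindex h) (hlev k) (hindex k) (Fin.suc-injective eq)
        node≡ : hnode h ≡ hnode k
        node≡ = trans (sym (reach-hidden ry)) (trans (cong (λ l → keyOf (toℕ l) x) l≡) (reach-hidden rz))

module LaconModel {G : Graph} {D M : ℕ} {S : Fin M → Fin M → ℕ → Bool} (model : TreeModel G D M S) where

  open TreeModel model

  -- Two vertices of one colour `i` see every pair containing `i` at their common ancestor, whatever
  -- the other colour. Diagonal pairs get the higher priority so that the dominant vertex carries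
  -- the pair of `i` with itself.
  diagonal : Fin (M * M) → Fin 2
  diagonal xy = bit (proj₁ (remQuot {M} M xy) Fin.≟ proj₂ (remQuot {M} M xy))

  open Layered tree (M * M) diagonal

  first second : Fin m → Fin M
  first h  = proj₁ (remQuot {M} M (hindex h))
  second h = proj₂ (remQuot {M} M (hindex h))

  Adj : Fin (n G) → Fin m → Set
  Adj v h = hnode h ≡ key (toℕ (hlev h)) v × (first h ≡ col v ⊎ second h ≡ col v)

  adj? : ∀ v h → Dec (Adj v h)
  adj? v h = (hnode h Fin.≟ key (toℕ (hlev h)) v) ×-dec ((first h Fin.≟ col v) ⊎-dec (second h Fin.≟ col v))

  ladj : Fin (n G) → Fin m → Bool
  ladj v h = does (adj? v h)

  ladj⇒ : ∀ {v h} → ladj v h ≡ true → Adj v h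
  ladj⇒ {v} {h} = does⇒ (adj? v h)

  label : Fin m → Bool
  label h = S (first h) (second h) (toℕ (hlev h))

  meeting : Fin (n G) → Fin (n G) → Fin m
  meeting u v = hidden (Fin.fromℕ< (s≤s (lev-≤ u v))) (key (lev u v) u) (combine (col u) (col v))

  split-meeting : ∀ u v → split (meeting u v) ≡ (Fin.fromℕ< (s≤s (lev-≤ u v)) , key (lev u v) u , combine (col u) (col v))
  split-meeting u v = split-hidden _ _ _

  meeting-lev : ∀ u v → toℕ (hlev (meeting u v)) ≡ lev u v
  meeting-lev u v = trans (cong (toℕ ∘ proj₁) (split-meeting u v)) (Fin.toℕ-fromℕ< _)

  meeting-node : ∀ u v → hnode (meeting u v) ≡ key (lev u v) u
  meeting-node u v = cong (proj₁ ∘ proj₂) (split-meeting u v)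

  meeting-index : ∀ u v → hindex (meeting u v) ≡ combine (col u) (col v)
  meeting-index u v = cong (proj₂ ∘ proj₂) (split-meeting u v)

  meeting-first : ∀ u v → first (meeting u v) ≡ col u
  meeting-first u v = trans (cong (proj₁ ∘ remQuot {M} M) (meeting-index u v)) (cong proj₁ (Fin.remQuot-combine (col u) (col v)))

  meeting-second : ∀ u v → second (meeting u v) ≡ col v
  meeting-second u v = trans (cong (proj₂ ∘ remQuot {M} M) (meeting-index u v)) (cong proj₂ (Fin.remQuot-combine (col u) (col v)))

  meeting-key : ∀ u v → hnode (meeting u v) ≡ key (toℕ (hlev (meeting u v))) u
  meeting-key u v = trans (meeting-node u v) (cong (λ l → key l u) (sym (meeting-lev u v)))

  meeting-adjˡ : ∀ u v → ladj u (meeting u v) ≡ true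
  meeting-adjˡ u v = dec-true (adj? _ _) (meeting-key u v , inj₁ (meeting-first u v))

  meeting-adjʳ : ∀ u v → ladj v (meeting u v) ≡ true
  meeting-adjʳ u v = dec-true (adj? _ _)
    (trans (meeting-key u v) (lev-key (≤-reflexive (meeting-lev u v))) , inj₂ (meeting-second u v))

  module _ {u v h} (u≢v : u ≢ v) (uh : Adj u h) (vh : Adj v h) (dominates : π (inj₂ (meeting u v)) ≤ π (inj₂ h)) where

    -- A common neighbour sits at a common ancestor, so its level is at most `lev u v`; dominating
    -- `meeting u v` forces it to be at least that.
    level : toℕ (hlev h) ≡ lev u v
    level = ≤-antisym
      (lev-max (hlev-≤ h) (trans (sym (proj₁ uh)) (proj₁ vh)))
      (subst (_≤ toℕ (hlev h)) (meeting-lev u v) (π-hlev {meeting u v} {h} dominates))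

    meeting-diagonal : col u ≡ col v → first h ≡ second h
    meeting-diagonal eq = is-diagonal (first h Fin.≟ second h) refl
      where
      is-diagonal : (d : Dec (first h ≡ second h)) → d ≡ (first h Fin.≟ second h) → first h ≡ second h
      is-diagonal (yes p) _ = p
      is-diagonal (no ¬p) d≡ = contradiction (π-pr {meeting u v} {h} dominates
          (Fin.toℕ-injective (trans (meeting-lev u v) (sym level))))
        (subst₂ (λ a b → ¬ (a Fin.≤ b)) one (cong bit d≡) λ ())
        where
        one : suc zero ≡ diagonal (hindex (meeting u v))
        one with first (meeting u v) Fin.≟ second (meeting u v)
        ... | yes _ = refl
        ... | no ¬q = contradiction (trans (meeting-first u v) (trans eq (sym (meeting-second u v)))) ¬q

    label-S : label h ≡ S (col u) (col v) (lev u v)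
    label-S = trans (cong (S (first h) (second h)) level) (by-colours (proj₂ uh) (proj₂ vh))
      where
      -- `S` need not be symmetric, but both values equal the adjacency of `u` and `v`.
      symmetric : S (col v) (col u) (lev u v) ≡ S (col u) (col v) (lev u v)
      symmetric = trans (cong (S (col v) (col u)) (lev-sym u v))
        (trans (sym (adj-S v u (u≢v ∘ sym))) (trans (Graph.sym G v u) (adj-S u v u≢v)))
      same-colour : col u ≡ col v → (first h ≡ col u ⊎ second h ≡ col u) → S (first h) (second h) (lev u v) ≡ S (col u) (col v) (lev u v)
      same-colour eq (inj₁ p) = cong₂ (λ x y → S x y (lev u v)) p (trans (sym (meeting-diagonal eq)) (trans p eq))
      same-colour eq (inj₂ p) = cong₂ (λ x y → S x y (lev u v)) (trans (meeting-diagonal eq) p) (trans p eq)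
      by-colours : (first h ≡ col u ⊎ second h ≡ col u) → (first h ≡ col v ⊎ second h ≡ col v) →
        S (first h) (second h) (lev u v) ≡ S (col u) (col v) (lev u v)
      by-colours (inj₁ p) (inj₁ q) = same-colour (trans (sym p) q) (inj₁ p)
      by-colours (inj₁ p) (inj₂ q) = cong₂ (λ x y → S x y (lev u v)) p q
      by-colours (inj₂ p) (inj₁ q) = trans (cong₂ (λ x y → S x y (lev u v)) q p) symmetric
      by-colours (inj₂ p) (inj₂ q) = same-colour (trans (sym p) q) (inj₂ p)

  lacon : Lacon G
  lacon = record
    { m = m ; ladj = ladj ; label = label ; π = π ; π-inj = π-inj ; π-hid = π-hid
    ; common = λ u v → meeting u v , meeting-adjˡ u v , meeting-adjʳ u v
    ; correct = λ u v u≢v h ((uh , vh) , max) →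
        let eq = trans (adj-S u v u≢v) (sym (label-S {h = h} u≢v (ladj⇒ {h = h} uh) (ladj⇒ {h = h} vh)
                   (max (meeting u v) (meeting-adjˡ u v) (meeting-adjʳ u v))))
        in mk⇔ (trans (sym eq)) (trans eq) }

  lacon-wcol : WcolInfLE (LEdge ladj) π (suc (suc D * (M * M)))
  lacon-wcol = wcol-layered ladj (λ {v} {h} vh → proj₁ (ladj⇒ {v} {h} vh))

Decomposable⇒Cond2 : ∀ {𝒢} → Decomposable 𝒢 → Cond2 𝒢
Decomposable⇒Cond2 (D , M , S , model) =
  suc (suc D * (M * M)) , λ G G∈ → LaconModel.lacon (model G G∈) , LaconModel.lacon-wcol (model G G∈)

-- Concatenation of walks and finite maxima

module _ {V : Set} {E : V → V → Set} where

  _++ʷ_ : ∀ {u v w} → Walk E u v → Walk E v w → Walk E u w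
  []      ++ʷ q = q
  (e ∷ p) ++ʷ q = e ∷ (p ++ʷ q)

  All-++ʷ : ∀ {u v w} {P : V → Set} (p : Walk E u v) (q : Walk E v w) → All P (verts p) → All P (verts q) → All P (verts (p ++ʷ q))
  All-++ʷ []      q _         aq = aq
  All-++ʷ (e ∷ p) q (pu ∷ ap) aq = pu ∷ All-++ʷ p q ap aq

  length-verts : ∀ {u v} (p : Walk E u v) → length (verts p) ≡ suc (wlen p)
  length-verts []      = refl
  length-verts (_ ∷ p) = cong suc (length-verts p)

argmax : ∀ {V : Set} → Searchable V → (π : V → ℕ) {P : V → Set} → (∀ v → Dec (P v)) → ∀ b → (∀ {v} → P v → π v < b) →
  (∃ λ v → P v × ∀ {u} → P u → π u ≤ π v) ⊎ (∀ v → ¬ P v)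
argmax search π P? zero    bound = inj₂ λ v p → contradiction (bound p) λ ()
argmax search π P? (suc b) bound with search (λ v → P? v ×-dec (π v ≟ b))
... | yes (v , p , refl) = inj₁ (v , p , λ q → ≤-pred (bound q))
... | no none            = argmax search π P? b λ {v} p → ≤∧≢⇒< (≤-pred (bound p)) λ eq → none (v , p , eq)

-- Elimination forests from weak reachability

-- The parent of v is the π-largest other vertex weakly reachable from v; every vertex weakly
-- reachable from v is then an ancestor of v.
module Elimination {V : Set} (search : Searchable V) (_≟ⱽ_ : DecidableEquality V)
  {N : ℕ} (finite : ∀ {xs : List V} → Unique xs → length xs ≤ N)
  {E : V → V → Set} (E? : ∀ u v → Dec (E u v)) (E-sym : ∀ {u v} → E u v → E v u)
  {π : V → ℕ} (π-inj : Injective _≡_ _≡_ π) where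

  WalkIn : (V → Set) → V → V → Set
  WalkIn P u v = Σ (Walk E u v) λ p → All P (verts p)

  -- Walks replace the paths of `WReach` because they can be concatenated; `shorten` recovers a path
  -- whose vertices satisfy the same condition.
  Reach : V → V → Set
  Reach v u = WalkIn (λ w → π u ≤ π w) v u

  reverse-append : ∀ {P u v w} → WalkIn P u v → WalkIn P u w → WalkIn P v w
  reverse-append ([]    , _)      q        = q
  reverse-append (e ∷ p , _ ∷ ap) (q , aq) = reverse-append (p , ap) (E-sym e ∷ q , walk-first p ap ∷ aq)

  from-vertex : ∀ {P : V → Set} {u v x} (p : Walk E u v) → All P (verts p) → IsPath p → x ∈ verts p →
    Σ (Walk E x v) λ q → All P (verts q) × IsPath q
  from-vertex []      ap       u       (here refl) = [] , ap , u
  from-vertex (e ∷ p) ap       u       (here refl) = e ∷ p , ap , u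
  from-vertex (e ∷ p) (_ ∷ ap) (_ ∷ u) (there x∈)  = from-vertex p ap u x∈

  shorten : ∀ {P : V → Set} {u v} (p : Walk E u v) → All P (verts p) → Σ (Walk E u v) λ q → All P (verts q) × IsPath q
  shorten []            ap        = [] , ap , [] ∷ []
  shorten (_∷_ {u} e p) (pu ∷ ap) with shorten p ap
  ... | q , aq , path with Any.any? (u ≟ⱽ_) (verts q)
  ...   | yes u∈ = from-vertex q aq path u∈
  ...   | no u∉  = e ∷ q , pu ∷ aq , All.¬Any⇒All¬ _ u∉ ∷ path

  reach⇒wreach : ∀ {v u} → Reach v u → WReach E π v u
  reach⇒wreach (p , ap) with shorten p ap
  ... | q , aq , path = q , path , aq

  wreach⇒reach : ∀ {v u} → WReach E π v u → Reach v u
  wreach⇒reach (p , _ , ap) = p , ap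

  BoundedWalkIn : (V → Set) → ℕ → V → V → Set
  BoundedWalkIn P k u v = Σ (Walk E u v) λ p → All P (verts p) × wlen p ≤ k

  boundedWalkIn? : ∀ {P} → (∀ v → Dec (P v)) → ∀ k u v → Dec (BoundedWalkIn P k u v)
  boundedWalkIn? P? k u v with P? u
  ... | no ¬pu = no λ (p , ap , _) → ¬pu (walk-first p ap)
  ... | yes pu with u ≟ⱽ v
  ...   | yes refl = yes ([] , pu ∷ [] , z≤n)
  boundedWalkIn? P? zero u v | yes pu | no u≢v = no λ { ([] , _ , _) → u≢v refl }
  boundedWalkIn? {P} P? (suc k) u v | yes pu | no u≢v =
    map′ (λ (w , e , p , ap , le) → e ∷ p , pu ∷ ap , s≤s le) uncons
      (search λ w → E? u w ×-dec boundedWalkIn? P? k w v)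
    where
    uncons : BoundedWalkIn P (suc k) u v → ∃ λ w → E u w × BoundedWalkIn P k w v
    uncons ([] , _ , _)               = contradiction refl u≢v
    uncons (e ∷ p , _ ∷ ap , s≤s le) = _ , e , p , ap , le

  -- A path has at most `N` vertices, so searching the walks of length at most `N` is exhaustive.
  reach? : ∀ v u → Dec (Reach v u)
  reach? v u = map′ (λ (p , ap , _) → p , ap) bounded (boundedWalkIn? (λ w → π u ≤? π w) N v u)
    where
    bounded : Reach v u → BoundedWalkIn (λ w → π u ≤ π w) N v u
    bounded (p , ap) with shorten p ap
    ... | q , aq , path = q , aq , <⇒≤ (subst (_≤ N) (length-verts q) (finite path))

  Below : V → V → Set
  Below v u = Reach v u × π u < π v

  greatest : ∀ v → (∃ λ w → Below v w × ∀ {u} → Below v u → π u ≤ π w) ⊎ (∀ w → ¬ Below v w)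
  greatest v = argmax search π (λ u → reach? v u ×-dec (π u <? π v)) (π v) proj₂

  par : V → Maybe V
  par v = [ just ∘ proj₁ , (λ _ → nothing) ]′ (greatest v)

  reach-≤ : ∀ {v u} → Reach v u → π u ≤ π v
  reach-≤ (p , ap) = walk-first p ap

  reach-trans : ∀ {v w u} → Reach v w → Reach w u → Reach v u
  reach-trans (p , ap) r@(q , aq) = p ++ʷ q , All-++ʷ p q (All.map (≤-trans (reach-≤ r)) ap) aq

  -- Go back from `w` to `v` and on to `u`; no vertex on either part is below `π u`.
  reach-via : ∀ {v w u} → Reach v w → Reach v u → π u ≤ π w → Reach w u
  reach-via (p , ap) q u≤w = reverse-append (p , All.map (≤-trans u≤w) ap) q

  -- Whatever is weakly reachable from the parent `w` is also reachable from `v`, and so is `v`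
  -- itself, which is too large to be reachable from `w`. The count therefore drops with each step
  -- towards the root.
  depth-bound : ∀ k v → AtMost (WReach E π v) k → DepthLE par k v
  depth-bound zero    v few = contradiction (few (v ∷ []) ([] ∷ []) (reach⇒wreach ([] , ≤-refl ∷ []) ∷ [])) λ ()
  depth-bound (suc k) v few with greatest v in eq
  ... | inj₂ _ = root (cong [ just ∘ proj₁ , (λ _ → nothing) ]′ eq)
  ... | inj₁ (w , (vw , w<v) , _) = step (cong [ just ∘ proj₁ , (λ _ → nothing) ]′ eq) (depth-bound k w fewer)
    where
    fewer : AtMost (WReach E π w) k
    fewer xs u rs = ≤-pred (few (v ∷ xs)
      (All.map (λ r v≡x → <⇒≱ w<v (subst (λ z → π z ≤ π w) (sym v≡x) (reach-≤ (wreach⇒reach r)))) rs ∷ u)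
      (reach⇒wreach ([] , ≤-refl ∷ []) ∷ All.map (reach⇒wreach ∘ reach-trans vw ∘ wreach⇒reach) rs))

  -- By maximality the parent is at least `u` in `π`, so `u` is reachable from the parent as well,
  -- and the argument repeats there.
  reach⇒Anc : ∀ {k v u} → DepthLE par k v → Reach v u → Anc par u v
  reach⇒Anc {v = v} {u} dv r with u ≟ⱽ v
  ... | yes refl = here
  ... | no u≢v with ≤∧≢⇒< (reach-≤ r) (u≢v ∘ π-inj) | greatest v in eq
  ...   | u<v | inj₂ none = contradiction (r , u<v) (none u)
  reach⇒Anc (root e) r | no _ | u<v | inj₁ _ with () ← trans (sym e) (cong [ just ∘ proj₁ , (λ _ → nothing) ]′ eq)
  reach⇒Anc {v = v} {u} (step {w = w} e dw) r | no _ | u<v | inj₁ (w' , (vw , _) , max)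
    with refl ← trans (sym e) (cong [ just ∘ proj₁ , (λ _ → nothing) ]′ eq) =
    up e (reach⇒Anc dw (reach-via vw r (max (r , u<v))))

  module _ {d : ℕ} (wcol : WcolInfLE E π d) where

    depths : ∀ v → DepthLE par d v
    depths v = depth-bound d v (wcol v)

    edge-Anc : ∀ {u v} → E u v → π u ≤ π v → Anc par u v
    edge-Anc {v = v} uv u≤v = reach⇒Anc (depths v) (E-sym uv ∷ [] , u≤v ∷ ≤-refl ∷ [])

    treedepth : TreedepthLE' E d
    treedepth = par , depths , λ u v uv → [ (λ le → inj₁ (edge-Anc uv le)) , (λ le → inj₂ (edge-Anc (E-sym uv) le)) ]′ (≤-total (π u) (π v))

TreedepthLE'-transport : ∀ {V W : Set} {E : V → V → Set} {E' : W → W → Set} {d} (to : V → W) (from : W → V) →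
  (∀ v → from (to v) ≡ v) → (∀ w → to (from w) ≡ w) → (∀ x y → E' x y → E (from x) (from y)) →
  TreedepthLE' E d → TreedepthLE' E' d
TreedepthLE'-transport {V} {W} to from from-to to-from edges' (par , depth , edges) =
  par' , (λ w → subst (DepthLE par' _) (to-from w) (depth' (depth (from w)))) ,
  λ x y xy → Sum.map (anc'' x y) (anc'' y x) (edges _ _ (edges' x y xy))
  where
  par' : W → Maybe W
  par' w = Maybe.map to (par (from w))
  par'-to : ∀ {v r} → par v ≡ r → par' (to v) ≡ Maybe.map to r
  par'-to {v} eq = cong (Maybe.map to) (trans (cong par (from-to v)) eq)
  depth' : ∀ {k v} → DepthLE par k v → DepthLE par' k (to v)
  depth' (root eq)   = root (par'-to eq)
  depth' (step eq p) = step (par'-to eq) (depth' p)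
  anc' : ∀ {u v} → Anc par u v → Anc par' (to u) (to v)
  anc' here      = here
  anc' (up eq a) = up (par'-to eq) (anc' a)
  anc'' : ∀ x y → Anc par (from x) (from y) → Anc par' x y
  anc'' x y a = subst₂ (Anc par') (to-from x) (to-from y) (anc' a)

⊎-finite : ∀ {t k} {xs : List (Fin t ⊎ Fin k)} → Unique xs → length xs ≤ t + k
⊎-finite {t} {k} {xs} u = length-≤-code {P = λ _ → ⊤} (Fin.join t k)
  (λ {x} {y} _ _ eq → trans (sym (Fin.splitAt-join t k x)) (trans (cong (Fin.splitAt t) eq) (Fin.splitAt-join t k y)))
  xs u (All.tabulate λ _ → tt)

module _ {t k : ℕ} (a : Fin t → Fin k → Bool) where

  LEdge? : ∀ x y → Dec (LEdge a x y)
  LEdge? (inj₁ _) (inj₁ _) = no λ ()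
  LEdge? (inj₁ u) (inj₂ h) = bool? (a u h)
  LEdge? (inj₂ h) (inj₁ u) = bool? (a u h)
  LEdge? (inj₂ _) (inj₂ _) = no λ ()

  LEdge-sym : ∀ {x y} → LEdge a x y → LEdge a y x
  LEdge-sym {inj₁ _} {inj₂ _} e = e
  LEdge-sym {inj₂ _} {inj₁ _} e = e

  bipS⇒LEdge : ∀ x y → bipS a x y ≡ true → LEdge a x y
  bipS⇒LEdge (inj₁ _) (inj₂ _) e = e
  bipS⇒LEdge (inj₂ _) (inj₁ _) e = e

  bipGraph-treedepth : ∀ {d} → TreedepthLE' (LEdge a) d → TreedepthLE (bipGraph t k a) d
  bipGraph-treedepth = TreedepthLE'-transport (Fin.join t k) (Fin.splitAt t) (Fin.splitAt-join t k) (Fin.join-splitAt t k)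
    λ x y → bipS⇒LEdge (Fin.splitAt t x) (Fin.splitAt t y)

  module BipartiteElimination {π : Fin t ⊎ Fin k → ℕ} (π-inj : Injective _≡_ _≡_ π) =
    Elimination (⊎-searchable Fin-searchable Fin-searchable) (Sum.≡-dec Fin._≟_ Fin._≟_)
      ⊎-finite LEdge? (λ {x} {y} → LEdge-sym {x} {y}) π-inj

-- Transductions from bipartite decompositions

⋁ᶠ : ∀ {p m k} r → (Fin r → Fm p m k) → Fm p m k
⋁ᶠ zero    φ = ⊥ᶠ
⋁ᶠ (suc r) φ = φ zero ∨ᶠ ⋁ᶠ r (φ ∘ suc)

Sat-⋁ : ∀ {p m k} {A : Str p m} r (φ : Fin r → Fm p m k) {ρ} → Sat A (⋁ᶠ r φ) ρ ⇔ ∃ λ i → Sat A (φ i) ρ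
Sat-⋁ r φ = mk⇔ (to r φ) (λ (i , s) → from r φ i s)
  where
  to : ∀ {p m k} {A : Str p m} r (φ : Fin r → Fm p m k) {ρ} → Sat A (⋁ᶠ r φ) ρ → ∃ λ i → Sat A (φ i) ρ
  to (suc r) φ (inj₁ s) = zero , s
  to (suc r) φ (inj₂ s) with to r (φ ∘ suc) s
  ... | i , s' = suc i , s'
  from : ∀ {p m k} {A : Str p m} r (φ : Fin r → Fm p m k) {ρ} i → Sat A (φ i) ρ → Sat A (⋁ᶠ r φ) ρ
  from (suc r) φ zero    s = inj₁ s
  from (suc r) φ (suc i) s = inj₂ (from r (φ ∘ suc) i s)

isTarget : ∀ {A B : Set} → A ⊎ B → Bool
isTarget (inj₁ _) = true
isTarget (inj₂ _) = false

module Bipartite {t k : ℕ} (a : Fin t → Fin k → Bool) {p : ℕ} (Pr : Fin p → Fin t ⊎ Fin k → Bool) where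

  Pr' : Fin p → Fin (t + k) → Bool
  Pr' j x = Pr j (Fin.splitAt t x)

  A : Str p 1
  A = copyExp (bipGraph t k a) p 1 Pr'

  target : Fin t → Str.V A
  target v = v Fin.↑ˡ k , zero

  hid : Fin k → Str.V A
  hid h = t Fin.↑ʳ h , zero

  target-injective : Injective _≡_ _≡_ target
  target-injective eq = Fin.↑ˡ-injective k _ _ (cong proj₁ eq)

  hid-injective : Injective _≡_ _≡_ hid
  hid-injective eq = Fin.↑ʳ-injective t _ _ (cong proj₁ eq)

  param-target : ∀ j v → Pr' j (proj₁ (target v)) ≡ Pr j (inj₁ v)
  param-target j v = cong (Pr j) (Fin.splitAt-↑ˡ t v k)

  param-hid : ∀ j h → Pr' j (proj₁ (hid h)) ≡ Pr j (inj₂ h)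
  param-hid j h = cong (Pr j) (Fin.splitAt-↑ʳ t k h)

  edge-hid : ∀ v h → a v h ≡ true → Str.E A (target v) (hid h)
  edge-hid v h e = refl , trans (cong₂ (bipS a) (Fin.splitAt-↑ˡ t v k) (Fin.splitAt-↑ʳ t k h)) e

  edge-target : ∀ v {z} → Str.E A (target v) z → ∃ λ h → z ≡ hid h × a v h ≡ true
  edge-target v {x , zero} (_ , e) = helper (Fin.splitAt t x) refl
    where
    e' : ∀ y → Fin.splitAt t x ≡ y → bipS a (inj₁ v) y ≡ true
    e' y eq = trans (sym (cong₂ (bipS a) (Fin.splitAt-↑ˡ t v k) eq)) e
    helper : ∀ y → Fin.splitAt t x ≡ y → ∃ λ h → (x , zero) ≡ hid h × a v h ≡ true
    helper (inj₁ u) eq = contradiction (e' _ eq) λ ()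
    helper (inj₂ h) eq = h , cong (_, zero) (sym (Fin.splitAt⁻¹-↑ʳ eq)) , e' _ eq

  is-target : ∀ j → (∀ y → Pr j y ≡ isTarget y) → ∀ x → Str.P A j x ⇔ (∃ λ v → target v ≡ x)
  is-target j spec (x , zero) = mk⇔ (λ px → to (Fin.splitAt t x) refl (trans (sym (spec _)) px))
    (λ { (v , refl) → trans (param-target j v) (spec (inj₁ v)) })
    where
    to : ∀ y → Fin.splitAt t x ≡ y → isTarget y ≡ true → ∃ λ v → target v ≡ (x , zero)
    to (inj₁ v) eq _ = v , cong (_, zero) (Fin.splitAt⁻¹-↑ˡ eq)

module LaconTransduction (d : ℕ) where

  pattern targetP = zero
  pattern labelP  = suc zero

  commonᶠ : ∀ {k} → Fin k → Fin k → Fin k → Fm (2 + d) 1 k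
  commonᶠ x y z = edge x z ∧ᶠ edge y z

  -- Predicate 2 + i holds of the vertices of depth > i in the elimination forest, which orders the
  -- neighbours of a target vertex in the same way as π does.
  deeperᶠ : ∀ {k} → Fin k → Fin k → Fm (2 + d) 1 k
  deeperᶠ z z' = ⋁ᶠ d λ i → param (suc (suc i)) z' ∧ᶠ (¬ᶠ param (suc (suc i)) z)

  dominantᶠ : Fm (2 + d) 1 2
  dominantᶠ = ∃ᶠ ((commonᶠ (suc zero) (suc (suc zero)) zero ∧ᶠ param labelP zero) ∧ᶠ
    (¬ᶠ (∃ᶠ (commonᶠ (suc (suc zero)) (suc (suc (suc zero))) zero ∧ᶠ deeperᶠ (suc zero) zero))))

  transduction : Transduction
  transduction = record { p = 2 + d ; m = 1 ; χ = ⊤ᶠ ; ν = param targetP zero ; φ = dominantᶠ }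

  module _ {G : Graph} (L : Lacon G) (wcol : WcolInfLE (LEdge (Lacon.ladj L)) (Lacon.π L) d) where
    open Lacon L
    open BipartiteElimination ladj π-inj
    open Forest (depths wcol)

    Pr : Fin (2 + d) → Fin (n G) ⊎ Fin m → Bool
    Pr targetP       y        = isTarget y
    Pr labelP        (inj₁ _) = false
    Pr labelP        (inj₂ h) = label h
    Pr (suc (suc i)) y        = does (toℕ i <? dep y)

    open Bipartite ladj Pr

    Common : Fin (n G) → Fin (n G) → Fin m → Set
    Common u v h = ladj u h ≡ true × ladj v h ≡ true

    -- Targets exceed all hidden vertices, so the walk from `h` through `u` to `h'` witnesses weak
    -- reachability. The neighbours of one target thus form a chain in the forest.
    neighbours-Anc : ∀ {u h h'} → ladj u h ≡ true → ladj u h' ≡ true → π (inj₂ h') ≤ π (inj₂ h) → Anc par (inj₂ h') (inj₂ h)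
    neighbours-Anc {u} {h} {h'} uh uh' le = reach⇒Anc (depths wcol _)
      (_∷_ {v = inj₁ u} uh (uh' ∷ []) , le ∷ <⇒≤ (π-hid h' u) ∷ ≤-refl ∷ [])

    Deeper : Fin m → Fin m → Set
    Deeper h h' = dep (inj₂ h) < dep (inj₂ h')

    Sat-deeper : ∀ {k} {x y : Fin k} {ρ h h'} → ρ x ≡ hid h → ρ y ≡ hid h' → Sat A (deeperᶠ x y) ρ ⇔ Deeper h h'
    Sat-deeper {x = x} {y} {ρ} {h} {h'} ex ey = mk⇔ to from
      where
      param-dep : ∀ {z h} i → ρ z ≡ hid h → Sat A (param (suc (suc i)) z) ρ ⇔ toℕ i < dep (inj₂ h)
      param-dep {z} {h} i ez = mk⇔
        (λ s → does⇒ (toℕ i <? dep (inj₂ h)) (trans (sym (trans (cong (Pr' (suc (suc i)) ∘ proj₁) ez) (param-hid (suc (suc i)) h))) s))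
        (λ lt → trans (cong (Pr' (suc (suc i)) ∘ proj₁) ez) (trans (param-hid (suc (suc i)) h) (dec-true (toℕ i <? dep (inj₂ h)) lt)))
      to : Sat A (deeperᶠ x y) ρ → Deeper h h'
      to s with Equivalence.to (Sat-⋁ {A = A} d _) s
      ... | i , py , ¬px = ≤-trans (s≤s (≮⇒≥ (¬px ∘ Equivalence.from (param-dep i ex)))) (Equivalence.to (param-dep i ey) py)
      from : Deeper h h' → Sat A (deeperᶠ x y) ρ
      from lt = Equivalence.from (Sat-⋁ {A = A} d _) (i ,
        Equivalence.from (param-dep i ey) (subst (_< dep (inj₂ h')) (sym i≡) lt) ,
        λ px → <-irrefl i≡ (Equivalence.to (param-dep i ex) px))
        where
        -- The threshold at the depth of `h` itself is missed by `h` and passed by every deeper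
        -- vertex.
        i = Fin.fromℕ< (dep-< (inj₂ h))
        i≡ : toℕ i ≡ dep (inj₂ h)
        i≡ = Fin.toℕ-fromℕ< (dep-< (inj₂ h))

    Deepest : Fin (n G) → Fin (n G) → Set
    Deepest u v = ∃ λ h → Common u v h × label h ≡ true × (∀ h' → Common u v h' → ¬ Deeper h h')

    Sat-dominant : ∀ u v → Sat A dominantᶠ (env2 (target u) (target v)) ⇔ Deepest u v
    Sat-dominant u v = mk⇔ to from
      where
      common-hid : ∀ {z} → Str.E A (target u) z → Str.E A (target v) z → ∃ λ h → z ≡ hid h × Common u v h
      common-hid uz vz with edge-target u uz | edge-target v vz
      ... | h , refl , uh | h' , eq , vh' with refl ← hid-injective eq = h , refl , uh , vh'
      to : Sat A dominantᶠ (env2 (target u) (target v)) → Deepest u v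
      to (z , ((uz , vz) , lz) , none) with common-hid uz vz
      ... | h , refl , c = h , c , trans (sym (param-hid labelP h)) lz ,
        λ h' (uh' , vh') deeper → none (hid h' , (edge-hid u h' uh' , edge-hid v h' vh') ,
          Equivalence.from (Sat-deeper {x = suc zero} {zero} refl refl) deeper)
      from : Deepest u v → Sat A dominantᶠ (env2 (target u) (target v))
      from (h , (uh , vh) , lh , none) = hid h , ((edge-hid u h uh , edge-hid v h vh) , trans (param-hid labelP h) lh) , λ
        { (z , (uz , vz) , deeper) → none' z uz vz deeper }
        where
        none' : ∀ z → Str.E A (target u) z → Str.E A (target v) z → ¬ Sat A (deeperᶠ (suc zero) zero) (ext z (ext (hid h) (env2 (target u) (target v))))
        none' z uz vz deeper with common-hid uz vz
        ... | h' , refl , c = none h' c (Equivalence.to (Sat-deeper {x = suc zero} {zero} refl refl) deeper)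

    dominant-exists : ∀ u v → ∃ (Dominant u v)
    dominant-exists u v with argmax Fin-searchable (π ∘ inj₂) {Common u v} (λ h → bool? (ladj u h) ×-dec bool? (ladj v h))
      (π (inj₁ u)) (λ {h} _ → π-hid h u)
    ... | inj₁ (h , c , max) = h , c , λ h' uh' vh' → max (uh' , vh')
    ... | inj₂ none          = contradiction (proj₂ (common u v)) (none _)

    -- The dominant vertex is the only deepest common neighbour: all others are its proper ancestors
    -- and hence of smaller depth.
    dominant-label : ∀ {u v h} → Dominant u v h → label h ≡ true ⇔ Deepest u v
    dominant-label {u} {v} {h} (c@(uh , vh) , max) = mk⇔
      (λ lh → h , c , lh , λ h' (uh' , vh') deeper → <⇒≱ deeper (dep-Anc (neighbours-Anc uh uh' (max h' uh' vh'))))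
      λ (h' , c' , lh' , none) → subst (λ h → label h ≡ true) (same c' none) lh'
      where
      same : ∀ {h'} → Common u v h' → (∀ h'' → Common u v h'' → ¬ Deeper h' h'') → h' ≡ h
      same {h'} (uh' , vh') none with h' Fin.≟ h
      ... | yes eq = eq
      ... | no neq = contradiction (dep-Anc-< (neighbours-Anc uh uh' (max h' uh' vh')) λ { refl → neq refl }) (none h c)

    edge-Deepest : ∀ u v → u ≢ v → Edge G u v ⇔ Deepest u v
    edge-Deepest u v u≢v with dominant-exists u v
    ... | h , dom = mk⇔ (Equivalence.to (dominant-label dom) ∘ Equivalence.to (correct u v u≢v h dom))
                        (Equivalence.from (correct u v u≢v h dom) ∘ Equivalence.from (dominant-label dom))

    inImage : InImage transduction (bipGraph (n G) m ladj) G
    inImage = Pr' , tt , target , target-injective , is-target targetP (λ _ → refl) , λ u v u≢v → mk⇔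
      (λ uv → inj₁ (Equivalence.from (Sat-dominant u v) (Equivalence.to (edge-Deepest u v u≢v) uv)))
      [ (λ s → Equivalence.from (edge-Deepest u v u≢v) (Equivalence.to (Sat-dominant u v) s))
      , (λ s → trans (Graph.sym G u v) (Equivalence.from (edge-Deepest v u (u≢v ∘ sym)) (Equivalence.to (Sat-dominant v u) s))) ]′

Cond2⇒Cond1 : ∀ {𝒢} → Cond2 𝒢 → Cond1 𝒢
Cond2⇒Cond1 (d , lacon) = (λ G' → TreedepthLE G' d) , (d , λ _ td → td) , LaconTransduction.transduction d ,
  λ G G∈ → let (L , wcol) = lacon G G∈ in
    bipGraph (n G) (Lacon.m L) (Lacon.ladj L) ,
    bipGraph-treedepth (Lacon.ladj L) (BipartiteElimination.treedepth (Lacon.ladj L) (Lacon.π-inj L) wcol) ,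
    LaconTransduction.inImage d L wcol

-- Parity-decompositions

∑ : ∀ k → (Fin k → ℕ) → ℕ
∑ zero    f = 0
∑ (suc k) f = f zero + ∑ k (f ∘ suc)

sum-allFin : ∀ k f → sum (map f (allFin k)) ≡ ∑ k f
sum-allFin k f = trans (cong sum (map-tabulate id f)) (sum-tabulate k f)
  where
  sum-tabulate : ∀ k f → sum (tabulate {n = k} f) ≡ ∑ k f
  sum-tabulate zero    f = refl
  sum-tabulate (suc k) f = cong (f zero +_) (sum-tabulate k (f ∘ suc))

∑-cong : ∀ k {f g} → (∀ i → f i ≡ g i) → ∑ k f ≡ ∑ k g
∑-cong zero    eq = refl
∑-cong (suc k) eq = cong₂ _+_ (eq zero) (∑-cong k (eq ∘ suc))

∑-mono : ∀ k {f g} → (∀ i → f i ≤ g i) → ∑ k f ≤ ∑ k g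
∑-mono zero    le = z≤n
∑-mono (suc k) le = +-mono-≤ (le zero) (∑-mono k (le ∘ suc))

∑-bound : ∀ k {f c} → (∀ i → f i ≤ c) → ∑ k f ≤ k * c
∑-bound zero    le = z≤n
∑-bound (suc k) le = +-mono-≤ (le zero) (∑-bound k (le ∘ suc))

∑-zero : ∀ k {f} → (∀ i → f i ≡ 0) → ∑ k f ≡ 0
∑-zero zero    eq = refl
∑-zero (suc k) eq = cong₂ _+_ (eq zero) (∑-zero k (eq ∘ suc))

∑-single : ∀ {k} j {f} → (∀ i → i ≢ j → f i ≡ 0) → ∑ k f ≡ f j
∑-single {suc k} zero    {f} eq = trans (cong (f zero +_) (∑-zero k λ i → eq (suc i) λ ())) (+-identityʳ _)
∑-single {suc k} (suc j) {f} eq = cong₂ _+_ (eq zero λ ()) (∑-single j λ i i≢j → eq (suc i) (i≢j ∘ Fin.suc-injective))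

∑-+ : ∀ a b f → ∑ (a + b) f ≡ ∑ a (λ i → f (i Fin.↑ˡ b)) + ∑ b (λ j → f (a Fin.↑ʳ j))
∑-+ zero    b f = refl
∑-+ (suc a) b f = trans (cong (f zero +_) (∑-+ a b (f ∘ suc))) (sym (+-assoc (f zero) _ _))

∑-* : ∀ a b f → ∑ (a * b) f ≡ ∑ a λ i → ∑ b λ j → f (combine i j)
∑-* zero    b f = refl
∑-* (suc a) b f = trans (∑-+ b (a * b) f) (cong (∑ b (λ j → f (j Fin.↑ˡ (a * b))) +_) (∑-* a b (λ x → f (b Fin.↑ʳ x))))

odd : ℕ → Bool
odd zero    = false
odd (suc k) = not (odd k)

Odd⇔odd : ∀ k → Odd k ⇔ odd k ≡ true
Odd⇔odd zero          = mk⇔ (λ ()) (λ ())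
Odd⇔odd (suc zero)    = mk⇔ (λ _ → refl) (λ _ → refl)
Odd⇔odd (suc (suc k)) = subst (λ b → Odd k ⇔ b ≡ true) (sym (Bool.not-involutive (odd k))) (Odd⇔odd k)

odd-+ : ∀ k l → odd (k + l) ≡ odd k xor odd l
odd-+ zero    l = refl
odd-+ (suc k) l = trans (cong not (odd-+ k l)) (Bool.not-distribˡ-xor (odd k) (odd l))

⨁ : ∀ k → (Fin k → Bool) → Bool
⨁ zero    f = false
⨁ (suc k) f = f zero xor ⨁ k (f ∘ suc)

⨁-cong : ∀ k {f g} → (∀ i → f i ≡ g i) → ⨁ k f ≡ ⨁ k g
⨁-cong zero    eq = refl
⨁-cong (suc k) eq = cong₂ _xor_ (eq zero) (⨁-cong k (eq ∘ suc))

odd-∑ : ∀ k f → odd (∑ k f) ≡ ⨁ k (odd ∘ f)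
odd-∑ zero    f = refl
odd-∑ (suc k) f = trans (odd-+ (f zero) _) (cong (odd (f zero) xor_) (odd-∑ k (f ∘ suc)))

xor-cancel-middle : ∀ a b c → (b xor a) xor (c xor b) ≡ c xor a
xor-cancel-middle false false false = refl
xor-cancel-middle false false true  = refl
xor-cancel-middle false true  false = refl
xor-cancel-middle false true  true  = refl
xor-cancel-middle true  false false = refl
xor-cancel-middle true  false true  = refl
xor-cancel-middle true  true  false = refl
xor-cancel-middle true  true  true  = refl

-- A telescoping sum over 𝔽₂, which the mask cuts off after step `l`.
⨁-telescope : ∀ {k l} (s : ℕ → Bool) → l < k →
  ⨁ k (λ i → does (toℕ i ≤? l) ∧ (s (suc (toℕ i)) xor s (toℕ i))) ≡ s (suc l) xor s 0
⨁-telescope {suc k} {zero}  s _        = trans (cong ((s 1 xor s 0) xor_) (⨁-false k)) (Bool.xor-identityʳ _)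
  where
  ⨁-false : ∀ k → ⨁ k (λ _ → false) ≡ false
  ⨁-false zero    = refl
  ⨁-false (suc k) = ⨁-false k
⨁-telescope {suc k} {suc l} s (s≤s l<k) =
  trans (cong ((s 1 xor s 0) xor_) (trans (⨁-cong k λ i → cong (_∧ (s (suc (suc (toℕ i))) xor s (suc (toℕ i))))
      (does-⇔ (mk⇔ ≤-pred s≤s) (suc (toℕ i) ≤? suc l) (toℕ i ≤? l))) (⨁-telescope (s ∘ suc) l<k))) (xor-cancel-middle (s 0) (s 1) (s (suc (suc l))))

indicator : Bool → ℕ
indicator b = if b then 1 else 0

odd-indicator : ∀ b → odd (indicator b) ≡ b
odd-indicator true  = refl
odd-indicator false = refl

indicator-≤1 : ∀ b → indicator b ≤ 1
indicator-≤1 true  = ≤-refl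
indicator-≤1 false = z≤n

indicator-zero : ∀ {b} → ¬ b ≡ true → indicator b ≡ 0
indicator-zero {true}  ¬b = contradiction refl ¬b
indicator-zero {false} _  = refl

∧-true : ∀ {a b} → a ∧ b ≡ true → a ≡ true × b ≡ true
∧-true {true} {true} _ = refl , refl

-- A symmetric matrix over 𝔽₂ as a Gram matrix: one coordinate for every pair x < y, and one
-- coordinate for every x that corrects the diagonal.
module Gram {M : ℕ} (f : Fin M → Fin M → Bool) (f-sym : ∀ i j → f i j ≡ f j i) where

  offDiagonal : Fin M → Fin M → Fin M → Bool
  offDiagonal i x y = (does (x Fin.<? y) ∧ f x y) ∧ (does (i Fin.≟ x) ∨ does (i Fin.≟ y))

  offDiagonal⇒ : ∀ {i x y} → offDiagonal i x y ≡ true → x Fin.< y × (i ≡ x ⊎ i ≡ y) × f x y ≡ true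
  offDiagonal⇒ {i} {x} {y} eq with ∧-true {does (x Fin.<? y) ∧ f x y} eq
  ... | p , m with ∧-true {does (x Fin.<? y)} p
  ...   | lt , fxy = does⇒ (x Fin.<? y) lt , does⇒ ((i Fin.≟ x) ⊎-dec (i Fin.≟ y)) m , fxy

  pairs : Fin M → Fin M → ℕ
  pairs i j = ∑ (M * M) λ xy → let (x , y) = remQuot {M} M xy in indicator (offDiagonal i x y ∧ offDiagonal j x y)

  -- `pairs x x` is the square of the uncorrected vector of `x`; the bit is set when its parity
  -- differs from `f x x`.
  diagonalBit : Fin M → Fin M → Bool
  diagonalBit i x = does (i Fin.≟ x) ∧ (f x x xor odd (pairs x x))

  coordinate : Fin M → Fin (M * M + M) → Bool
  coordinate i q = [ (λ xy → let (x , y) = remQuot {M} M xy in offDiagonal i x y) , diagonalBit i ]′ (Fin.splitAt (M * M) q)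

  product : Fin M → Fin M → ℕ
  product i j = ∑ (M * M + M) λ q → indicator (coordinate i q ∧ coordinate j q)

  product-split : ∀ i j → product i j ≡ pairs i j + ∑ M λ x → indicator (diagonalBit i x ∧ diagonalBit j x)
  product-split i j = trans (∑-+ (M * M) M _) (cong₂ _+_
    (∑-cong (M * M) λ xy → cong body (Fin.splitAt-↑ˡ (M * M) xy M))
    (∑-cong M λ x → cong body (Fin.splitAt-↑ʳ (M * M) M x)))
    where
    body : Fin (M * M) ⊎ Fin M → ℕ
    body s = indicator ([ (λ xy → let (x , y) = remQuot {M} M xy in offDiagonal i x y) , diagonalBit i ]′ s ∧
                        [ (λ xy → let (x , y) = remQuot {M} M xy in offDiagonal j x y) , diagonalBit j ]′ s)

  pairs-sym : ∀ i j → pairs i j ≡ pairs j i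
  pairs-sym i j = ∑-cong (M * M) λ xy → let (x , y) = remQuot {M} M xy in
    cong indicator (Bool.∧-comm (offDiagonal i x y) (offDiagonal j x y))

  -- The vectors of `i` and `j` can both be nonzero only at the coordinate of the pair `(i , j)`
  -- itself.
  pairs-< : ∀ {i j} → i Fin.< j → pairs i j ≡ indicator (f i j)
  pairs-< {i} {j} i<j = begin
    pairs i j                                                ≡⟨ ∑-single (combine i j) others ⟩
    body (remQuot {M} M (combine i j))                       ≡⟨ cong body (Fin.remQuot-combine i j) ⟩
    indicator (offDiagonal i i j ∧ offDiagonal j i j)        ≡⟨ cong indicator both ⟩
    indicator (f i j)                                        ∎
    where
    open ≡-Reasoning
    body : Fin M × Fin M → ℕ
    body (x , y) = indicator (offDiagonal i x y ∧ offDiagonal j x y)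
    i≢j : i ≢ j
    i≢j refl = <-irrefl refl i<j
    others : ∀ xy → xy ≢ combine i j → body (remQuot {M} M xy) ≡ 0
    others xy neq = indicator-zero λ eq → let (ei , ej) = ∧-true eq in neq (begin
        xy                                        ≡⟨ Fin.combine-remQuot {M} M xy ⟨
        combine (proj₁ (remQuot {M} M xy)) (proj₂ (remQuot {M} M xy))
          ≡⟨ (let (x≡ , y≡) = positions (offDiagonal⇒ {i} ei) (offDiagonal⇒ {j} ej) in cong₂ combine x≡ y≡) ⟩
        combine i j                               ∎)
      where
      positions : ∀ {x y} → x Fin.< y × (i ≡ x ⊎ i ≡ y) × f x y ≡ true → x Fin.< y × (j ≡ x ⊎ j ≡ y) × f x y ≡ true → x ≡ i × y ≡ j
      positions (_   , inj₁ refl , _) (_ , inj₁ refl , _) = contradiction refl i≢j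
      positions (_   , inj₁ refl , _) (_ , inj₂ refl , _) = refl , refl
      positions (x<y , inj₂ refl , _) (_ , inj₁ refl , _) = contradiction x<y (<⇒≯ i<j)
      positions (_   , inj₂ refl , _) (_ , inj₂ refl , _) = contradiction refl i≢j
    both : offDiagonal i i j ∧ offDiagonal j i j ≡ f i j
    both rewrite dec-true (i Fin.<? j) i<j | dec-true (i Fin.≟ i) refl | dec-true (j Fin.≟ j) refl
               | Bool.∨-zeroʳ (does (j Fin.≟ i)) | Bool.∧-identityʳ (f i j) = Bool.∧-idem (f i j)

  diagonal-off : ∀ {i j} → i ≢ j → ∑ M (λ x → indicator (diagonalBit i x ∧ diagonalBit j x)) ≡ 0
  diagonal-off {i} {j} i≢j = ∑-zero M λ x → indicator-zero λ eq →
    let (ei , ej) = ∧-true eq in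
    i≢j (trans (does⇒ (i Fin.≟ x) (proj₁ (∧-true ei))) (sym (does⇒ (j Fin.≟ x) (proj₁ (∧-true ej)))))

  diagonal-on : ∀ i → ∑ M (λ x → indicator (diagonalBit i x ∧ diagonalBit i x)) ≡ indicator (f i i xor odd (pairs i i))
  diagonal-on i = trans (∑-single i λ x x≢i → indicator-zero λ eq →
      x≢i (sym (does⇒ (i Fin.≟ x) (proj₁ (∧-true (proj₁ (∧-true eq)))))))
    (cong indicator (trans (Bool.∧-idem _) (cong (_∧ (f i i xor odd (pairs i i))) (dec-true (i Fin.≟ i) refl))))

  product-parity : ∀ i j → odd (product i j) ≡ f i j
  product-parity i j = trans (cong odd (product-split i j)) (trans (odd-+ (pairs i j) _) (cases (Fin.<-cmp i j)))
    where
    rest = odd (∑ M λ x → indicator (diagonalBit i x ∧ diagonalBit j x))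
    no-rest : i ≢ j → ∀ {b} → odd (pairs i j) ≡ b → odd (pairs i j) xor rest ≡ b
    no-rest i≢j eq = trans (cong (λ r → odd (pairs i j) xor odd r) (diagonal-off i≢j)) (trans (Bool.xor-identityʳ _) eq)
    cases : _ → odd (pairs i j) xor rest ≡ f i j
    cases (tri< i<j i≢j _) = no-rest i≢j (trans (cong odd (pairs-< i<j)) (odd-indicator (f i j)))
    cases (tri> _ i≢j j<i) = no-rest i≢j (trans (cong odd (trans (pairs-sym i j) (pairs-< j<i))) (trans (odd-indicator (f j i)) (f-sym j i)))
    cases (tri≈ _ refl _)  = trans (cong (odd (pairs i i) xor_) (trans (cong odd (diagonal-on i)) (odd-indicator _))) (absorb (odd (pairs i i)) (f i i))
      where
      absorb : ∀ a b → a xor (b xor a) ≡ b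
      absorb false b     = Bool.xor-identityʳ b
      absorb true  false = refl
      absorb true  true  = refl

module ParityModel {G : Graph} {D M : ℕ} {S : Fin M → Fin M → ℕ → Bool} (model : TreeModel G D M S) where

  open TreeModel model

  -- Gram matrices are symmetric, so `S` is symmetrised; for the colours and level of two distinct
  -- vertices this changes nothing.
  symS : Fin M → Fin M → ℕ → Bool
  symS i j l = S i j l ∨ S j i l

  symS-correct : ∀ u v → u ≢ v → symS (col u) (col v) (lev u v) ≡ adj G u v
  symS-correct u v u≢v = trans (cong₂ _∨_ (sym (adj-S u v u≢v))
      (trans (cong (S (col v) (col u)) (lev-sym u v)) (trans (sym (adj-S v u (u≢v ∘ sym))) (Graph.sym G v u))))
    (Bool.∨-idem (adj G u v))

  -- Levels move up by one so that the telescoping sum starts from `false`: `increment 0` is the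
  -- whole matrix of level 0, and later increments are changes from one level to the next.
  shifted : Fin M → Fin M → ℕ → Bool
  shifted i j zero    = false
  shifted i j (suc l) = symS i j l

  increment : ℕ → Fin M → Fin M → Bool
  increment e i j = shifted i j (suc e) xor shifted i j e

  shifted-sym : ∀ i j e → shifted i j e ≡ shifted j i e
  shifted-sym i j zero    = refl
  shifted-sym i j (suc e) = Bool.∨-comm (S i j e) (S j i e)

  module GramAt (e : ℕ) = Gram (increment e) (λ i j → cong₂ _xor_ (shifted-sym i j (suc e)) (shifted-sym i j e))

  Q : ℕ
  Q = M * M + M

  open Layered tree Q (λ _ → zero)

  padjAt : Fin (n G) → Fin (suc D) × Fin N × Fin Q → Bool
  padjAt v (e , a , q) = does (a Fin.≟ key (toℕ e) v) ∧ GramAt.coordinate (toℕ e) (col v) q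

  padj : Fin (n G) → Fin m → Bool
  padj v h = padjAt v (split h)

  padjAt-key : ∀ {v e a q} → padjAt v (e , a , q) ≡ true → a ≡ key (toℕ e) v
  padjAt-key {v} {e} {a} eq = does⇒ (a Fin.≟ key (toℕ e) v) (proj₁ (∧-true {does (a Fin.≟ key (toℕ e) v)} eq))

  padj-local : ∀ {v h} → padj v h ≡ true → hnode h ≡ key (toℕ (hlev h)) v
  padj-local {v} {h} eq = padjAt-key {v} {hlev h} {hnode h} {hindex h} eq

  ∑-hidden : ∀ (g : Fin (suc D) × Fin N × Fin Q → ℕ) →
    ∑ m (g ∘ split) ≡ ∑ (suc D) λ e → ∑ N λ a → ∑ Q λ q → g (e , a , q)
  ∑-hidden g = trans (∑-* (suc D) (N * Q) (g ∘ split)) (∑-cong (suc D) λ e → trans (∑-* N Q (λ aq → g (split (combine e aq))))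
    (∑-cong N λ a → ∑-cong Q λ q → cong g (split-hidden e a q)))

  at-key : ∀ v (e : Fin (suc D)) (g : Fin N → Fin Q → ℕ) → (∀ a q → a ≢ key (toℕ e) v → g a q ≡ 0) →
    ∑ N (λ a → ∑ Q (g a)) ≡ ∑ Q (g (key (toℕ e) v))
  at-key v e g zero-off = ∑-single (key (toℕ e) v) λ a neq → ∑-zero Q λ q → zero-off a q neq

  -- On each level a vertex is adjacent only to hidden vertices at its own ancestor, and there are
  -- `Q` of these.
  degree : ∀ v → sum (map (λ h → if padj v h then 1 else 0) (allFin m)) ≤ suc D * Q
  degree v = begin
    sum (map (indicator ∘ padj v) (allFin m))   ≡⟨ sum-allFin m _ ⟩
    ∑ m (indicator ∘ padj v)                    ≡⟨ ∑-hidden (indicator ∘ padjAt v) ⟩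
    (∑ (suc D) λ e → ∑ N λ a → ∑ Q λ q → indicator (padjAt v (e , a , q)))
      ≡⟨ (∑-cong (suc D) λ e → at-key v e (λ a q → indicator (padjAt v (e , a , q))) λ a q neq →
             indicator-zero {padjAt v (e , a , q)} λ eq → neq (padjAt-key {v} {e} {a} {q} eq)) ⟩
    (∑ (suc D) λ e → ∑ Q λ q → indicator (padjAt v (e , key (toℕ e) v , q)))
      ≤⟨ (∑-bound (suc D) λ e → ≤-trans (∑-bound Q λ q → indicator-≤1 (padjAt v (e , key (toℕ e) v , q))) (≤-reflexive (*-identityʳ Q))) ⟩
    suc D * Q                                   ∎
    where open ≤-Reasoning

  module _ (u v : Fin (n G)) where

    common-at : Fin (suc D) → ℕ
    common-at e = ∑ Q λ q → indicator (padjAt u (e , key (toℕ e) u , q) ∧ padjAt v (e , key (toℕ e) u , q))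

    common-sum : sum (map (λ h → if padj u h ∧ padj v h then 1 else 0) (allFin m)) ≡ ∑ (suc D) common-at
    common-sum = begin
      sum (map (λ h → indicator (padj u h ∧ padj v h)) (allFin m))  ≡⟨ sum-allFin m _ ⟩
      ∑ m (λ h → indicator (padj u h ∧ padj v h))                   ≡⟨ ∑-hidden (λ h → indicator (padjAt u h ∧ padjAt v h)) ⟩
      (∑ (suc D) λ e → ∑ N λ a → ∑ Q λ q → indicator (padjAt u (e , a , q) ∧ padjAt v (e , a , q)))
        ≡⟨ (∑-cong (suc D) λ e → at-key u e (λ a q → indicator (padjAt u (e , a , q) ∧ padjAt v (e , a , q))) λ a q neq →
             indicator-zero {padjAt u (e , a , q) ∧ padjAt v (e , a , q)} λ eq →
             neq (padjAt-key {u} {e} {a} {q} (proj₁ (∧-true {padjAt u (e , a , q)} eq)))) ⟩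
      ∑ (suc D) common-at                                           ∎
      where open ≡-Reasoning

    -- At a common ancestor the shared neighbours are counted by a product of Gram vectors; below
    -- the lowest common ancestor the nodes differ and nothing is shared.
    common-parity-at : ∀ e → odd (common-at e) ≡ does (toℕ e ≤? lev u v) ∧ increment (toℕ e) (col u) (col v)
    common-parity-at e with toℕ e ≤? lev u v
    ... | yes e≤ = trans (cong odd (∑-cong Q λ q → cong indicator (cong₂ _∧_
            (cong (_∧ GramAt.coordinate (toℕ e) (col u) q) (dec-true (key (toℕ e) u Fin.≟ key (toℕ e) u) refl))
            (cong (_∧ GramAt.coordinate (toℕ e) (col v) q) (dec-true (key (toℕ e) u Fin.≟ key (toℕ e) v) (lev-key e≤))))))
          (trans (GramAt.product-parity (toℕ e) (col u) (col v))
            (sym (cong (_∧ increment (toℕ e) (col u) (col v)) (dec-true (toℕ e ≤? lev u v) e≤))))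
    ... | no e≰ = trans (cong odd (∑-zero Q λ q → 
            let at = e , key (toℕ e) u , q in
            indicator-zero {padjAt u at ∧ padjAt v at} λ eq → e≰ (lev-max (≤-pred (Fin.toℕ<n e))
              (padjAt-key {v} {e} {key (toℕ e) u} {q} (proj₂ (∧-true {padjAt u at} eq))))))
          (sym (cong (_∧ increment (toℕ e) (col u) (col v)) (dec-false (toℕ e ≤? lev u v) e≰)))

    common-parity : u ≢ v → odd (sum (map (λ h → if padj u h ∧ padj v h then 1 else 0) (allFin m))) ≡ adj G u v
    common-parity u≢v = begin
      odd (sum (map (λ h → if padj u h ∧ padj v h then 1 else 0) (allFin m)))  ≡⟨ cong odd common-sum ⟩
      odd (∑ (suc D) common-at)                       ≡⟨ odd-∑ (suc D) common-at ⟩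
      ⨁ (suc D) (odd ∘ common-at)                     ≡⟨ ⨁-cong (suc D) common-parity-at ⟩
      ⨁ (suc D) (λ e → does (toℕ e ≤? lev u v) ∧ increment (toℕ e) (col u) (col v))
                                                      ≡⟨ ⨁-telescope (shifted (col u) (col v)) (s≤s (lev-≤ u v)) ⟩
      symS (col u) (col v) (lev u v) xor false        ≡⟨ Bool.xor-identityʳ _ ⟩
      symS (col u) (col v) (lev u v)                  ≡⟨ symS-correct u v u≢v ⟩
      adj G u v                                       ∎
      where open ≡-Reasoning

  parityDec : ParityDec G (suc D * Q)
  parityDec = record
    { k = m ; padj = padj ; tdeg = degree
    ; correct = λ u v u≢v → let eq = common-parity u v u≢v ; parity = Odd⇔odd (ParityDec-common u v) in mk⇔
        (λ uv → Equivalence.from parity (trans eq uv)) (λ o → trans (sym eq) (Equivalence.to parity o)) }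
    where
    ParityDec-common : Fin (n G) → Fin (n G) → ℕ
    ParityDec-common u v = sum (map (λ h → if padj u h ∧ padj v h then 1 else 0) (allFin m))

  parity-treedepth : TreedepthLE (ParityDec.graph parityDec) (suc (suc D * Q))
  parity-treedepth = bipGraph-treedepth padj (BipartiteElimination.treedepth padj π-inj
    (wcol-layered padj λ {v} {h} → padj-local {v} {h}))

Decomposable⇒Cond4 : ∀ {𝒢} → Decomposable 𝒢 → Cond4 𝒢
Decomposable⇒Cond4 (D , M , S , model) =
  suc D * (M * M + M) , (λ G → TreedepthLE G (suc (suc D * (M * M + M)))) , (_ , λ _ td → td) ,
  λ G G∈ → ParityModel.parityDec (model G G∈) , ParityModel.parity-treedepth (model G G∈)

-- Counting common neighbours by formulas

module ParityTransduction (d : ℕ) where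

  freshᶠ : ∀ {k} → Fin k → List (Fin k) → Fm 1 1 k
  freshᶠ z []       = ⊤ᶠ
  freshᶠ z (w ∷ ws) = (¬ᶠ (z ≐ w)) ∧ᶠ freshᶠ z ws

  -- At least `r` common neighbours outside `zs`, the variables bound so far.
  commonsᶠ : ∀ {k} → ℕ → Fin k → Fin k → List (Fin k) → Fm 1 1 k
  commonsᶠ zero    x y zs = ⊤ᶠ
  commonsᶠ (suc r) x y zs = ∃ᶠ (((edge (suc x) zero ∧ᶠ edge (suc y) zero) ∧ᶠ freshᶠ zero (map suc zs)) ∧ᶠ
    commonsᶠ r (suc x) (suc y) (zero ∷ map suc zs))

  -- The number of common neighbours is at most the degree bound, so the exact counts from 0 to `d`
  -- are exhaustive.
  oddᶠ : Fm 1 1 2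
  oddᶠ = ⋁ᶠ (suc d) λ r → if odd (toℕ r)
    then commonsᶠ (toℕ r) zero (suc zero) [] ∧ᶠ (¬ᶠ commonsᶠ (suc (toℕ r)) zero (suc zero) [])
    else ⊥ᶠ

  transduction : Transduction
  transduction = record { p = 1 ; m = 1 ; χ = ⊤ᶠ ; ν = param zero zero ; φ = oddᶠ }

  module _ {G : Graph} (P : ParityDec G d) where
    open ParityDec P

    Pr : Fin 1 → Fin (n G) ⊎ Fin k → Bool
    Pr zero = isTarget

    open Bipartite padj Pr

    module _ (u v : Fin (n G)) where

      Common : Fin k → Set
      Common h = padj u h ∧ padj v h ≡ true

      Commons : ℕ → List (Fin k) → Set
      Commons r acc = ∃ λ hs → length hs ≡ r × All Common hs × Unique hs × All (λ h → All (h ≢_) acc) hs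

      Sat-fresh : ∀ {j} {ρ : Fin j → Str.V A} {z h ws acc} → ρ z ≡ hid h → map ρ ws ≡ map hid acc →
        Sat A (freshᶠ z ws) ρ ⇔ All (h ≢_) acc
      Sat-fresh {ws = []}     {[]}      ez ews = mk⇔ (λ _ → []) (λ _ → tt)
      Sat-fresh {ws = w ∷ ws} {a ∷ acc} ez ews = mk⇔
        (λ (z≢w , s) → (λ { refl → z≢w (trans ez (sym (∷-injectiveˡ ews))) }) ∷ Equivalence.to rest s)
        (λ { (h≢a ∷ s) → (λ z≡w → h≢a (hid-injective (trans (sym ez) (trans z≡w (∷-injectiveˡ ews))))) , Equivalence.from rest s })
        where rest = Sat-fresh {ws = ws} {acc} ez (∷-injectiveʳ ews)

      Sat-commons : ∀ r {j} {ρ : Fin j → Str.V A} {x y zs acc} → ρ x ≡ target u → ρ y ≡ target v →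
        map ρ zs ≡ map hid acc → Sat A (commonsᶠ r x y zs) ρ ⇔ Commons r acc
      Sat-commons zero    ex ey ezs = mk⇔ (λ _ → [] , refl , [] , [] , []) (λ _ → tt)
      Sat-commons (suc r) {j} {ρ} {x} {y} {zs} {acc} ex ey ezs = mk⇔ to from
        where
        shifted-zs : ∀ z → map (ext z ρ) (map suc zs) ≡ map hid acc
        shifted-zs z = trans (sym (map-∘ zs)) ezs
        next : ∀ h → Sat A (commonsᶠ r (suc x) (suc y) (zero ∷ map suc zs)) (ext (hid h) ρ) ⇔ Commons r (h ∷ acc)
        next h = Sat-commons r ex ey (cong (hid h ∷_) (shifted-zs (hid h)))
        to : Sat A (commonsᶠ (suc r) x y zs) ρ → Commons (suc r) acc
        to (z , ((xz , yz) , fresh) , s)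
          with edge-target u (subst (λ w → Str.E A w z) ex xz) | edge-target v (subst (λ w → Str.E A w z) ey yz)
        ... | h , refl , uh | h' , eq , vh' with refl ← hid-injective eq with Equivalence.to (next h) s
        ...   | hs , len , cs , uniq , avoid =
          h ∷ hs , cong suc len , cong₂ _∧_ uh vh' ∷ cs ,
          All.map (λ { (h''≢h ∷ _) → h''≢h ∘ sym }) avoid ∷ uniq ,
          Equivalence.to (Sat-fresh {z = zero} {ws = map suc zs} refl (shifted-zs (hid h))) fresh ∷ All.map All.tail avoid
        from : Commons (suc r) acc → Sat A (commonsᶠ (suc r) x y zs) ρ
        from (h ∷ hs , len , c ∷ cs , h∉ ∷ uniq , av ∷ avoid) =
          hid h , ((subst (λ w → Str.E A w (hid h)) (sym ex) (edge-hid u h (proj₁ (∧-true c))) ,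
                    subst (λ w → Str.E A w (hid h)) (sym ey) (edge-hid v h (proj₂ (∧-true {padj u h} c)))) ,
                   Equivalence.from (Sat-fresh {z = zero} {ws = map suc zs} refl (shifted-zs (hid h))) av) ,
          Equivalence.from (next h) (hs , suc-injective len , cs , uniq ,
            All.zipWith (λ (p , q) → p ∘ sym ∷ q) (h∉ , avoid))

      common? : ∀ h → Dec (Common h)
      common? h = bool? _

      common-list : List (Fin k)
      common-list = filter common? (allFin k)

      commonN-length : commonN u v ≡ length common-list
      commonN-length = go (allFin k)
        where
        go : ∀ hs → sum (map (λ h → if padj u h ∧ padj v h then 1 else 0) hs) ≡ length (filter common? hs)
        go [] = refl
        go (h ∷ hs) with padj u h ∧ padj v h
        ... | true  = cong suc (go hs)
        ... | false = go hs

      Commons⇔≤ : ∀ r → Commons r [] ⇔ r ≤ commonN u v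
      Commons⇔≤ r = mk⇔ to from
        where
        to : Commons r [] → r ≤ commonN u v
        to (hs , refl , cs , uniq , _) = subst (length hs ≤_) (sym commonN-length)
          (Unique-⊆-length uniq λ h∈ → ∈-filter⁺ common? (∈-allFin _) (All.lookup cs h∈))
        from : r ≤ commonN u v → Commons r []
        from le = take r common-list ,
          trans (length-take r common-list) (m≤n⇒m⊓n≡m (subst (r ≤_) commonN-length le)) ,
          All.take⁺ r (All.all-filter common? (allFin k)) ,
          Unique.take⁺ r (Unique.filter⁺ common? (Unique.allFin⁺ k)) ,
          All.tabulate λ _ → []

      commonN-≤ : commonN u v ≤ d
      commonN-≤ = ≤-trans (subst₂ _≤_ (sym (sum-allFin k _)) (sym (sum-allFin k _))
        (∑-mono k λ h → indicator-∧ (padj u h) (padj v h))) (tdeg u)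
        where
        indicator-∧ : ∀ a b → indicator (a ∧ b) ≤ indicator a
        indicator-∧ true  b = indicator-≤1 b
        indicator-∧ false b = z≤n

      Sat-odd : Sat A oddᶠ (env2 (target u) (target v)) ⇔ odd (commonN u v) ≡ true
      Sat-odd = mk⇔ to from
        where
        φ = λ (r : Fin (suc d)) → if odd (toℕ r)
          then commonsᶠ (toℕ r) zero (suc zero) [] ∧ᶠ (¬ᶠ commonsᶠ (suc (toℕ r)) zero (suc zero) [])
          else ⊥ᶠ
        ρ = env2 (target u) (target v)
        commons⇔ : ∀ r → Sat A (commonsᶠ r zero (suc zero) []) ρ ⇔ r ≤ commonN u v
        commons⇔ r = mk⇔ (Equivalence.to (Commons⇔≤ r) ∘ Equivalence.to sat) (Equivalence.from sat ∘ Equivalence.from (Commons⇔≤ r))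
          where sat = Sat-commons r {ρ = ρ} {zero} {suc zero} {[]} {[]} refl refl refl
        exactly : ∀ r b → Sat A (if b then commonsᶠ r zero (suc zero) [] ∧ᶠ (¬ᶠ commonsᶠ (suc r) zero (suc zero) []) else ⊥ᶠ) ρ →
          b ≡ true × r ≡ commonN u v
        exactly r true (s , ¬s) = refl , ≤-antisym (Equivalence.to (commons⇔ r) s)
          (≤-pred (≰⇒> (¬s ∘ Equivalence.from (commons⇔ (suc r)))))
        to : Sat A oddᶠ ρ → odd (commonN u v) ≡ true
        to s with Equivalence.to (Sat-⋁ {A = A} (suc d) φ) s
        ... | r , sr with exactly (toℕ r) (odd (toℕ r)) sr
        ...   | o , eq = subst (λ c → odd c ≡ true) eq o
        from : odd (commonN u v) ≡ true → Sat A oddᶠ ρ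
        from o = Equivalence.from (Sat-⋁ {A = A} (suc d) φ) (r , subst
          (λ b → Sat A (if b then commonsᶠ (toℕ r) zero (suc zero) [] ∧ᶠ (¬ᶠ commonsᶠ (suc (toℕ r)) zero (suc zero) []) else ⊥ᶠ) ρ)
          (sym (trans (cong odd r≡) o))
          ( Equivalence.from (commons⇔ (toℕ r)) (≤-reflexive r≡)
          , λ s → <-irrefl r≡ (Equivalence.to (commons⇔ (suc (toℕ r))) s)))
          where
          r : Fin (suc d)
          r = Fin.fromℕ< (s≤s commonN-≤)
          r≡ : toℕ r ≡ commonN u v
          r≡ = Fin.toℕ-fromℕ< (s≤s commonN-≤)

      Edge⇔odd : u ≢ v → Edge G u v ⇔ Sat A oddᶠ (env2 (target u) (target v))
      Edge⇔odd u≢v = mk⇔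
        (Equivalence.from Sat-odd ∘ Equivalence.to (Odd⇔odd (commonN u v)) ∘ Equivalence.to (correct u v u≢v))
        (Equivalence.from (correct u v u≢v) ∘ Equivalence.from (Odd⇔odd (commonN u v)) ∘ Equivalence.to Sat-odd)

    inImage : InImage transduction graph G
    inImage = Pr' , tt , target , target-injective , is-target zero (λ _ → refl) , λ u v u≢v → mk⇔
      (inj₁ ∘ Equivalence.to (Edge⇔odd u v u≢v))
      [ Equivalence.from (Edge⇔odd u v u≢v)
      , (λ s → trans (Graph.sym G u v) (Equivalence.from (Edge⇔odd v u (u≢v ∘ sym)) s)) ]′

Cond4⇒Cond1 : ∀ {𝒢} → Cond4 𝒢 → Cond1 𝒢
Cond4⇒Cond1 (d , 𝒢' , bounded , parity) = 𝒢' , bounded , ParityTransduction.transduction d ,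
  λ G G∈ → let (P , P∈) = parity G G∈ in ParityDec.graph P , P∈ , ParityTransduction.inImage d P

-- Walks and distances

module _ {V : Set} {E : V → V → Set} where

  DistLE-refl : ∀ {x k} → DistLE E x x k
  DistLE-refl = [] , z≤n

  DistLE-edge : ∀ {x y} → E x y → DistLE E x y 1
  DistLE-edge e = e ∷ [] , ≤-refl

  DistLE-mono : ∀ {x y k l} → k ≤ l → DistLE E x y k → DistLE E x y l
  DistLE-mono k≤l (p , le) = p , ≤-trans le k≤l

  DistLE-trans : ∀ {x y z k l} → DistLE E x y k → DistLE E y z l → DistLE E x z (k + l)
  DistLE-trans {k = k} ([] , _)             q = DistLE-mono (m≤n+m _ k) q
  DistLE-trans         (e ∷ p , s≤s le) q with DistLE-trans (p , le) q
  ... | r , le' = e ∷ r , s≤s le'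

  DistLE-sym : (∀ {x y} → E x y → E y x) → ∀ {x y k} → DistLE E x y k → DistLE E y x k
  DistLE-sym E-sym ([] , _) = [] , z≤n
  DistLE-sym E-sym {k = suc k} (e ∷ p , s≤s le) =
    subst (DistLE E _ _) (+-comm k 1) (DistLE-trans (DistLE-sym E-sym (p , le)) (DistLE-edge (E-sym e)))

  -- The source of all lower bounds on distances: an edge gains at most one unit of `h`.
  walk-potential : (h : V → ℕ) → (∀ {x y} → E x y → h y ≤ suc (h x)) → ∀ {x y} (p : Walk E x y) → h y ≤ wlen p + h x
  walk-potential h lip []                  = ≤-refl
  walk-potential h lip {x} (_∷_ {v = w} e p) = begin
    _                     ≤⟨ walk-potential h lip p ⟩
    wlen p + h w          ≤⟨ +-monoʳ-≤ (wlen p) (lip e) ⟩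
    wlen p + suc (h x)    ≡⟨ +-suc (wlen p) (h x) ⟩
    suc (wlen p + h x)    ∎
    where open ≤-Reasoning

-- Shrub-decompositions

DistLE? : ∀ (F : Graph) x y k → Dec (DistLE (Edge F) x y k)
DistLE? F x y k with x Fin.≟ y
... | yes refl = yes DistLE-refl
DistLE? F x y zero    | no x≢y = no λ { ([] , _) → x≢y refl }
DistLE? F x y (suc k) | no x≢y = map′ (λ (z , e , d) → DistLE-trans (DistLE-edge e) d) uncons
  (Fin.any? λ z → bool? (adj F x z) ×-dec DistLE? F z y k)
  where
  uncons : DistLE (Edge F) x y (suc k) → ∃ λ z → Edge F x z × DistLE (Edge F) z y k
  uncons ([] , _)           = contradiction refl x≢y
  uncons (e ∷ p , s≤s le) = _ , e , p , le

Dist-exists : ∀ (F : Graph) {x y} k → DistLE (Edge F) x y k → ∃ (Dist (Edge F) x y)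
Dist-exists F zero    d = 0 , d , λ _ ()
Dist-exists F {x} {y} (suc k) d with DistLE? F x y k
... | yes d' = Dist-exists F k d'
... | no ¬d' = suc k , d , λ l l<k dl → ¬d' (DistLE-mono (≤-pred l<k) dl)

module ShrubTransduction (d : ℕ) (S : Fin 1 → Fin 1 → ℕ → Bool) where

  withinᶠ : ∀ {k} → ℕ → Fin k → Fin k → Fm 1 1 k
  withinᶠ zero    x y = x ≐ y
  withinᶠ (suc l) x y = (x ≐ y) ∨ᶠ (∃ᶠ (edge (suc x) zero ∧ᶠ withinᶠ l zero (suc y)))

  atDistanceᶠ : ℕ → Bool → Fm 1 1 2
  atDistanceᶠ l true  = withinᶠ (suc l) zero (suc zero) ∧ᶠ (¬ᶠ withinᶠ l zero (suc zero))
  atDistanceᶠ l false = ⊥ᶠ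

  -- `S-range` confines the signature to the distances from 1 to `d`, hence `suc (toℕ l)` for
  -- `l : Fin d`.
  adjacentᶠ : Fm 1 1 2
  adjacentᶠ = ⋁ᶠ d λ l → atDistanceᶠ (toℕ l) (S zero zero (suc (toℕ l)))

  transduction : Transduction
  transduction = record { p = 1 ; m = 1 ; χ = ⊤ᶠ ; ν = param zero zero ; φ = adjacentᶠ }

  module _ {G : Graph} (Δ : ShrubDec G 1 d S) where
    open ShrubDec Δ

    leaf? : ∀ x → Dec (∃ λ v → ι v ≡ x)
    leaf? x = Fin.any? λ v → ι v Fin.≟ x

    Pr : Fin 1 → Fin (n F) → Bool
    Pr _ x = does (leaf? x)

    A : Str 1 1
    A = copyExp F 1 1 Pr

    leaf : Fin (n G) → Str.V A
    leaf v = ι v , zero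

    Sat-within : ∀ l {k} {ρ : Fin k → Str.V A} x y →
      Sat A (withinᶠ l x y) ρ ⇔ DistLE (Edge F) (proj₁ (ρ x)) (proj₁ (ρ y)) l
    Sat-within l x y = mk⇔ (to l x y) (from l x y)
      where
      same : ∀ {x y : Str.V A} → proj₁ x ≡ proj₁ y → x ≡ y
      same {_ , zero} {_ , zero} = cong (_, zero)
      to : ∀ l {k} {ρ : Fin k → Str.V A} x y → Sat A (withinᶠ l x y) ρ → DistLE (Edge F) (proj₁ (ρ x)) (proj₁ (ρ y)) l
      to zero    {ρ = ρ} x y eq        = subst (λ z → DistLE (Edge F) (proj₁ (ρ x)) (proj₁ z) 0) eq DistLE-refl
      to (suc l) {ρ = ρ} x y (inj₁ eq) = subst (λ z → DistLE (Edge F) (proj₁ (ρ x)) (proj₁ z) (suc l)) eq DistLE-refl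
      to (suc l) x y (inj₂ (z , (_ , e) , s)) = DistLE-trans (DistLE-edge e) (to l zero (suc y) s)
      from' : ∀ l {k} {ρ : Fin k → Str.V A} x y {v w} → v ≡ proj₁ (ρ x) → w ≡ proj₁ (ρ y) → DistLE (Edge F) v w l →
        Sat A (withinᶠ l x y) ρ
      from' zero    x y ex ey ([] , _)         = same (trans (sym ex) ey)
      from' (suc l) x y ex ey ([] , _)         = inj₁ (same (trans (sym ex) ey))
      from' (suc l) {ρ = ρ} x y ex ey (_∷_ {v = z} e p , s≤s le) =
        inj₂ ((z , proj₂ (ρ x)) , (refl , subst (λ v → Edge F v z) ex e) , from' l zero (suc y) refl ey (p , le))
      from : ∀ l {k} {ρ : Fin k → Str.V A} x y → DistLE (Edge F) (proj₁ (ρ x)) (proj₁ (ρ y)) l → Sat A (withinᶠ l x y) ρ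
      from l x y = from' l x y refl refl

    S-colour : ∀ u v l → S (col u) (col v) l ≡ S zero zero l
    S-colour u v l = cong₂ (λ i j → S i j l) (only (col u)) (only (col v))
      where
      only : (i : Fin 1) → i ≡ zero
      only zero = refl

    Edge⇔adjacent : ∀ u v → Edge G u v ⇔ Sat A adjacentᶠ (env2 (leaf u) (leaf v))
    Edge⇔adjacent u v = mk⇔ to from
      where
      ρ = env2 (leaf u) (leaf v)
      within⇔ : ∀ l → Sat A (withinᶠ l zero (suc zero)) ρ ⇔ DistLE (Edge F) (ι u) (ι v) l
      within⇔ l = Sat-within l {ρ = ρ} zero (suc zero)
      φ = λ (l : Fin d) → atDistanceᶠ (toℕ l) (S zero zero (suc (toℕ l)))
      to : Edge G u v → Sat A adjacentᶠ ρ
      to uv with Dist-exists F d (diam (ι u) (ι v))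
      ... | l , dist@(near , far) with Equivalence.to (correct u v l dist) uv
      ...   | Sl with S-range _ _ l Sl
      to uv | suc l , (near , far) | Sl | _ , l<d = Equivalence.from (Sat-⋁ {A = A} d φ) (i , subst
        (λ b → Sat A (atDistanceᶠ (toℕ i) b) ρ)
        (sym (trans (cong (λ l → S zero zero (suc l)) i≡) (trans (sym (S-colour u v (suc l))) Sl)))
        ( Equivalence.from (within⇔ (suc (toℕ i))) (subst (DistLE (Edge F) (ι u) (ι v) ∘ suc) (sym i≡) near)
        , far (toℕ i) (≤-reflexive (cong suc i≡)) ∘ Equivalence.to (within⇔ (toℕ i))))
        where
        i = Fin.fromℕ< l<d
        i≡ : toℕ i ≡ l
        i≡ = Fin.toℕ-fromℕ< l<d
      at-distance : ∀ l b → Sat A (atDistanceᶠ l b) ρ → b ≡ true × Dist (Edge F) (ι u) (ι v) (suc l)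
      at-distance l true (s , ¬s) = refl , Equivalence.to (within⇔ (suc l)) s ,
        λ k k<l dk → ¬s (Equivalence.from (within⇔ l) (DistLE-mono (≤-pred k<l) dk))
      from : Sat A adjacentᶠ ρ → Edge G u v
      from s with Equivalence.to (Sat-⋁ {A = A} d φ) s
      ... | i , si with at-distance (toℕ i) (S zero zero (suc (toℕ i))) si
      ...   | Sl , dist = Equivalence.from (correct u v _ dist) (trans (S-colour u v _) Sl)

    inImage : InImage transduction F G
    inImage = Pr , tt , leaf , (ι-inj ∘ cong proj₁) ,
      (λ { (x , zero) → mk⇔ (λ s → Product.map₂ (cong (_, zero)) (does⇒ (leaf? x) s)) (λ { (v , refl) → dec-true (leaf? (ι v)) (v , refl) }) }) ,
      λ u v _ → mk⇔ (inj₁ ∘ Equivalence.to (Edge⇔adjacent u v))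
        [ Equivalence.from (Edge⇔adjacent u v)
        , (λ s → trans (Graph.sym G u v) (Equivalence.from (Edge⇔adjacent v u) s)) ]′

Cond3⇒Cond1 : ∀ {𝒢} → Cond3 𝒢 → Cond1 𝒢
Cond3⇒Cond1 (d , S , shrub) = (λ G' → TreedepthLE G' d) , (d , λ _ td → td) , ShrubTransduction.transduction d S ,
  λ G G∈ → let (Δ , td) = shrub G G∈ in ShrubDec.F Δ , td , ShrubTransduction.inImage d S Δ

-- Degrees, and graphs presented by decidable relations

≤-∑ : ∀ {k} (f : Fin k → ℕ) i → f i ≤ ∑ k f
≤-∑ f zero    = m≤m+n _ _
≤-∑ f (suc i) = ≤-trans (≤-∑ (f ∘ suc) i) (m≤n+m _ _)

∑-≤1-unique : ∀ {k} (f : Fin k → ℕ) → ∑ k f ≤ 1 → ∀ {i j} → 1 ≤ f i → 1 ≤ f j → i ≡ j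
∑-≤1-unique f le {zero}  {zero}  _ _ = refl
∑-≤1-unique f le {zero}  {suc j} p q = contradiction (≤-trans (+-mono-≤ p (≤-trans q (≤-∑ (f ∘ suc) j))) le) λ { (s≤s ()) }
∑-≤1-unique f le {suc i} {zero}  p q = contradiction (≤-trans (+-mono-≤ q (≤-trans p (≤-∑ (f ∘ suc) i))) le) λ { (s≤s ()) }
∑-≤1-unique f le {suc i} {suc j} p q = cong suc (∑-≤1-unique (f ∘ suc) (≤-trans (m≤n+m _ (f zero)) le) p q)

deg-∑ : ∀ F x → deg F x ≡ ∑ (n F) (indicator ∘ adj F x)
deg-∑ F x = sum-allFin (n F) _

deg-one : ∀ F {x y} → Edge F x y → (∀ z → Edge F x z → z ≡ y) → deg F x ≡ 1
deg-one F {x} {y} xy only = trans (deg-∑ F x) (trans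
  (∑-single y λ z z≢y → indicator-zero λ xz → z≢y (only z xz)) (cong indicator xy))

deg-one-unique : ∀ F {x} → deg F x ≡ 1 → ∀ {y z} → Edge F x y → Edge F x z → y ≡ z
deg-one-unique F {x} one xy xz = ∑-≤1-unique (indicator ∘ adj F x)
  (≤-reflexive (trans (sym (deg-∑ F x)) one)) (≤-reflexive (sym (cong indicator xy))) (≤-reflexive (sym (cong indicator xz)))

module Symmetrised {W : Set} {K : ℕ} (to : W → Fin K) (from : Fin K → W)
  (from-to : ∀ w → from (to w) ≡ w) (to-from : ∀ x → to (from x) ≡ x)
  {R : W → W → Set} (R? : ∀ x y → Dec (R x y)) (R-irr : ∀ x → ¬ R x x) where

  Sym : W → W → Set
  Sym x y = R x y ⊎ R y x

  Sym? : ∀ x y → Dec (Sym x y)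
  Sym? x y = R? x y ⊎-dec R? y x

  graph : Graph
  graph = record
    { n = K ; adj = λ x y → does (Sym? (from x) (from y))
    ; sym = λ x y → does-⇔ (mk⇔ Sum.swap Sum.swap) (Sym? (from x) (from y)) (Sym? (from y) (from x))
    ; irrefl = λ x → dec-false (Sym? (from x) (from x)) [ R-irr _ , R-irr _ ]′ }

  edge⇒ : ∀ {x y} → Edge graph x y → Sym (from x) (from y)
  edge⇒ {x} {y} = does⇒ (Sym? (from x) (from y))

  edge⇐ : ∀ {v w} → Sym v w → Edge graph (to v) (to w)
  edge⇐ {v} {w} s = dec-true (Sym? _ _) (subst₂ Sym (sym (from-to v)) (sym (from-to w)) s)

  distLE : ∀ {v w k} → DistLE Sym v w k → DistLE (Edge graph) (to v) (to w) k
  distLE ([] , _)                  = DistLE-refl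
  distLE {k = suc k} (e ∷ p , s≤s le) = DistLE-trans (DistLE-edge (edge⇐ e)) (distLE (p , le))

  potential : (h : W → ℕ) → (∀ {x y} → R x y → h y ≤ suc (h x) × h x ≤ suc (h y)) →
    ∀ {v w k} → DistLE (Edge graph) (to v) (to w) k → h w ≤ k + h v
  potential h lip {v} {w} {k} (p , le) = begin
    h w                        ≡⟨ cong h (from-to w) ⟨
    h (from (to w))            ≤⟨ walk-potential (h ∘ from) (λ e → [ proj₁ ∘ lip , proj₂ ∘ lip ]′ (edge⇒ e)) p ⟩
    wlen p + h (from (to v))   ≤⟨ +-mono-≤ le (≤-reflexive (cong h (from-to v))) ⟩
    k + h v                    ∎
    where open ≤-Reasoning

  treedepth : ∀ {d} → TreedepthLE' Sym d → TreedepthLE graph d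
  treedepth = TreedepthLE'-transport to from from-to to-from λ _ _ → edge⇒

-- Powers of two form a Sidon set, so the distance between two leaves reveals their two colours.
2^-<-sum : ∀ {i j k l} → i ≤ j → j < l → 2 ^ i + 2 ^ j < 2 ^ k + 2 ^ l
2^-<-sum {i} {j} {k} {l} i≤j j<l = begin-strict
  2 ^ i + 2 ^ j        ≤⟨ +-mono-≤ (^-monoʳ-≤ 2 i≤j) (≤-reflexive (sym (+-identityʳ _))) ⟩
  2 ^ suc j            ≤⟨ ^-monoʳ-≤ 2 j<l ⟩
  2 ^ l                <⟨ m<n+m (2 ^ l) (m^n>0 2 k) ⟩
  2 ^ k + 2 ^ l        ∎
  where open ≤-Reasoning

2^-injective : ∀ {i j} → 2 ^ i ≡ 2 ^ j → i ≡ j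
2^-injective {i} {j} eq with <-cmp i j
... | tri< i<j _ _ = contradiction eq (<⇒≢ (^-monoʳ-< 2 ≤-refl i<j))
... | tri≈ _ e _   = e
... | tri> _ _ j<i = contradiction (sym eq) (<⇒≢ (^-monoʳ-< 2 ≤-refl j<i))

2^-sidon-sorted : ∀ {i j k l} → i ≤ j → k ≤ l → 2 ^ i + 2 ^ j ≡ 2 ^ k + 2 ^ l → i ≡ k × j ≡ l
2^-sidon-sorted {i} {j} {k} {l} i≤j k≤l eq with <-cmp j l
... | tri< j<l _ _ = contradiction eq (<⇒≢ (2^-<-sum {k = k} i≤j j<l))
... | tri> _ _ l<j = contradiction (sym eq) (<⇒≢ (2^-<-sum {k = i} k≤l l<j))
... | tri≈ _ refl _ = 2^-injective (+-cancelʳ-≡ (2 ^ j) _ _ eq) , refl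

2^-sidon : ∀ i j k l → 2 ^ i + 2 ^ j ≡ 2 ^ k + 2 ^ l → (i ≡ k × j ≡ l) ⊎ (i ≡ l × j ≡ k)
2^-sidon i j k l eq with ≤-total i j | ≤-total k l
... | inj₁ i≤j | inj₁ k≤l = inj₁ (2^-sidon-sorted i≤j k≤l eq)
... | inj₁ i≤j | inj₂ l≤k = inj₂ (2^-sidon-sorted i≤j l≤k (trans eq (+-comm (2 ^ k) _)))
... | inj₂ j≤i | inj₁ k≤l = inj₂ (Product.swap (2^-sidon-sorted j≤i k≤l (trans (+-comm (2 ^ j) _) eq)))
... | inj₂ j≤i | inj₂ l≤k = inj₁ (Product.swap (2^-sidon-sorted j≤i l≤k (trans (+-comm (2 ^ j) _) (trans eq (+-comm (2 ^ k) _)))))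

-- Reading two colours and a level off one distance

quotient-< : ∀ {b q q' r r'} → r < b → q < q' → b * q + r < b * q' + r'
quotient-< {b} {q} {q'} {r} {r'} r<b q<q' = begin-strict
  b * q + r   <⟨ +-monoʳ-< (b * q) r<b ⟩
  b * q + b   ≡⟨ trans (+-comm (b * q) b) (sym (*-suc b q)) ⟩
  b * suc q   ≤⟨ *-monoʳ-≤ b q<q' ⟩
  b * q'      ≤⟨ m≤m+n _ r' ⟩
  b * q' + r' ∎
  where open ≤-Reasoning

quotient-remainder-unique : ∀ {b q q' r r'} → r < b → r' < b → b * q + r ≡ b * q' + r' → q ≡ q' × r ≡ r'
quotient-remainder-unique {b} {q} {q'} r<b r'<b eq with <-cmp q q'
... | tri< q<q' _ _ = contradiction eq (<⇒≢ (quotient-< r<b q<q'))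
... | tri> _ _ q'<q = contradiction (sym eq) (<⇒≢ (quotient-< r'<b q'<q))
... | tri≈ _ refl _ = refl , +-cancelˡ-≡ (b * q) _ _ eq

module Distances (D M : ℕ) where

  -- The position at which an arm of colour `i` is attached. The factor `suc (D + D)` exceeds every
  -- `(D ∸ l) + (D ∸ l)`; the outer `suc` keeps the position visibly away from the leaf at 0.
  arm : Fin M → ℕ
  arm i = suc (suc (D + D) * 2 ^ toℕ i)

  armMax : ℕ
  armMax = suc (suc (suc (D + D) * 2 ^ M))

  arm-< : ∀ i → arm i < armMax
  arm-< i = s≤s (s≤s (*-monoʳ-≤ (suc (D + D)) (^-monoʳ-≤ 2 (<⇒≤ (Fin.toℕ<n i)))))

  -- From either leaf to the lowest common ancestor: `arm i` steps along the arm, one step to the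
  -- tree, and `D ∸ l` steps in it.
  distance : Fin M → Fin M → ℕ → ℕ
  distance i j l = (suc (arm i) + (D ∸ l)) + (suc (arm j) + (D ∸ l))

  distance-bound : ℕ
  distance-bound = (suc armMax + D) + (suc armMax + D)

  distance-≤ : ∀ i j l → distance i j l ≤ distance-bound
  distance-≤ i j l = +-mono-≤ (half i) (half j)
    where
    half : ∀ i → suc (arm i) + (D ∸ l) ≤ suc armMax + D
    half i = +-mono-≤ (s≤s (<⇒≤ (arm-< i))) (m∸n≤m D l)

  -- The distance is `4 + (2D + 1)(2^i + 2^j) + 2(D - l)`. Division by `2D + 1` separates the level
  -- from the sum of powers, which fixes the colours up to order.
  distance-decode : ∀ {i j l i' j' l'} → l ≤ D → l' ≤ D → distance i j l ≡ distance i' j' l' →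
    l ≡ l' × ((i ≡ i' × j ≡ j') ⊎ (i ≡ j' × j ≡ i'))
  distance-decode {i} {j} {l} {i'} {j'} {l'} l≤D l'≤D eq =
    ∸-cancelˡ-≡ l≤D l'≤D (halves (proj₂ split)) ,
    Sum.map (Product.map Fin.toℕ-injective Fin.toℕ-injective) (Product.map Fin.toℕ-injective Fin.toℕ-injective)
      (2^-sidon (toℕ i) (toℕ j) (toℕ i') (toℕ j') (proj₁ split))
    where
    rearrange : ∀ b x y r → (suc (suc (b * x)) + r) + (suc (suc (b * y)) + r) ≡ 4 + (b * (x + y) + (r + r))
    rearrange = solve-∀
    small : ∀ l → (D ∸ l) + (D ∸ l) < suc (D + D)
    small l = s≤s (+-mono-≤ (m∸n≤m D l) (m∸n≤m D l))
    split : 2 ^ toℕ i + 2 ^ toℕ j ≡ 2 ^ toℕ i' + 2 ^ toℕ j' × (D ∸ l) + (D ∸ l) ≡ (D ∸ l') + (D ∸ l')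
    split = quotient-remainder-unique {suc (D + D)} (small l) (small l') (+-cancelˡ-≡ 4 _ _
      (trans (sym (rearrange (suc (D + D)) (2 ^ toℕ i) (2 ^ toℕ j) (D ∸ l)))
        (trans eq (rearrange (suc (D + D)) (2 ^ toℕ i') (2 ^ toℕ j') (D ∸ l')))))
    halves : ∀ {a b} → a + a ≡ b + b → a ≡ b
    halves {a} {b} e with <-cmp a b
    ... | tri< a<b _ _ = contradiction e (<⇒≢ (+-mono-< a<b a<b))
    ... | tri≈ _ a≡b _ = a≡b
    ... | tri> _ _ b<a = contradiction (sym e) (<⇒≢ (+-mono-< b<a b<a))

  module _ (S : Fin M → Fin M → ℕ → Bool) where

    Decodes : ℕ → Fin M × Fin M × Fin (suc D) → Set
    Decodes δ (i , j , l) = δ ≡ distance i j (toℕ l) × S i j (toℕ l) ≡ true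

    decodes? : ∀ δ → Dec (∃ (Decodes δ))
    decodes? δ = ×-searchable Fin-searchable (×-searchable Fin-searchable Fin-searchable)
      λ (i , j , l) → (δ ≟ distance i j (toℕ l)) ×-dec bool? (S i j (toℕ l))

    distanceS : Fin 1 → Fin 1 → ℕ → Bool
    distanceS _ _ δ = does (decodes? δ)

-- Every node of the tree becomes a triangle, so that no node is a leaf. The arm of a vertex v is a
-- path with end points (v , 0) and (v , armMax) whose positions arm (col v) and armMax are both
-- joined to the node key D v; the second edge prevents a second end of degree one.
module ShrubModel {G : Graph} {D M : ℕ} {S : Fin M → Fin M → ℕ → Bool} (model : TreeModel G D M S) where

  open TreeModel model
  open Distances D M

  W : Set
  W = (Fin N × Fin 3) ⊎ (Fin (n G) × Fin (suc armMax))

  data Arc : W → W → Set where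
    triangle : ∀ {x r s} → r ≢ s → Arc (inj₁ (x , r)) (inj₁ (x , s))
    branch   : ∀ {x} → lvl x ≢ 0 → Arc (inj₁ (x , zero)) (inj₁ (parent x , zero))
    joint    : ∀ {v s} → toℕ s ≡ arm (col v) ⊎ toℕ s ≡ armMax → Arc (inj₂ (v , s)) (inj₁ (key D v , zero))
    segment  : ∀ {v s t} → toℕ t ≡ suc (toℕ s) → Arc (inj₂ (v , s)) (inj₂ (v , t))

  arc? : ∀ x y → Dec (Arc x y)
  arc? (inj₁ (x , r)) (inj₁ (y , s)) = map′
    (λ { (inj₁ (refl , r≢s)) → triangle r≢s ; (inj₂ (refl , refl , refl , nz)) → branch nz })
    (λ { (triangle r≢s) → inj₁ (refl , r≢s) ; (branch nz) → inj₂ (refl , refl , refl , nz) })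
    (((x Fin.≟ y) ×-dec ¬? (r Fin.≟ s)) ⊎-dec
      ((r Fin.≟ zero) ×-dec (s Fin.≟ zero) ×-dec (parent x Fin.≟ y) ×-dec ¬? (lvl x ≟ 0)))
  arc? (inj₁ _) (inj₂ _) = no λ ()
  arc? (inj₂ (v , s)) (inj₁ (x , r)) = map′
    (λ { (refl , refl , p) → joint p }) (λ { (joint p) → refl , refl , p })
    ((r Fin.≟ zero) ×-dec (x Fin.≟ key D v) ×-dec ((toℕ s ≟ arm (col v)) ⊎-dec (toℕ s ≟ armMax)))
  arc? (inj₂ (v , s)) (inj₂ (w , t)) = map′
    (λ { (refl , p) → segment p }) (λ { (segment p) → refl , p })
    ((v Fin.≟ w) ×-dec (toℕ t ≟ suc (toℕ s)))

  lvl-parent : ∀ {x} → lvl x ≢ 0 → suc (lvl (parent x)) ≡ lvl x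
  lvl-parent {x} nz with lvl x in eq
  ... | zero  = contradiction refl nz
  ... | suc l = cong suc (lvl-suc eq)

  arc-≢ : ∀ {x y} → Arc x y → x ≢ y
  arc-≢ (triangle r≢s) refl = r≢s refl
  arc-≢ (branch {x} nz) eq  = 1+n≢n (trans (lvl-parent nz) (cong lvl (cong proj₁ (Sum.inj₁-injective eq))))
  arc-≢ (segment eq)  refl  = 1+n≢n (sym eq)

  K : ℕ
  K = N * 3 + n G * suc armMax

  to : W → Fin K
  to w = Fin.join (N * 3) _ (Sum.map (uncurry combine) (uncurry combine) w)

  from : Fin K → W
  from x = Sum.map (remQuot 3) (remQuot (suc armMax)) (Fin.splitAt (N * 3) x)

  from-to : ∀ w → from (to w) ≡ w
  from-to (inj₁ (x , r)) = trans (cong (Sum.map _ _) (Fin.splitAt-join (N * 3) (n G * suc armMax) (inj₁ (combine x r))))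
    (cong inj₁ (Fin.remQuot-combine x r))
  from-to (inj₂ (v , s)) = trans (cong (Sum.map _ _) (Fin.splitAt-join (N * 3) (n G * suc armMax) (inj₂ (combine v s))))
    (cong inj₂ (Fin.remQuot-combine v s))

  to-from : ∀ x → to (from x) ≡ x
  to-from x = trans (cong (Fin.join (N * 3) (n G * suc armMax)) (rejoin (Fin.splitAt (N * 3) x))) (Fin.join-splitAt (N * 3) _ x)
    where
    rejoin : ∀ s → Sum.map (uncurry combine) (uncurry combine) (Sum.map (remQuot {N} 3) (remQuot {n G} (suc armMax)) s) ≡ s
    rejoin (inj₁ y) = cong inj₁ (Fin.combine-remQuot {N} 3 y)
    rejoin (inj₂ y) = cong inj₂ (Fin.combine-remQuot {n G} (suc armMax) y)

  to-injective : ∀ {v w} → to v ≡ to w → v ≡ w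
  to-injective {v} {w} eq = trans (sym (from-to v)) (trans (cong from eq) (from-to w))

  open Symmetrised to from from-to to-from arc? (λ x a → arc-≢ a refl)

  hub : Fin N → W
  hub x = inj₁ (x , zero)

  Sym-sym : ∀ {x y} → Sym x y → Sym y x
  Sym-sym = Sum.swap

  -- Elimination forest: the triangles of the ancestors one after the other, then the arm.
  elimParent : W → Maybe W
  elimParent (inj₁ (x , zero)) with lvl x
  ... | zero  = nothing
  ... | suc _ = just (inj₁ (parent x , suc (suc zero)))
  elimParent (inj₁ (x , suc r)) = just (inj₁ (x , Fin.inject₁ r))
  elimParent (inj₂ (v , zero))  = just (inj₁ (key D v , suc (suc zero)))
  elimParent (inj₂ (v , suc s)) = just (inj₂ (v , Fin.inject₁ s))

  -- Three places for each level, then the arm. The rank drops along `elimParent` and so bounds the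
  -- depth.
  rank : W → ℕ
  rank (inj₁ (x , r)) = lvl x * 3 + toℕ r
  rank (inj₂ (v , s)) = suc D * 3 + toℕ s

  elim-rank : ∀ w {w'} → elimParent w ≡ just w' → rank w' < rank w
  elim-rank (inj₁ (x , zero)) eq with lvl x in lx
  elim-rank (inj₁ (x , zero)) refl | suc l = begin-strict
    lvl (parent x) * 3 + 2  ≡⟨ cong (λ l → l * 3 + 2) (lvl-suc lx) ⟩
    l * 3 + 2               <⟨ +-monoʳ-< (l * 3) ≤-refl ⟩
    l * 3 + 3               ≡⟨ +-comm (l * 3) 3 ⟩
    suc l * 3               ≡⟨ +-identityʳ _ ⟨
    suc l * 3 + 0           ∎
    where open ≤-Reasoning
  elim-rank (inj₁ (x , suc r)) refl = +-monoʳ-< (lvl x * 3) (s≤s (≤-reflexive (Fin.toℕ-inject₁ r)))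
  elim-rank (inj₂ (v , zero))  refl = begin-strict
    lvl (key D v) * 3 + 2   ≡⟨ cong (λ l → l * 3 + 2) (key-lvl ≤-refl v) ⟩
    D * 3 + 2               <⟨ +-monoʳ-< (D * 3) ≤-refl ⟩
    D * 3 + 3               ≡⟨ +-comm (D * 3) 3 ⟩
    suc D * 3               ≡⟨ +-identityʳ _ ⟨
    suc D * 3 + 0           ∎
    where open ≤-Reasoning
  elim-rank (inj₂ (v , suc s)) refl = +-monoʳ-< (suc D * 3) (s≤s (≤-reflexive (Fin.toℕ-inject₁ s)))

  elim-depth : ∀ k w → rank w < k → DepthLE elimParent k w
  elim-depth (suc k) w (s≤s le) with elimParent w in eq
  ... | nothing = root eq
  ... | just w' = step eq (elim-depth k w' (≤-trans (elim-rank w eq) le))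

  treedepthBound : ℕ
  treedepthBound = suc D * 3 + suc armMax

  rank-bound : ∀ w → rank w < treedepthBound
  rank-bound (inj₁ (x , r)) = +-mono-≤-< (*-monoˡ-≤ 3 (m≤n⇒m≤1+n (lvl-≤ x))) (≤-trans (Fin.toℕ<n r) (s≤s (s≤s (s≤s z≤n))))
  rank-bound (inj₂ (v , s)) = +-monoʳ-< (suc D * 3) (Fin.toℕ<n s)

  Anc-trans : ∀ {u v w} → Anc elimParent u v → Anc elimParent v w → Anc elimParent u w
  Anc-trans a here      = a
  Anc-trans a (up eq b) = up eq (Anc-trans a b)

  triangle-Anc : ∀ {x r s} → r Fin.≤ s → Anc elimParent (inj₁ (x , r)) (inj₁ (x , s))
  triangle-Anc {r = zero}         {zero}         _ = here
  triangle-Anc {r = zero}         {suc zero}     _ = up refl here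
  triangle-Anc {r = zero}         {suc (suc zero)} _ = up refl (up refl here)
  triangle-Anc {r = suc zero}     {suc zero}     _ = here
  triangle-Anc {r = suc zero}     {suc (suc zero)} _ = up refl here
  triangle-Anc {r = suc (suc zero)} {suc (suc zero)} _ = here
  triangle-Anc {r = suc (suc zero)} {suc zero} (s≤s ())

  branch-Anc : ∀ {x} → lvl x ≢ 0 → Anc elimParent (hub (parent x)) (hub x)
  branch-Anc {x} nz = up parent-eq (triangle-Anc z≤n)
    where
    parent-eq : elimParent (hub x) ≡ just (inj₁ (parent x , suc (suc zero)))
    parent-eq with lvl x
    ... | zero  = contradiction refl nz
    ... | suc _ = refl

  joint-Anc : ∀ {v} k {s : Fin (suc armMax)} → toℕ s ≡ k → Anc elimParent (hub (key D v)) (inj₂ (v , s))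
  joint-Anc zero    {zero}  _  = up refl (triangle-Anc z≤n)
  joint-Anc (suc k) {suc s} eq = up refl (joint-Anc k (trans (Fin.toℕ-inject₁ s) (suc-injective eq)))

  arc-Anc : ∀ {x y} → Arc x y → Anc elimParent x y ⊎ Anc elimParent y x
  arc-Anc (triangle {r = r} {s} _) = Sum.map triangle-Anc triangle-Anc (≤-total (toℕ r) (toℕ s))
  arc-Anc (branch nz)              = inj₂ (branch-Anc nz)
  arc-Anc (joint _)                = inj₂ (joint-Anc _ refl)
  arc-Anc (segment {v} {s} {suc t} eq) = inj₁ (up
    (cong (λ s → just (inj₂ (v , s))) (Fin.toℕ-injective (trans (Fin.toℕ-inject₁ t) (suc-injective eq)))) here)

  shrub-treedepth : TreedepthLE graph treedepthBound
  shrub-treedepth = treedepth (elimParent , (λ w → elim-depth _ w (rank-bound w)) ,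
    λ x y → [ arc-Anc , Sum.swap ∘ arc-Anc ]′)

  climb-top : ∀ l {x} → lvl x ≡ l → DistLE Sym (hub x) (hub top) l
  climb-top zero    eq = subst (λ x → DistLE Sym (hub x) (hub top) 0) (sym (lvl-zero eq)) DistLE-refl
  climb-top (suc l) eq = DistLE-trans (DistLE-edge (inj₁ (branch λ z → 1+n≢0 (trans (sym eq) z)))) (climb-top l (lvl-suc eq))

  climb-key : ∀ j {e} v → j + e ≤ D → DistLE Sym (hub (key (j + e) v)) (hub (key e v)) j
  climb-key zero    v _  = DistLE-refl
  climb-key (suc j) {e} v le = DistLE-trans
    (DistLE-edge (inj₁ (subst (λ x → Arc (hub (key (suc j + e) v)) (hub x)) (key-up le v)
      (branch λ z → 1+n≢0 (trans (sym (key-lvl le v)) z)))))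
    (climb-key j v (<⇒≤ le))

  ascend : ∀ j {v} {s t : Fin (suc armMax)} → toℕ t ≡ j + toℕ s → DistLE Sym (inj₂ (v , s)) (inj₂ (v , t)) j
  ascend zero    {v} {s} {t} eq = subst (λ t → DistLE Sym (inj₂ (v , s)) (inj₂ (v , t)) 0) (Fin.toℕ-injective (sym eq)) DistLE-refl
  ascend (suc j) {v} {s} {t} eq = DistLE-trans (DistLE-edge (inj₁ (segment s⁺≡))) (ascend j (trans eq (trans (sym (+-suc j _)) (cong (j +_) (sym s⁺≡)))))
    where
    s⁺< : suc (toℕ s) < suc armMax
    s⁺< = ≤-trans (s≤s (subst (suc (toℕ s) ≤_) (sym eq) (s≤s (m≤n+m _ j)))) (Fin.toℕ<n t)
    s⁺≡ : toℕ (Fin.fromℕ< s⁺<) ≡ suc (toℕ s)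
    s⁺≡ = Fin.toℕ-fromℕ< s⁺<

  leaf : Fin (n G) → W
  leaf v = inj₂ (v , zero)

  leaf-key : ∀ {e} v → e ≤ D → DistLE Sym (leaf v) (hub (key e v)) (suc (arm (col v)) + (D ∸ e))
  leaf-key {e} v e≤D = DistLE-trans
    (subst (DistLE Sym (leaf v) (hub (key D v))) (+-comm (arm (col v)) 1)
      (DistLE-trans (ascend (arm (col v)) (trans a≡ (sym (+-identityʳ _)))) (DistLE-edge (inj₁ (joint (inj₁ a≡))))))
    (subst (λ E → DistLE Sym (hub (key E v)) (hub (key e v)) (D ∸ e)) (m∸n+n≡m e≤D)
      (climb-key (D ∸ e) v (≤-reflexive (m∸n+n≡m e≤D))))
    where
    a≡ : toℕ (Fin.fromℕ< (m≤n⇒m≤1+n (arm-< (col v)))) ≡ arm (col v)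
    a≡ = Fin.toℕ-fromℕ< (m≤n⇒m≤1+n (arm-< (col v)))

  leaf-distance : ∀ u v → DistLE Sym (leaf u) (leaf v) (distance (col u) (col v) (lev u v))
  leaf-distance u v = DistLE-trans
    (subst (λ x → DistLE Sym (leaf u) (hub x) (suc (arm (col u)) + (D ∸ lev u v))) (lev-key ≤-refl) (leaf-key u (lev-≤ u v)))
    (DistLE-sym Sym-sym (leaf-key v (lev-≤ u v)))

  radius : ℕ
  radius = armMax + suc D

  -- An arm vertex leaves by the far end of its arm, whose joint exists for every colour.
  to-top : ∀ w → DistLE Sym w (hub top) radius
  to-top (inj₁ (x , zero))  = DistLE-mono (≤-trans (lvl-≤ x) (≤-trans (n≤1+n D) (m≤n+m _ armMax))) (climb-top _ refl)
  to-top (inj₁ (x , suc r)) = DistLE-mono (≤-trans (s≤s (lvl-≤ x)) (m≤n+m _ armMax))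
    (DistLE-trans (DistLE-edge (inj₁ (triangle λ ()))) (climb-top _ refl))
  to-top (inj₂ (v , s)) = DistLE-trans
    (DistLE-mono (m∸n≤m armMax (toℕ s)) (ascend (armMax ∸ toℕ s) (trans end≡ (sym (m∸n+n≡m (≤-pred (Fin.toℕ<n s)))))))
    (DistLE-trans (DistLE-edge (inj₁ (joint (inj₂ end≡)))) (climb-top D (key-lvl ≤-refl v)))
    where
    end≡ : toℕ (Fin.fromℕ armMax) ≡ armMax
    end≡ = Fin.toℕ-fromℕ armMax

  shrub-diam : ∀ x y → DistLE (Edge graph) x y (radius + radius)
  shrub-diam x y = subst₂ (λ x y → DistLE (Edge graph) x y (radius + radius)) (to-from x) (to-from y)
    (distLE (DistLE-trans (to-top (from x)) (DistLE-sym Sym-sym (to-top (from y)))))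

  -- A 1-Lipschitz function measuring the distance from the leaf u.
  module _ (u : Fin (n G)) where

    -- The tree distance from `key D u` to a node of level `l`: up to the branch point, then one
    -- step for each level below it.
    nodeDistance : ℕ → Fin N → ℕ
    nodeDistance zero    x = D
    nodeDistance (suc l) x with key (suc l) u Fin.≟ x
    ... | yes _ = D ∸ suc l
    ... | no _  = suc (nodeDistance l (parent x))

    nodeDistance-key : ∀ l → nodeDistance l (key l u) ≡ D ∸ l
    nodeDistance-key zero    = refl
    nodeDistance-key (suc l) with key (suc l) u Fin.≟ key (suc l) u
    ... | yes _ = refl
    ... | no ¬p = contradiction refl ¬p

    nodeDistance-parent : ∀ l x → suc l ≤ D →
      nodeDistance l (parent x) ≤ suc (nodeDistance (suc l) x) × nodeDistance (suc l) x ≤ suc (nodeDistance l (parent x))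
    nodeDistance-parent l x l<D with key (suc l) u Fin.≟ x
    ... | no _     = ≤-trans (n≤1+n _) (n≤1+n _) , ≤-refl
    ... | yes refl = subst (λ δ → δ ≤ suc (D ∸ suc l) × D ∸ suc l ≤ suc δ)
      (sym (trans (cong (nodeDistance l) (key-up l<D u)) (nodeDistance-key l)))
      (≤-reflexive (+-∸-assoc 1 l<D) , ≤-trans (∸-monoʳ-≤ D (n≤1+n l)) (n≤1+n _))

    nodeDistance-off : ∀ v j → j + lev u v ≤ D → nodeDistance (j + lev u v) (key (j + lev u v) v) ≡ j + (D ∸ lev u v)
    nodeDistance-off v zero    _  = trans (cong (nodeDistance (lev u v)) (sym (lev-key ≤-refl))) (nodeDistance-key (lev u v))
    nodeDistance-off v (suc j) le with key (suc j + lev u v) u Fin.≟ key (suc j + lev u v) v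
    ... | yes eq = contradiction (lev-max le eq) (<⇒≱ (s≤s (m≤n+m _ j)))
    ... | no _   = cong suc (trans (cong (nodeDistance (j + lev u v)) (key-up le v)) (nodeDistance-off v j (<⇒≤ le)))

    δ : Fin N → ℕ
    δ x = nodeDistance (lvl x) x

    δ-key-own : δ (key D u) ≡ 0
    δ-key-own = trans (cong (λ l → nodeDistance l (key D u)) (key-lvl ≤-refl u)) (trans (nodeDistance-key D) (n∸n≡0 D))

    δ-key : ∀ v → δ (key D v) ≡ (D ∸ lev u v) + (D ∸ lev u v)
    δ-key v = trans (cong (λ l → nodeDistance l (key D v)) (key-lvl ≤-refl v))
      (subst (λ E → nodeDistance E (key E v) ≡ (D ∸ lev u v) + (D ∸ lev u v)) (m∸n+n≡m (lev-≤ u v))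
        (nodeDistance-off v (D ∸ lev u v) (≤-reflexive (m∸n+n≡m (lev-≤ u v)))))

    δ-parent : ∀ {x} → lvl x ≢ 0 → δ (parent x) ≤ suc (δ x) × δ x ≤ suc (δ (parent x))
    δ-parent {x} nz with lvl x in eq
    ... | zero  = contradiction refl nz
    ... | suc l rewrite lvl-suc eq = nodeDistance-parent l x (subst (_≤ D) eq (lvl-≤ x))

    -- The value is capped past the first joint on the arm of `u` and constant past it on the other
    -- arms. Beyond the joint it may underestimate distances, but it is 1-Lipschitz across both
    -- joint edges and exact at the leaves.
    armHeight : Fin (n G) → ℕ → ℕ
    armHeight v s with v Fin.≟ u
    ... | yes _ = s ⊓ arm (col u)
    ... | no _  = suc (arm (col u)) + δ (key D v) + suc (arm (col v) ∸ s)

    height : W → ℕ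
    height (inj₁ (x , _)) = suc (arm (col u)) + δ x
    height (inj₂ (v , s)) = armHeight v (toℕ s)

    armHeight-step : ∀ v s → armHeight v (suc s) ≤ suc (armHeight v s) × armHeight v s ≤ suc (armHeight v (suc s))
    armHeight-step v s with v Fin.≟ u
    ... | yes _ = ⊓-step s (arm (col u)) , ≤-trans (⊓-monoˡ-≤ _ (n≤1+n s)) (n≤1+n _)
      where
      ⊓-step : ∀ a b → suc a ⊓ b ≤ suc (a ⊓ b)
      ⊓-step a zero    = z≤n
      ⊓-step a (suc b) = s≤s (⊓-monoʳ-≤ a (n≤1+n b))
    ... | no _ =
      ≤-trans (+-monoʳ-≤ base (s≤s (∸-monoʳ-≤ (arm (col v)) (n≤1+n s)))) (n≤1+n _) ,
      ≤-trans (+-monoʳ-≤ base (s≤s (∸-step (arm (col v)) s))) (≤-reflexive (+-suc base _))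
      where
      base = suc (arm (col u)) + δ (key D v)
      ∸-step : ∀ a b → a ∸ b ≤ suc (a ∸ suc b)
      ∸-step zero    zero    = z≤n
      ∸-step zero    (suc b) = z≤n
      ∸-step (suc a) zero    = ≤-refl
      ∸-step (suc a) (suc b) = ∸-step a b

    height-lipschitz : ∀ {x y} → Arc x y → height y ≤ suc (height x) × height x ≤ suc (height y)
    height-lipschitz (triangle _) = n≤1+n _ , n≤1+n _
    height-lipschitz (branch {x} nz) = shift (proj₁ (δ-parent nz)) , shift (proj₂ (δ-parent nz))
      where
      shift : ∀ {a b} → a ≤ suc b → suc (arm (col u)) + a ≤ suc (suc (arm (col u)) + b)
      shift {a} {b} le = ≤-trans (+-monoʳ-≤ (suc (arm (col u))) le) (≤-reflexive (+-suc (suc (arm (col u))) b))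
    height-lipschitz (joint {v} {s} at) with v Fin.≟ u
    ... | yes refl = ≤-reflexive (trans (cong (suc (arm (col u)) +_) δ-key-own) (trans (+-identityʳ _) (cong suc (sym at-arm)))) ,
                     ≤-trans (≤-reflexive at-arm) (≤-trans (≤-trans (n≤1+n _) (m≤m+n _ _)) (n≤1+n _))
      where
      at-arm : toℕ s ⊓ arm (col u) ≡ arm (col u)
      at-arm = m≥n⇒m⊓n≡n ([ (λ e → ≤-reflexive (sym e)) , (λ e → ≤-trans (<⇒≤ (arm-< (col u))) (≤-reflexive (sym e))) ]′ at)
    ... | no _ = ≤-trans (m≤m+n _ _) (n≤1+n _) ,
                 ≤-reflexive (trans (cong (λ r → suc (arm (col u)) + δ (key D v) + suc r) past-arm) (+-comm _ 1))
      where
      past-arm : arm (col v) ∸ toℕ s ≡ 0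
      past-arm = m≤n⇒m∸n≡0 ([ (λ e → ≤-reflexive (sym e)) , (λ e → ≤-trans (<⇒≤ (arm-< (col v))) (≤-reflexive (sym e))) ]′ at)
    height-lipschitz (segment {v} {s} eq) =
      subst (λ t → armHeight v t ≤ suc (height (inj₂ (v , s))) × height (inj₂ (v , s)) ≤ suc (armHeight v t))
        (sym eq) (armHeight-step v (toℕ s))

    height-own : height (leaf u) ≡ 0
    height-own with u Fin.≟ u
    ... | yes _ = refl
    ... | no ¬p = contradiction refl ¬p

    height-leaf : ∀ {v} → u ≢ v → height (leaf v) ≡ distance (col u) (col v) (lev u v)
    height-leaf {v} u≢v with v Fin.≟ u
    ... | yes v≡u = contradiction (sym v≡u) u≢v
    ... | no _    = trans (cong (λ d → suc (arm (col u)) + d + suc (arm (col v))) (δ-key v))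
      (rearrange (suc (arm (col u))) (D ∸ lev u v) (suc (arm (col v))))
      where
      rearrange : ∀ a r b → a + (r + r) + b ≡ (a + r) + (b + r)
      rearrange = solve-∀

  ι : Fin (n G) → Fin K
  ι v = to (leaf v)

  ι-distance-≥ : ∀ {u v k} → u ≢ v → DistLE (Edge graph) (ι u) (ι v) k → distance (col u) (col v) (lev u v) ≤ k
  ι-distance-≥ {u} {v} {k} u≢v d = subst₂ _≤_ (height-leaf u u≢v) (trans (cong (k +_) (height-own u)) (+-identityʳ k))
    (potential (height u) (height-lipschitz u) {leaf u} {leaf v} d)

  Dist-unique : ∀ {u v k} → u ≢ v → Dist (Edge graph) (ι u) (ι v) k → k ≡ distance (col u) (col v) (lev u v)
  Dist-unique {u} {v} u≢v (near , far) = ≤-antisym (≮⇒≥ λ lt → far _ lt (distLE (leaf-distance u v))) (ι-distance-≥ u≢v near)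

  two-neighbours : ∀ {w a b} → Sym w a → Sym w b → a ≢ b → deg graph (to w) ≢ 1
  two-neighbours wa wb a≢b one = a≢b (to-injective (deg-one-unique graph one (edge⇐ wa) (edge⇐ wb)))

  leaf-neighbour : ∀ {v w} → Sym (leaf v) w → w ≡ inj₂ (v , suc zero)
  leaf-neighbour (inj₁ (joint (inj₁ ())))
  leaf-neighbour (inj₁ (joint (inj₂ ())))
  leaf-neighbour {v} (inj₁ (segment eq)) = cong (λ s → inj₂ (v , s)) (Fin.toℕ-injective eq)
  leaf-neighbour (inj₂ (segment ()))

  leaf-degree : ∀ v → deg graph (ι v) ≡ 1
  leaf-degree v = deg-one graph (edge⇐ {leaf v} {inj₂ (v , suc zero)} (inj₁ (segment refl))) λ z e →
    trans (sym (to-from z)) (cong to (leaf-neighbour (subst (λ w → Sym w (from z)) (from-to (leaf v)) (edge⇒ e))))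

  degree-leaf : ∀ w → deg graph (to w) ≡ 1 → ∃ λ v → leaf v ≡ w
  degree-leaf (inj₁ (x , zero)) one = contradiction one
    (two-neighbours (inj₁ (triangle {s = suc zero} λ ())) (inj₁ (triangle {s = suc (suc zero)} λ ())) λ ())
  degree-leaf (inj₁ (x , suc zero)) one = contradiction one
    (two-neighbours (inj₁ (triangle {s = zero} λ ())) (inj₁ (triangle {s = suc (suc zero)} λ ())) λ ())
  degree-leaf (inj₁ (x , suc (suc zero))) one = contradiction one
    (two-neighbours (inj₁ (triangle {s = zero} λ ())) (inj₁ (triangle {s = suc zero} λ ())) λ ())
  degree-leaf (inj₂ (v , zero)) one = v , refl
  degree-leaf (inj₂ (v , suc s)) one with m≤n⇒m<n∨m≡n (Fin.toℕ<n s)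
  -- At the far end the second neighbour is the tree node, by the joint at `armMax`.
  ... | inj₂ end = contradiction one (two-neighbours {a = inj₂ (v , Fin.inject₁ s)}
    (inj₂ (segment (cong suc (sym (Fin.toℕ-inject₁ s))))) (inj₁ (joint (inj₂ end))) λ ())
  ... | inj₁ lt = contradiction one (two-neighbours {a = inj₂ (v , Fin.inject₁ s)} {inj₂ (v , Fin.fromℕ< (s≤s lt))}
    (inj₂ (segment (cong suc (sym (Fin.toℕ-inject₁ s))))) (inj₁ (segment (Fin.toℕ-fromℕ< (s≤s lt))))
    λ eq → <⇒≢ (≤-trans (≤-reflexive (cong suc (Fin.toℕ-inject₁ s))) (n≤1+n _))
      (trans (cong toℕ (Product.,-injectiveʳ (Sum.inj₂-injective eq))) (Fin.toℕ-fromℕ< (s≤s lt))))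

  -- `Cond3` has one number for the diameter, the range of the signature and the treedepth, hence
  -- the sum of three bounds.
  bound : ℕ
  bound = (radius + radius) + distance-bound + treedepthBound

  S-range : ∀ i j l → distanceS S i j l ≡ true → 1 ≤ l × l ≤ bound
  S-range _ _ l eq with does⇒ (decodes? S l) eq
  ... | (i , j , e) , refl , _ = s≤s z≤n ,
    ≤-trans (distance-≤ i j (toℕ e)) (≤-trans (m≤n+m _ (radius + radius)) (m≤m+n _ treedepthBound))

  correct : ∀ u v l → Dist (Edge graph) (ι u) (ι v) l → Edge G u v ⇔ distanceS S zero zero l ≡ true
  correct u v l dist with u Fin.≟ v
  -- The condition includes `u ≡ v`, at distance 0, which lies outside the range of the signature;
  -- both sides are false.
  ... | yes refl = mk⇔ (λ uu → contradiction (trans (sym (Graph.irrefl G u)) uu) λ ())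
    λ eq → contradiction DistLE-refl (proj₂ dist 0 (proj₁ (S-range zero zero l eq)))
  ... | no u≢v = mk⇔ encode decode
    where
    encode : Edge G u v → distanceS S zero zero l ≡ true
    encode uv = dec-true (decodes? S l) ((col u , col v , Fin.fromℕ< (s≤s (lev-≤ u v))) ,
      trans (Dist-unique u≢v dist) (cong (distance (col u) (col v)) (sym l≡)) ,
      trans (cong (S (col u) (col v)) l≡) (trans (sym (adj-S u v u≢v)) uv))
      where
      l≡ : toℕ (Fin.fromℕ< (s≤s (lev-≤ u v))) ≡ lev u v
      l≡ = Fin.toℕ-fromℕ< _
    decode : distanceS S zero zero l ≡ true → Edge G u v
    decode eq with does⇒ (decodes? S l) eq
    ... | (i , j , e) , l≡ , Sij with distance-decode {col u} {col v} {lev u v} {i} {j} {toℕ e}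
      (lev-≤ u v) (≤-pred (Fin.toℕ<n e)) (trans (sym (Dist-unique u≢v dist)) l≡)
    ...   | e≡ , inj₁ (refl , refl) = trans (adj-S u v u≢v) (trans (cong (S (col u) (col v)) e≡) Sij)
    -- The colours may come out in the opposite order; then the adjacency of `v` and `u` is read
    -- off.
    ...   | e≡ , inj₂ (refl , refl) = trans (Graph.sym G u v) (trans (adj-S v u (u≢v ∘ sym))
      (trans (cong (S (col v) (col u)) (trans (lev-sym v u) e≡)) Sij))

  shrubDec : ShrubDec G 1 bound (distanceS S)
  shrubDec = record
    { F = graph ; ι = ι ; ι-inj = λ eq → Product.,-injectiveˡ (Sum.inj₂-injective (to-injective eq))
    ; leaves = λ x → mk⇔
        (λ one → Product.map₂ (λ eq → trans (cong to eq) (to-from x))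
          (degree-leaf (from x) (subst (λ x → deg graph x ≡ 1) (sym (to-from x)) one)))
        (λ { (v , refl) → leaf-degree v })
    ; diam = λ x y → DistLE-mono (≤-trans (m≤m+n _ distance-bound) (m≤m+n _ treedepthBound)) (shrub-diam x y)
    ; col = λ _ → zero
    ; S-range = S-range ; S-sym = λ _ _ _ → refl
    ; correct = correct }

Decomposable⇒Cond3 : ∀ {𝒢} → Decomposable 𝒢 → Cond3 𝒢
Decomposable⇒Cond3 {𝒢} (D , M , S , model) = shrubBound , Distances.distanceS D M S , λ G G∈ →
  ShrubModel.shrubDec (model G G∈) ,
  TreedepthLE'-mono (m≤n+m (suc D * 3 + suc armMax) ((armMax + suc D + (armMax + suc D)) + distance-bound))
    (ShrubModel.shrub-treedepth (model G G∈))
  where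
  open Distances D M
  -- This is `ShrubModel.bound` restated without a graph, because the number has to be given before
  -- `G`.
  shrubBound : ℕ
  shrubBound = (armMax + suc D + (armMax + suc D)) + distance-bound + (suc D * 3 + suc armMax)

theorem7 : (𝒢 : GraphClass) →
    (Cond1 𝒢 ⇔ Cond2 𝒢) × (Cond1 𝒢 ⇔ Cond3 𝒢) × (Cond1 𝒢 ⇔ Cond4 𝒢)
theorem7 𝒢 =
  mk⇔ (Decomposable⇒Cond2 ∘ Cond1⇒Decomposable) Cond2⇒Cond1 ,
  mk⇔ (Decomposable⇒Cond3 ∘ Cond1⇒Decomposable) Cond3⇒Cond1 ,
  mk⇔ (Decomposable⇒Cond4 ∘ Cond1⇒Decomposable) Cond4⇒Cond1
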